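{- There is an algorithm that, given a metric $(V,\mathrm{d})$ with treewidth $\omega\ge 1$ and $|V|=n$, a set of terminals $\mathcal{X}\subseteq V$, a root $r\in\mathcal{X}$ and an integer $k\ge 1$, computes a minimum-cost $k$-hop Steiner tree exactly and has running time $n^{O(\omega k)}$.
   Context: A graph $G=(V,E)$ with a positive edge-weight function induces the finite metric space $(V,\mathrm{d})$ if for all $u,v\in V$ the length of a shortest $u$-$v$ path in $G$ equals $\mathrm{d}(u,v)$. The metric is assumed to be given by a graph inducing it. A graph $G=(V,E)$ has treewidth $\omega$ if there is a tree $T_G=(B,E_B)$ (a tree decomposition) whose nodes $b\in B$ are identified with subsets $S_b\subseteq V$, called bags, such that (i) for each edge in $E$ some bag contains both endpoints; (ii) for each vertex in $V$, the nodes whose bags contain it form a connected subtree of $T_G$; (iii) each bag contains at most $\omega+1$ vertices. A metric $(V,\mathrm{d})$ has treewidth $\omega$ if there is a weighted graph $G=(V,E)$ with treewidth $\omega$ that induces it. Given a finite metric space $(V,\mathrm{d})$ with $\mathrm{d}:V\times V\to\mathbb{Q}_+$, terminals $\mathcal{X}\subseteq V$, a root $r\in\mathcal{X}$ and an integer $k\ge1$, a $k$-hop Steiner tree is a tree $S=(V_S,E_S)$ rooted at $r$ with $\mathcal{X}\subseteq V_S\subseteq V$ whose edges are arbitrary pairs of points of $V_S$ (not necessarily edges of a graph inducing the metric), such that for every $v\in V_S$ the $r$-$v$ path in $S$ has at most $k$ edges. Its cost is $\sum_{\{u,v\}\in E_S}\mathrm{d}(u,v)$. A minimum-cost $k$-hop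 Steiner tree is a $k$-hop Steiner tree of minimum cost. -}

module Defs where

open import Data.Bool using (Bool; true; false; _∧_; T; if_then_else_)
open import Data.Bool.Properties using (∧-comm)
open import Data.Fin using (Fin; toℕ; _<?_)
open import Data.Fin.Subset using (Subset; _∈_; _⊆_; ∣_∣; ⊤; Nonempty)
open import Data.List using (List; []; _∷_; map; foldr; filter; cartesianProduct; allFin)
import Data.List as List
import Data.List.Membership.Propositional as List
open import Data.List.Relation.Unary.All using (All; []; _∷_)
import Data.List.Relation.Unary.All as All
open import Data.List.Relation.Unary.Unique.Propositional using (Unique)
open import Data.Nat using (ℕ; suc; _≤_)
import Data.Nat as ℕ
open import Data.Product using (_×_; _,_; ∃-syntax)
open import Data.Rational using (ℚ; 0ℚ)
import Data.Rational as ℚ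
open import Data.Vec using (lookup; tabulate; toList)
open import Relation.Binary.Construct.Closure.ReflexiveTransitive using (Star; ε; _◅_)
open import Relation.Binary.PropositionalEquality using (_≡_; cong; cong₂)
open import Relation.Nullary using (¬_)
open import Relation.Nullary.Decidable using (_×-dec_; T?)

------------------------------------------------------------------------
-- Graphs

record Graph (n : ℕ) : Set where
  field
    adj        : Fin n → Fin n → Bool
    adj-sym    : ∀ u v → adj u v ≡ adj v u
    adj-irrefl : ∀ v → adj v v ≡ false

  Adj : Fin n → Fin n → Set
  Adj u v = T (adj u v)

  Walk : Fin n → Fin n → Set
  Walk = Star Adj

  #edges : ∀ {u v} → Walk u v → ℕ
  #edges ε       = 0
  #edges (_ ◅ p) = suc (#edges p)

  walkVertices : ∀ {u v} → Walk u v → List (Fin n)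
  walkVertices {u} ε       = u ∷ []
  walkVertices {u} (_ ◅ p) = u ∷ walkVertices p

  length : (Fin n → Fin n → ℚ) → ∀ {u v} → Walk u v → ℚ
  length w ε                   = 0ℚ
  length w (_◅_ {u} {v} _ p)   = w u v ℚ.+ length w p

  IsPath : ∀ {u v} → Walk u v → Set
  IsPath p = Unique (walkVertices p)

  -- A cycle is a path with at least two edges closed up by one more edge.
  Acyclic : Set
  Acyclic = ∀ {u v} (p : Walk u v) → IsPath p → 2 ≤ #edges p → ¬ Adj v u

open Graph public

-- (W , G) is a tree with vertex set W; points outside W do not belong to it.
record IsTree {n} (W : Subset n) (G : Graph n) : Set where
  field
    nonempty  : Nonempty W
    edges⊆W   : ∀ {u v} → Adj G u v → u ∈ W × v ∈ W
    connected : ∀ {u v} → u ∈ W → v ∈ W → Walk G u v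
    acyclic   : Acyclic G

induced : ∀ {n} → Graph n → Subset n → Graph n
induced G W = record
  { adj        = λ u v → adj G u v ∧ (lookup W u ∧ lookup W v)
  ; adj-sym    = λ u v → cong₂ _∧_ (adj-sym G u v) (∧-comm (lookup W u) (lookup W v))
  ; adj-irrefl = λ v → cong (_∧ (lookup W v ∧ lookup W v)) (adj-irrefl G v)
  }

-- The value of `weight` on non-edges carries no meaning.
record WeightedGraph (n : ℕ) : Set where
  field
    graph      : Graph n
    weight     : Fin n → Fin n → ℚ
    weight-sym : ∀ u v → weight u v ≡ weight v u
    weight-pos : ∀ {u v} → Adj graph u v → 0ℚ ℚ.< weight u v

open WeightedGraph public

record Induces {n} (G : WeightedGraph n) (d : Fin n → Fin n → ℚ) : Set where
  field
    attained : ∀ u v → ∃[ p ] IsPath (graph G) {u} {v} p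
                            × length (graph G) (weight G) p ≡ d u v
    shortest : ∀ {u v} (p : Walk (graph G) u v) → IsPath (graph G) p →
               d u v ℚ.≤ length (graph G) (weight G) p

------------------------------------------------------------------------
-- Treewidth

record TreeDecomposition {n} (G : Graph n) (ω : ℕ) : Set where
  field
    #nodes : ℕ
    tree   : Graph #nodes
    isTree : IsTree ⊤ tree
    bag    : Fin #nodes → Subset n

  nodesContaining : Fin n → Subset #nodes
  nodesContaining v = tabulate λ b → lookup (bag b) v

  field
    edges-covered : ∀ {u v} → Adj G u v → ∃[ b ] (u ∈ bag b × v ∈ bag b)
    subtrees      : ∀ v → IsTree (nodesContaining v) (induced tree (nodesContaining v))
    bag-size      : ∀ b → ∣ bag b ∣ ≤ suc ω

MetricHasTreewidth : ∀ {n} → (Fin n → Fin n → ℚ) → ℕ → Set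
MetricHasTreewidth d ω = ∃[ H ] (Induces H d × TreeDecomposition (graph H) ω)

------------------------------------------------------------------------
-- Steiner trees

record Subtree (n : ℕ) : Set where
  field
    vertices : Subset n
    edges    : Graph n
    isTree   : IsTree vertices edges

open Subtree public

record IsHopSteinerTree {n} (X : Subset n) (r : Fin n) (k : ℕ) (S : Subtree n) : Set where
  field
    terminals : X ⊆ vertices S
    hops      : ∀ {v} → v ∈ vertices S → (p : Walk (edges S) r v) →
                IsPath (edges S) p → #edges (edges S) p ≤ k

-- Each undirected edge is listed once, as the pair (u , v) with u < v.
edgeList : ∀ {n} → Graph n → List (Fin n × Fin n)
edgeList {n} G = filter (λ (u , v) → (u <? v) ×-dec T? (adj G u v))
                        (cartesianProduct (allFin n) (allFin n))

cost : ∀ {n} → (Fin n → Fin n → ℚ) → Subtree n → ℚ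
cost d S = foldr ℚ._+_ 0ℚ (map (λ (u , v) → d u v) (edgeList (edges S)))

record IsMinimumHopSteinerTree {n} (d : Fin n → Fin n → ℚ) (X : Subset n) (r : Fin n)
                               (k : ℕ) (S : Subtree n) : Set where
  field
    isHopSteinerTree : IsHopSteinerTree X r k S
    minimum          : ∀ S′ → IsHopSteinerTree X r k S′ → cost d S ℚ.≤ cost d S′

------------------------------------------------------------------------
-- Model of computation
--
-- Algorithms are terms of a call-by-value functional language with general
-- recursion; the running time is the number of rules in the evaluation
-- derivation. With environments and data shared by pointers, every rule takes
-- a constant number of steps on a RAM (the contexts inside a fixed term have
-- bounded length), so time bounds here are RAM time bounds. The only unit-cost
-- operations on rationals are addition and comparison, and naturals can only be
-- incremented, decremented and tested for zero, so that unit cost hides no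
-- computational power.

infixr 5 _⇒_
infixr 6 _⊕_
infixr 7 _⊗_

data Ty : Set where
  unit nat rat : Ty
  _⊗_ _⊕_ _⇒_  : Ty → Ty → Ty
  list         : Ty → Ty

bool : Ty
bool = unit ⊕ unit

Ctx : Set
Ctx = List Ty

data Tm (Γ : Ctx) : Ty → Set where
  var      : ∀ {A} → A List.∈ Γ → Tm Γ A
  -- `fun` binds its argument (first) and the function itself (second).
  fun      : ∀ {A B} → Tm (A ∷ (A ⇒ B) ∷ Γ) B → Tm Γ (A ⇒ B)
  app      : ∀ {A B} → Tm Γ (A ⇒ B) → Tm Γ A → Tm Γ B
  tt       : Tm Γ unit
  zero     : Tm Γ nat
  suc      : Tm Γ nat → Tm Γ nat
  caseℕ    : ∀ {A} → Tm Γ nat → Tm Γ A → Tm (nat ∷ Γ) A → Tm Γ A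
  rational : ℚ → Tm Γ rat
  add      : Tm Γ rat → Tm Γ rat → Tm Γ rat
  leq      : Tm Γ rat → Tm Γ rat → Tm Γ bool
  pair     : ∀ {A B} → Tm Γ A → Tm Γ B → Tm Γ (A ⊗ B)
  fst      : ∀ {A B} → Tm Γ (A ⊗ B) → Tm Γ A
  snd      : ∀ {A B} → Tm Γ (A ⊗ B) → Tm Γ B
  inl      : ∀ {A B} → Tm Γ A → Tm Γ (A ⊕ B)
  inr      : ∀ {A B} → Tm Γ B → Tm Γ (A ⊕ B)
  case⊕    : ∀ {A B C} → Tm Γ (A ⊕ B) → Tm (A ∷ Γ) C → Tm (B ∷ Γ) C → Tm Γ C
  nil      : ∀ {A} → Tm Γ (list A)
  cons     : ∀ {A} → Tm Γ A → Tm Γ (list A) → Tm Γ (list A)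
  caseList : ∀ {A B} → Tm Γ (list A) → Tm Γ B → Tm (A ∷ list A ∷ Γ) B → Tm Γ B

data Val : Ty → Set where
  tt   : Val unit
  nat  : ℕ → Val nat
  rat  : ℚ → Val rat
  pair : ∀ {A B} → Val A → Val B → Val (A ⊗ B)
  inl  : ∀ {A B} → Val A → Val (A ⊕ B)
  inr  : ∀ {A B} → Val B → Val (A ⊕ B)
  nil  : ∀ {A} → Val (list A)
  cons : ∀ {A} → Val A → Val (list A) → Val (list A)
  clo  : ∀ {Γ A B} → All Val Γ → Tm (A ∷ (A ⇒ B) ∷ Γ) B → Val (A ⇒ B)

Env : Ctx → Set
Env = All Val

boolVal : Bool → Val bool
boolVal true  = inl tt
boolVal false = inr tt

infix 3 _⊢_⇓_∣_

-- ρ ⊢ e ⇓ v ∣ t : in environment ρ, e evaluates to v in t steps.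
data _⊢_⇓_∣_ {Γ} (ρ : Env Γ) : ∀ {A} → Tm Γ A → Val A → ℕ → Set where
  ⇓var : ∀ {A} (x : A List.∈ Γ) →
         ρ ⊢ var x ⇓ All.lookup ρ x ∣ 1
  ⇓fun : ∀ {A B} {e : Tm (A ∷ (A ⇒ B) ∷ Γ) B} →
         ρ ⊢ fun e ⇓ clo ρ e ∣ 1
  ⇓app : ∀ {Δ A B} {σ : Env Δ} {b : Tm (A ∷ (A ⇒ B) ∷ Δ) B} {f a v w i j l} →
         ρ ⊢ f ⇓ clo σ b ∣ i → ρ ⊢ a ⇓ v ∣ j → v ∷ clo σ b ∷ σ ⊢ b ⇓ w ∣ l →
         ρ ⊢ app f a ⇓ w ∣ suc (i ℕ.+ j ℕ.+ l)
  ⇓tt  : ρ ⊢ tt ⇓ tt ∣ 1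
  ⇓zero : ρ ⊢ zero ⇓ nat 0 ∣ 1
  ⇓suc  : ∀ {e m i} → ρ ⊢ e ⇓ nat m ∣ i → ρ ⊢ suc e ⇓ nat (suc m) ∣ suc i
  ⇓caseℕ-zero : ∀ {A e} {z : Tm Γ A} {s v i j} →
         ρ ⊢ e ⇓ nat 0 ∣ i → ρ ⊢ z ⇓ v ∣ j →
         ρ ⊢ caseℕ e z s ⇓ v ∣ suc (i ℕ.+ j)
  ⇓caseℕ-suc  : ∀ {A e} {z : Tm Γ A} {s v m i j} →
         ρ ⊢ e ⇓ nat (suc m) ∣ i → nat m ∷ ρ ⊢ s ⇓ v ∣ j →
         ρ ⊢ caseℕ e z s ⇓ v ∣ suc (i ℕ.+ j)
  ⇓rational : ∀ {q} → ρ ⊢ rational q ⇓ rat q ∣ 1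
  ⇓add : ∀ {e f p q i j} → ρ ⊢ e ⇓ rat p ∣ i → ρ ⊢ f ⇓ rat q ∣ j →
         ρ ⊢ add e f ⇓ rat (p ℚ.+ q) ∣ suc (i ℕ.+ j)
  ⇓leq : ∀ {e f p q i j} → ρ ⊢ e ⇓ rat p ∣ i → ρ ⊢ f ⇓ rat q ∣ j →
         ρ ⊢ leq e f ⇓ boolVal (p ℚ.≤ᵇ q) ∣ suc (i ℕ.+ j)
  ⇓pair : ∀ {A B} {e : Tm Γ A} {f : Tm Γ B} {v w i j} →
         ρ ⊢ e ⇓ v ∣ i → ρ ⊢ f ⇓ w ∣ j →
         ρ ⊢ pair e f ⇓ pair v w ∣ suc (i ℕ.+ j)
  ⇓fst : ∀ {A B} {e : Tm Γ (A ⊗ B)} {v w i} →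
         ρ ⊢ e ⇓ pair v w ∣ i → ρ ⊢ fst e ⇓ v ∣ suc i
  ⇓snd : ∀ {A B} {e : Tm Γ (A ⊗ B)} {v w i} →
         ρ ⊢ e ⇓ pair v w ∣ i → ρ ⊢ snd e ⇓ w ∣ suc i
  ⇓inl : ∀ {A B} {e : Tm Γ A} {v i} →
         ρ ⊢ e ⇓ v ∣ i → ρ ⊢ inl {B = B} e ⇓ inl v ∣ suc i
  ⇓inr : ∀ {A B} {e : Tm Γ B} {v i} →
         ρ ⊢ e ⇓ v ∣ i → ρ ⊢ inr {A = A} e ⇓ inr v ∣ suc i
  ⇓case⊕-inl : ∀ {A B C} {e : Tm Γ (A ⊕ B)} {f : Tm (A ∷ Γ) C} {g v w i j} →
         ρ ⊢ e ⇓ inl v ∣ i → v ∷ ρ ⊢ f ⇓ w ∣ j →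
         ρ ⊢ case⊕ e f g ⇓ w ∣ suc (i ℕ.+ j)
  ⇓case⊕-inr : ∀ {A B C} {e : Tm Γ (A ⊕ B)} {f : Tm (A ∷ Γ) C} {g v w i j} →
         ρ ⊢ e ⇓ inr v ∣ i → v ∷ ρ ⊢ g ⇓ w ∣ j →
         ρ ⊢ case⊕ e f g ⇓ w ∣ suc (i ℕ.+ j)
  ⇓nil  : ∀ {A} → ρ ⊢ nil {A = A} ⇓ nil ∣ 1
  ⇓cons : ∀ {A} {e : Tm Γ A} {f v vs i j} →
         ρ ⊢ e ⇓ v ∣ i → ρ ⊢ f ⇓ vs ∣ j →
         ρ ⊢ cons e f ⇓ cons v vs ∣ suc (i ℕ.+ j)
  ⇓caseList-nil  : ∀ {A B} {e : Tm Γ (list A)} {f : Tm Γ B} {g w i j} →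
         ρ ⊢ e ⇓ nil ∣ i → ρ ⊢ f ⇓ w ∣ j →
         ρ ⊢ caseList e f g ⇓ w ∣ suc (i ℕ.+ j)
  ⇓caseList-cons : ∀ {A B} {e : Tm Γ (list A)} {f : Tm Γ B} {g v vs w i j} →
         ρ ⊢ e ⇓ cons v vs ∣ i → v ∷ vs ∷ ρ ⊢ g ⇓ w ∣ j →
         ρ ⊢ caseList e f g ⇓ w ∣ suc (i ℕ.+ j)

------------------------------------------------------------------------
-- Encoding of instances and solutions

listVal : ∀ {A} → List (Val A) → Val (list A)
listVal = foldr cons nil

matrixVal : ∀ {n A} → (Fin n → Fin n → Val A) → Val (list (list A))
matrixVal M = listVal (List.tabulate λ u → listVal (List.tabulate (M u)))

subsetVal : ∀ {n} → Subset n → Val (list bool)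
subsetVal W = listVal (map boolVal (toList W))

-- The matrix has `inr w` at an edge of weight w and `inl tt` at a non-edge.
weightedGraphVal : ∀ {n} → WeightedGraph n → Val (list (list (unit ⊕ rat)))
weightedGraphVal G = matrixVal λ u v →
  if adj (graph G) u v then inr (rat (weight G u v)) else inl tt

Instance : Ty
Instance = list (list (unit ⊕ rat)) ⊗ list bool ⊗ nat ⊗ nat

-- Neither the metric nor its treewidth is part of the input.
instanceVal : ∀ {n} → WeightedGraph n → Subset n → Fin n → ℕ → Val Instance
instanceVal G X r k =
  pair (weightedGraphVal G) (pair (subsetVal X) (pair (nat (toℕ r)) (nat k)))

Solution : Ty
Solution = list bool ⊗ list (list bool)

solutionVal : ∀ {n} → Subtree n → Val Solution
solutionVal S =
  pair (subsetVal (vertices S)) (matrixVal λ u v → boolVal (adj (edges S) u v))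

Algorithm : Set
Algorithm = Tm (Instance ∷ []) Solution

_on_returns_within_ : Algorithm → Val Instance → Val Solution → ℕ → Set
alg on x returns y within b = ∃[ t ] ((x ∷ [] ⊢ alg ⇓ y ∣ t) × t ≤ b)

{-# OPTIONS --safe #-}

-- A k-hop Steiner tree is encoded by labelling every point v with a row: for each
-- level i ≤ k the point of level at most i that is nearest to v. A point belongs to
-- the tree when it occurs in its own row, and its parent is the entry one level
-- below. With a common tie-breaking the rows of an optimal tree satisfy: if u lies
-- on a shortest path from v to an entry of v, then u has the same entry. Conversely,
-- this condition on the pairs u v with no third point between them already makes
-- the entries consistent, since an entry is handed on along a shortest path until
-- it reaches the point itself. These pairs form a subgraph of every graph that
-- induces the metric. Hence minimum-cost k-hop Steiner trees are the optimal
-- solutions of a binary constraint problem with n ^ k labels on a graph of treewidth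
-- at most ω.
--
-- This problem is solved without a given tree decomposition. For each labelled bag
-- τ and each point x, a table holds an optimal labelling, compatible with τ, of the
-- component of x in the graph without the bag; n rounds suffice, because the
-- components shrink. An entry is filled only if it certifies a decomposition, so
-- the bag size can be increased until the whole graph is solved, which happens at
-- the latest for bags of ω + 1 points.
--
-- Programs are written in a total language with structural loops. Its evaluator
-- gives their meaning, and an abstract interpretation, which bounds all sizes by
-- powers of n ^ (ω * k), their running time.
module Submission where

open import Defs
open import Data.Bool as Bool using (Bool; true; false; if_then_else_; _∧_; T; not; _∨_)
open import Data.Bool.Properties using (T-∧; ∧-comm; ∨-comm)
open import Data.Empty using (⊥; ⊥-elim)
open import Data.Fin as Fin using (Fin; zero; suc; toℕ; fromℕ<)
import Data.Fin.Properties as Fin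
open import Data.Fin.Subset as Subset using (Subset; ∣_∣; _∈_)
import Data.Fin.Subset.Properties as Subset
open import Data.List as List using (List; []; _∷_; map; foldr; tabulate; allFin; _++_; replicate; filter; cartesianProduct)
open import Data.List.Membership.Propositional using () renaming (_∈_ to _∈ˡ_)
open import Data.List.Membership.Propositional.Properties using (∈-lookup; ∈-map⁺; ∈-map⁻; ∈-allFin; ∈-++⁺ˡ; ∈-++⁻)
open import Data.List.Properties using (length-map; map-tabulate; length-tabulate; map-∘; length-++; length-replicate; tabulate-cong)
open import Data.List.Relation.Unary.All as All using (All; []; _∷_)
import Data.List.Relation.Unary.All.Properties as All
open import Data.List.Relation.Unary.AllPairs using ([]; _∷_)
open import Data.List.Relation.Unary.Any using (here; there)
open import Data.List.Relation.Unary.Unique.Propositional using (Unique)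
open import Data.Maybe using (Maybe; just; nothing)
open import Data.Maybe.Properties using (just-injective)
open import Data.Nat as ℕ using (ℕ; zero; suc; _+_; _*_; _^_; _⊔_; _≤_; z≤n; s≤s)
open import Data.Nat.Induction using (<-wellFounded)
import Data.Nat.Properties as ℕ
open import Data.Product using (Σ-syntax; ∃; ∃-syntax; _×_; _,_; proj₁; proj₂)
open import Data.Rational as ℚ using (ℚ; 0ℚ)
import Data.Rational.Properties as ℚ
open import Data.Sum using (_⊎_; inj₁; inj₂)
open import Data.Unit using (⊤; tt)
open import Data.Vec as Vec using (lookup)
import Data.Vec.Properties as Vec
open import Function using (_∘_; Equivalence; id)
open import Function.Metric.Rational using (IsMetric; module IsMetric)
open import Induction.WellFounded as WF using (Acc)
open import Relation.Binary.Construct.Closure.ReflexiveTransitive using (ε; _◅_; _◅◅_)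
open import Relation.Binary.Definitions using (tri<; tri≈; tri>)
open import Relation.Binary.PropositionalEquality using (_≡_; refl; sym; trans; cong; cong₂; subst; _≢_; subst₂)
open import Relation.Nullary using (¬_; Dec; yes; no; does)
open import Relation.Nullary.Decidable using (dec-true; dec-false; _×-dec_; T?)

infixr 7 _×ᵗ_

data Type : Set where
  boolᵗ natᵗ ratᵗ : Type
  _×ᵗ_            : Type → Type → Type
  maybeᵗ listᵗ    : Type → Type

⌜_⌝ : Type → Ty
⌜ boolᵗ ⌝    = bool
⌜ natᵗ ⌝     = nat
⌜ ratᵗ ⌝     = rat
⌜ A ×ᵗ B ⌝   = ⌜ A ⌝ ⊗ ⌜ B ⌝
⌜ maybeᵗ A ⌝ = unit ⊕ ⌜ A ⌝
⌜ listᵗ A ⌝  = list ⌜ A ⌝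

⟦_⟧ : Type → Set
⟦ boolᵗ ⟧    = Bool
⟦ natᵗ ⟧     = ℕ
⟦ ratᵗ ⟧     = ℚ
⟦ A ×ᵗ B ⟧   = ⟦ A ⟧ × ⟦ B ⟧
⟦ maybeᵗ A ⟧ = Maybe ⟦ A ⟧
⟦ listᵗ A ⟧  = List ⟦ A ⟧

enc : ∀ A → ⟦ A ⟧ → Val ⌜ A ⌝
enc boolᵗ      b        = boolVal b
enc natᵗ       m        = nat m
enc ratᵗ       q        = rat q
enc (A ×ᵗ B)   (x , y)  = pair (enc A x) (enc B y)
enc (maybeᵗ A) nothing  = inl tt
enc (maybeᵗ A) (just x) = inr (enc A x)
enc (listᵗ A)  xs       = listVal (map (enc A) xs)

Cx : Set
Cx = List Type

Vals : Cx → Set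
Vals = All ⟦_⟧

caseN : ∀ {B : Set} → B → (ℕ → B) → ℕ → B
caseN z s zero    = z
caseN z s (suc m) = s m

caseM : ∀ {A B : Set} → B → (A → B) → Maybe A → B
caseM n j nothing  = n
caseM n j (just x) = j x

caseL : ∀ {A B : Set} → B → (A → List A → B) → List A → B
caseL n c []       = n
caseL n c (x ∷ xs) = c x xs

iter : ∀ {B : Set} → ℕ → B → (B → B) → B
iter zero    z s = z
iter (suc m) z s = s (iter m z s)

-- The arguments of a call are pushed one by one, so the last argument is
-- variable 0 of the called expression.
data Exp (Γ : Cx) : Type → Set
data Args (Γ : Cx) (Ξ : Cx) : Cx → Set

data Exp Γ where
  varᵉ   : ∀ {A} → A ∈ˡ Γ → Exp Γ A
  letᵉ   : ∀ {A B} → Exp Γ A → Exp (A ∷ Γ) B → Exp Γ B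
  trueᵉ falseᵉ : Exp Γ boolᵗ
  ifᵉ    : ∀ {A} → Exp Γ boolᵗ → Exp Γ A → Exp Γ A → Exp Γ A
  zeroᵉ  : Exp Γ natᵗ
  sucᵉ   : Exp Γ natᵗ → Exp Γ natᵗ
  caseNᵉ : ∀ {A} → Exp Γ natᵗ → Exp Γ A → Exp (natᵗ ∷ Γ) A → Exp Γ A
  0ℚᵉ    : Exp Γ ratᵗ
  addᵉ   : Exp Γ ratᵗ → Exp Γ ratᵗ → Exp Γ ratᵗ
  leqᵉ   : Exp Γ ratᵗ → Exp Γ ratᵗ → Exp Γ boolᵗ
  pairᵉ  : ∀ {A B} → Exp Γ A → Exp Γ B → Exp Γ (A ×ᵗ B)
  fstᵉ   : ∀ {A B} → Exp Γ (A ×ᵗ B) → Exp Γ A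
  sndᵉ   : ∀ {A B} → Exp Γ (A ×ᵗ B) → Exp Γ B
  noneᵉ  : ∀ {A} → Exp Γ (maybeᵗ A)
  someᵉ  : ∀ {A} → Exp Γ A → Exp Γ (maybeᵗ A)
  caseMᵉ : ∀ {A B} → Exp Γ (maybeᵗ A) → Exp Γ B → Exp (A ∷ Γ) B → Exp Γ B
  nilᵉ   : ∀ {A} → Exp Γ (listᵗ A)
  consᵉ  : ∀ {A} → Exp Γ A → Exp Γ (listᵗ A) → Exp Γ (listᵗ A)
  caseLᵉ : ∀ {A B} → Exp Γ (listᵗ A) → Exp Γ B → Exp (A ∷ listᵗ A ∷ Γ) B → Exp Γ B
  mapᵉ   : ∀ {A B} → Exp Γ (listᵗ A) → Exp (A ∷ Γ) B → Exp Γ (listᵗ B)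
  foldᵉ  : ∀ {A B} → Exp Γ (listᵗ A) → Exp Γ B → Exp (B ∷ A ∷ Γ) B → Exp Γ B
  iterᵉ  : ∀ {B} → Exp Γ natᵗ → Exp Γ B → Exp (B ∷ Γ) B → Exp Γ B
  callᵉ  : ∀ {Θ B} → Args Γ [] Θ → Exp Θ B → Exp Γ B

infixr 4 _▸_

data Args Γ Ξ where
  ∙   : Args Γ Ξ Ξ
  _▸_ : ∀ {A Θ} → Exp Γ A → Args Γ (A ∷ Ξ) Θ → Args Γ Ξ Θ

eval     : ∀ {Γ A} → Exp Γ A → Vals Γ → ⟦ A ⟧
evalArgs : ∀ {Γ Ξ Θ} → Args Γ Ξ Θ → Vals Γ → Vals Ξ → Vals Θ

eval (varᵉ x)       ρ = All.lookup ρ x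
eval (letᵉ e b)     ρ = eval b (eval e ρ ∷ ρ)
eval trueᵉ          ρ = true
eval falseᵉ         ρ = false
eval (ifᵉ c t e)    ρ = if eval c ρ then eval t ρ else eval e ρ
eval zeroᵉ          ρ = 0
eval (sucᵉ e)       ρ = suc (eval e ρ)
eval (caseNᵉ e z s) ρ = caseN (eval z ρ) (λ m → eval s (m ∷ ρ)) (eval e ρ)
eval 0ℚᵉ            ρ = 0ℚ
eval (addᵉ e f)     ρ = eval e ρ ℚ.+ eval f ρ
eval (leqᵉ e f)     ρ = eval e ρ ℚ.≤ᵇ eval f ρ
eval (pairᵉ e f)    ρ = eval e ρ , eval f ρ
eval (fstᵉ e)       ρ = proj₁ (eval e ρ)
eval (sndᵉ e)       ρ = proj₂ (eval e ρ)
eval noneᵉ          ρ = nothing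
eval (someᵉ e)      ρ = just (eval e ρ)
eval (caseMᵉ e n j) ρ = caseM (eval n ρ) (λ x → eval j (x ∷ ρ)) (eval e ρ)
eval nilᵉ           ρ = []
eval (consᵉ e f)    ρ = eval e ρ ∷ eval f ρ
eval (caseLᵉ e n c) ρ = caseL (eval n ρ) (λ x xs → eval c (x ∷ xs ∷ ρ)) (eval e ρ)
eval (mapᵉ e b)     ρ = map (λ x → eval b (x ∷ ρ)) (eval e ρ)
eval (foldᵉ e z s)  ρ = foldr (λ x acc → eval s (acc ∷ x ∷ ρ)) (eval z ρ) (eval e ρ)
eval (iterᵉ e z s)  ρ = iter (eval e ρ) (eval z ρ) (λ acc → eval s (acc ∷ ρ))
eval (callᵉ as b)   ρ = eval b (evalArgs as ρ [])

evalArgs ∙        ρ ξ = ξ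
evalArgs (a ▸ as) ρ ξ = evalArgs as ρ (eval a ρ ∷ ξ)

mapSteps : ∀ {A : Set} → (A → ℕ) → List A → ℕ
mapSteps c []       = 2 + 1
mapSteps c (x ∷ xs) = suc (1 + suc (c x + suc (1 + 1 + mapSteps c xs)))

foldSteps : ∀ {A B : Set} → (A → B → B) → B → ℕ → (A → B → ℕ) → List A → ℕ
foldSteps f z i c []       = suc (1 + i)
foldSteps f z i c (x ∷ xs) =
  suc (1 + suc (1 + suc (1 + 1 + foldSteps f z i c xs) + c x (foldr f z xs)))

iterSteps : ∀ {B : Set} → B → (B → B) → ℕ → (B → ℕ) → ℕ → ℕ
iterSteps z f i c zero    = suc (1 + i)
iterSteps z f i c (suc m) =
  suc (1 + suc (1 + suc (1 + 1 + iterSteps z f i c m) + c (iter m z f)))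

steps     : ∀ {Γ A} → Exp Γ A → Vals Γ → ℕ
stepsArgs : ∀ {Γ Ξ Θ B} → Args Γ Ξ Θ → Exp Θ B → Vals Γ → Vals Ξ → ℕ

steps (varᵉ x)       ρ = 1
steps (letᵉ e b)     ρ = suc (1 + steps e ρ + steps b (eval e ρ ∷ ρ))
steps trueᵉ          ρ = 2
steps falseᵉ         ρ = 2
steps (ifᵉ c t e)    ρ = suc (steps c ρ + (if eval c ρ then steps t ρ else steps e ρ))
steps zeroᵉ          ρ = 1
steps (sucᵉ e)       ρ = suc (steps e ρ)
steps (caseNᵉ e z s) ρ = suc (steps e ρ + caseN (steps z ρ) (λ m → steps s (m ∷ ρ)) (eval e ρ))
steps 0ℚᵉ            ρ = 1
steps (addᵉ e f)     ρ = suc (steps e ρ + steps f ρ)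
steps (leqᵉ e f)     ρ = suc (steps e ρ + steps f ρ)
steps (pairᵉ e f)    ρ = suc (steps e ρ + steps f ρ)
steps (fstᵉ e)       ρ = suc (steps e ρ)
steps (sndᵉ e)       ρ = suc (steps e ρ)
steps noneᵉ          ρ = 2
steps (someᵉ e)      ρ = suc (steps e ρ)
steps (caseMᵉ e n j) ρ = suc (steps e ρ + caseM (steps n ρ) (λ x → steps j (x ∷ ρ)) (eval e ρ))
steps nilᵉ           ρ = 1
steps (consᵉ e f)    ρ = suc (steps e ρ + steps f ρ)
steps (caseLᵉ e n c) ρ =
  suc (steps e ρ + caseL (steps n ρ) (λ x xs → steps c (x ∷ xs ∷ ρ)) (eval e ρ))
steps (mapᵉ e b)     ρ = suc (1 + steps e ρ + mapSteps (λ x → steps b (x ∷ ρ)) (eval e ρ))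
steps (foldᵉ e z s)  ρ =
  suc (1 + steps e ρ + foldSteps (λ x acc → eval s (acc ∷ x ∷ ρ)) (eval z ρ)
                                (steps z ρ) (λ x acc → steps s (acc ∷ x ∷ ρ)) (eval e ρ))
steps (iterᵉ e z s)  ρ =
  suc (1 + steps e ρ + iterSteps (eval z ρ) (λ acc → eval s (acc ∷ ρ))
                                (steps z ρ) (λ acc → steps s (acc ∷ ρ)) (eval e ρ))
steps (callᵉ as b)   ρ = stepsArgs as b ρ []

stepsArgs ∙        b ρ ξ = steps b ξ
stepsArgs (a ▸ as) b ρ ξ = suc (1 + steps a ρ + stepsArgs as b ρ (eval a ρ ∷ ξ))

-- Compilation

Ren : Cx → Ctx → Set
Ren Γ Δ = ∀ {A} → A ∈ˡ Γ → ⌜ A ⌝ ∈ˡ Δ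

wk : ∀ {Γ Δ B} → Ren Γ Δ → Ren Γ (B ∷ Δ)
wk r x = there (r x)

cons-ren : ∀ {Γ Δ A} → ⌜ A ⌝ ∈ˡ Δ → Ren Γ Δ → Ren (A ∷ Γ) Δ
cons-ren y r (here refl) = y
cons-ren y r (there x)   = r x

pattern i0 = here refl
pattern i1 = there i0
pattern i2 = there i1
pattern i3 = there i2

compile     : ∀ {Γ Δ A} → Exp Γ A → Ren Γ Δ → Tm Δ ⌜ A ⌝
compileArgs : ∀ {Γ Ξ Θ Δ B} → Args Γ Ξ Θ → Exp Θ B → Ren Γ Δ → Ren Ξ Δ → Tm Δ ⌜ B ⌝

compile (varᵉ x)       r = var (r x)
compile (letᵉ e b)     r = app (fun (compile b (cons-ren i0 (wk (wk r))))) (compile e r)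
compile trueᵉ          r = inl tt
compile falseᵉ         r = inr tt
compile (ifᵉ c t e)    r = case⊕ (compile c r) (compile t (wk r)) (compile e (wk r))
compile zeroᵉ          r = zero
compile (sucᵉ e)       r = suc (compile e r)
compile (caseNᵉ e z s) r = caseℕ (compile e r) (compile z r) (compile s (cons-ren i0 (wk r)))
compile 0ℚᵉ            r = rational 0ℚ
compile (addᵉ e f)     r = add (compile e r) (compile f r)
compile (leqᵉ e f)     r = leq (compile e r) (compile f r)
compile (pairᵉ e f)    r = pair (compile e r) (compile f r)
compile (fstᵉ e)       r = fst (compile e r)
compile (sndᵉ e)       r = snd (compile e r)
compile noneᵉ          r = inl tt
compile (someᵉ e)      r = inr (compile e r)
compile (caseMᵉ e n j) r = case⊕ (compile e r) (compile n (wk r)) (compile j (cons-ren i0 (wk r)))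
compile nilᵉ           r = nil
compile (consᵉ e f)    r = cons (compile e r) (compile f r)
compile (caseLᵉ e n c) r =
  caseList (compile e r) (compile n r) (compile c (cons-ren i0 (cons-ren i1 (wk (wk r)))))
compile (mapᵉ e b)     r =
  app (fun (caseList (var i0) nil
             (cons (compile b (cons-ren i0 (wk (wk (wk (wk r))))))
                   (app (var i3) (var i1)))))
      (compile e r)
compile (foldᵉ e z s)  r =
  app (fun (caseList (var i0) (compile z (wk (wk r)))
             (app (fun (compile s (cons-ren i0 (cons-ren i2 (wk (wk (wk (wk (wk (wk r))))))))))
                  (app (var i3) (var i1)))))
      (compile e r)
compile (iterᵉ e z s)  r =
  app (fun (caseℕ (var i0) (compile z (wk (wk r)))
             (app (fun (compile s (cons-ren i0 (wk (wk (wk (wk (wk r))))))))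
                  (app (var i2) (var i0)))))
      (compile e r)
compile (callᵉ as b)   r = compileArgs as b r (λ ())

compileArgs ∙        b r s = compile b s
compileArgs (a ▸ as) b r s =
  app (fun (compileArgs as b (wk (wk r)) (cons-ren i0 (wk (wk s))))) (compile a r)

record Agrees {Γ Δ} (r : Ren Γ Δ) (σ : Env Δ) (ρ : Vals Γ) : Set where
  constructor agrees
  field lookup-≡ : ∀ {A} (x : A ∈ˡ Γ) → All.lookup σ (r x) ≡ enc A (All.lookup ρ x)
open Agrees

agrees-wk : ∀ {Γ Δ B} {v : Val B} {r : Ren Γ Δ} {σ : Env Δ} {ρ : Vals Γ} →
            Agrees r σ ρ → Agrees (wk r) (v ∷ σ) ρ
agrees-wk ag .lookup-≡ x = ag .lookup-≡ x

agrees-cons : ∀ {Γ Δ A} {y : ⌜ A ⌝ ∈ˡ Δ} {r : Ren Γ Δ} {σ : Env Δ} {ρ v} →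
              All.lookup σ y ≡ enc A v → Agrees r σ ρ →
              Agrees {A ∷ Γ} (cons-ren y r) σ (v ∷ ρ)
agrees-cons p q .lookup-≡ (here refl) = p
agrees-cons p q .lookup-≡ (there x)   = q .lookup-≡ x

module _ {Δ : Ctx} {σ : Env Δ} where

  ⇓if : ∀ {A} b {c : Tm Δ bool} {t f : Tm (unit ∷ Δ) ⌜ A ⌝} {x y i j l} →
        σ ⊢ c ⇓ boolVal b ∣ i →
        tt ∷ σ ⊢ t ⇓ enc A x ∣ j → tt ∷ σ ⊢ f ⇓ enc A y ∣ l →
        σ ⊢ case⊕ c t f ⇓ enc A (if b then x else y) ∣ suc (i + (if b then j else l))
  ⇓if true  p q r = ⇓case⊕-inl p q
  ⇓if false p q r = ⇓case⊕-inr p r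

  ⇓caseN : ∀ {A} m {c : Tm Δ nat} {t s x} {y : ℕ → ⟦ A ⟧} {i j} {l : ℕ → ℕ} →
           σ ⊢ c ⇓ nat m ∣ i → σ ⊢ t ⇓ enc A x ∣ j →
           (∀ m → nat m ∷ σ ⊢ s ⇓ enc A (y m) ∣ l m) →
           σ ⊢ caseℕ c t s ⇓ enc A (caseN x y m) ∣ suc (i + caseN j l m)
  ⇓caseN zero    p q r = ⇓caseℕ-zero p q
  ⇓caseN (suc m) p q r = ⇓caseℕ-suc p (r m)

  ⇓caseM : ∀ {A B} m {c : Tm Δ (unit ⊕ ⌜ A ⌝)} {t s x} {y : ⟦ A ⟧ → ⟦ B ⟧} {i j} {l : ⟦ A ⟧ → ℕ} →
           σ ⊢ c ⇓ enc (maybeᵗ A) m ∣ i → tt ∷ σ ⊢ t ⇓ enc B x ∣ j →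
           (∀ v → enc A v ∷ σ ⊢ s ⇓ enc B (y v) ∣ l v) →
           σ ⊢ case⊕ c t s ⇓ enc B (caseM x y m) ∣ suc (i + caseM j l m)
  ⇓caseM nothing  p q r = ⇓case⊕-inl p q
  ⇓caseM (just v) p q r = ⇓case⊕-inr p (r v)

  ⇓caseL : ∀ {A B} m {c : Tm Δ (list ⌜ A ⌝)} {t s x} {y : ⟦ A ⟧ → List ⟦ A ⟧ → ⟦ B ⟧} {i j}
           {l : ⟦ A ⟧ → List ⟦ A ⟧ → ℕ} →
           σ ⊢ c ⇓ enc (listᵗ A) m ∣ i → σ ⊢ t ⇓ enc B x ∣ j →
           (∀ v vs → enc A v ∷ enc (listᵗ A) vs ∷ σ ⊢ s ⇓ enc B (y v vs) ∣ l v vs) →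
           σ ⊢ caseList c t s ⇓ enc B (caseL x y m) ∣ suc (i + caseL j l m)
  ⇓caseL []       p q r = ⇓caseList-nil p q
  ⇓caseL (v ∷ vs) p q r = ⇓caseList-cons p (r v vs)

  ⇓map : ∀ {A B} {b : Tm _ ⌜ B ⌝} {f : ⟦ A ⟧ → ⟦ B ⟧} {c : ⟦ A ⟧ → ℕ} →
         let body = caseList (var i0) nil (cons b (app (var i3) (var i1))) in
         (∀ v vs w → enc A v ∷ vs ∷ w ∷ clo σ body ∷ σ ⊢ b ⇓ enc B (f v) ∣ c v) →
         ∀ xs → enc (listᵗ A) xs ∷ clo σ body ∷ σ ⊢ body ⇓ enc (listᵗ B) (map f xs) ∣ mapSteps c xs
  ⇓map p []       = ⇓caseList-nil (⇓var i0) ⇓nil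
  ⇓map p (x ∷ xs) =
    ⇓caseList-cons (⇓var i0) (⇓cons (p x _ _) (⇓app (⇓var i3) (⇓var i1) (⇓map p xs)))

  ⇓fold : ∀ {A B} {z : Tm _ ⌜ B ⌝} {s : Tm _ ⌜ B ⌝} {f : ⟦ A ⟧ → ⟦ B ⟧ → ⟦ B ⟧} {x₀ i} {c : ⟦ A ⟧ → ⟦ B ⟧ → ℕ} →
          let body = caseList (var i0) z (app (fun s) (app (var i3) (var i1))) in
          (∀ w → w ∷ clo σ body ∷ σ ⊢ z ⇓ enc B x₀ ∣ i) →
          (∀ a w v vs u → enc B a ∷ w ∷ enc A v ∷ vs ∷ u ∷ clo σ body ∷ σ ⊢ s ⇓ enc B (f v a) ∣ c v a) →
          ∀ xs → enc (listᵗ A) xs ∷ clo σ body ∷ σ ⊢ body ⇓ enc B (foldr f x₀ xs) ∣ foldSteps f x₀ i c xs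
  ⇓fold p q []       = ⇓caseList-nil (⇓var i0) (p _)
  ⇓fold {f = f} {x₀} p q (x ∷ xs) =
    ⇓caseList-cons (⇓var i0)
      (⇓app ⇓fun (⇓app (⇓var i3) (⇓var i1) (⇓fold p q xs)) (q (foldr f x₀ xs) _ x _ _))

  ⇓iter : ∀ {B} {z : Tm _ ⌜ B ⌝} {s : Tm _ ⌜ B ⌝} {f : ⟦ B ⟧ → ⟦ B ⟧} {x₀ i} {c : ⟦ B ⟧ → ℕ} →
          let body = caseℕ (var i0) z (app (fun s) (app (var i2) (var i0))) in
          (∀ w → w ∷ clo σ body ∷ σ ⊢ z ⇓ enc B x₀ ∣ i) →
          (∀ a w v u → enc B a ∷ w ∷ v ∷ u ∷ clo σ body ∷ σ ⊢ s ⇓ enc B (f a) ∣ c a) →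
          ∀ m → nat m ∷ clo σ body ∷ σ ⊢ body ⇓ enc B (iter m x₀ f) ∣ iterSteps x₀ f i c m
  ⇓iter p q zero = ⇓caseℕ-zero (⇓var i0) (p _)
  ⇓iter {f = f} {x₀} p q (suc m) =
    ⇓caseℕ-suc (⇓var i0)
      (⇓app ⇓fun (⇓app (⇓var i2) (⇓var i0) (⇓iter p q m)) (q (iter m x₀ f) _ _ _))

compile-sound : ∀ {Γ Δ A} (e : Exp Γ A) {r : Ren Γ Δ} {σ : Env Δ} {ρ : Vals Γ} → Agrees r σ ρ →
                σ ⊢ compile e r ⇓ enc A (eval e ρ) ∣ steps e ρ
compileArgs-sound : ∀ {Γ Ξ Θ Δ B} (as : Args Γ Ξ Θ) (b : Exp Θ B) {r : Ren Γ Δ} {s : Ren Ξ Δ}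
                    {σ : Env Δ} {ρ : Vals Γ} {ξ : Vals Ξ} → Agrees r σ ρ → Agrees s σ ξ →
                    σ ⊢ compileArgs as b r s ⇓ enc B (eval b (evalArgs as ρ ξ)) ∣ stepsArgs as b ρ ξ

compile-sound (varᵉ x) {r} {σ} ag = subst (λ v → σ ⊢ var (r x) ⇓ v ∣ 1) (ag .lookup-≡ x) (⇓var (r x))
compile-sound (letᵉ e b) ag =
  ⇓app ⇓fun (compile-sound e ag) (compile-sound b (agrees-cons refl (agrees-wk (agrees-wk ag))))
compile-sound trueᵉ ag = ⇓inl ⇓tt
compile-sound falseᵉ ag = ⇓inr ⇓tt
compile-sound (ifᵉ {A} c t e) {ρ = ρ} ag =
  ⇓if {A = A} (eval c ρ) (compile-sound c ag) (compile-sound t (agrees-wk ag)) (compile-sound e (agrees-wk ag))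
compile-sound zeroᵉ ag = ⇓zero
compile-sound (sucᵉ e) ag = ⇓suc (compile-sound e ag)
compile-sound (caseNᵉ {A} e z s) {ρ = ρ} ag =
  ⇓caseN {A = A} (eval e ρ) (compile-sound e ag) (compile-sound z ag)
    (λ m → compile-sound s (agrees-cons refl (agrees-wk ag)))
compile-sound 0ℚᵉ ag = ⇓rational
compile-sound (addᵉ e f) ag = ⇓add (compile-sound e ag) (compile-sound f ag)
compile-sound (leqᵉ e f) ag = ⇓leq (compile-sound e ag) (compile-sound f ag)
compile-sound (pairᵉ e f) ag = ⇓pair (compile-sound e ag) (compile-sound f ag)
compile-sound (fstᵉ e) ag = ⇓fst (compile-sound e ag)
compile-sound (sndᵉ e) ag = ⇓snd (compile-sound e ag)
compile-sound noneᵉ ag = ⇓inl ⇓tt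
compile-sound (someᵉ e) ag = ⇓inr (compile-sound e ag)
compile-sound (caseMᵉ {A} {B} e n j) {ρ = ρ} ag =
  ⇓caseM {A = A} {B} (eval e ρ) (compile-sound e ag) (compile-sound n (agrees-wk ag))
    (λ v → compile-sound j (agrees-cons refl (agrees-wk ag)))
compile-sound nilᵉ ag = ⇓nil
compile-sound (consᵉ e f) ag = ⇓cons (compile-sound e ag) (compile-sound f ag)
compile-sound (caseLᵉ {A} {B} e n c) {ρ = ρ} ag =
  ⇓caseL {A = A} {B} (eval e ρ) (compile-sound e ag) (compile-sound n ag)
    (λ v vs → compile-sound c (agrees-cons refl (agrees-cons refl (agrees-wk (agrees-wk ag)))))
compile-sound (mapᵉ {A} {B} e b) {ρ = ρ} ag =
  ⇓app ⇓fun (compile-sound e ag)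
    (⇓map {A = A} {B} (λ _ _ _ → compile-sound b (agrees-cons refl (agrees-wk (agrees-wk (agrees-wk (agrees-wk ag)))))) (eval e ρ))
compile-sound (foldᵉ {A} {B} e z s) {ρ = ρ} ag =
  ⇓app ⇓fun (compile-sound e ag)
    (⇓fold {A = A} {B} (λ _ → compile-sound z (agrees-wk (agrees-wk ag)))
       (λ _ _ _ _ _ → compile-sound s (agrees-cons refl (agrees-cons refl (agrees-wk (agrees-wk (agrees-wk (agrees-wk (agrees-wk (agrees-wk ag))))))))) (eval e ρ))
compile-sound (iterᵉ {B} e z s) {ρ = ρ} ag =
  ⇓app ⇓fun (compile-sound e ag)
    (⇓iter {B = B} (λ _ → compile-sound z (agrees-wk (agrees-wk ag)))
       (λ _ _ _ _ → compile-sound s (agrees-cons refl (agrees-wk (agrees-wk (agrees-wk (agrees-wk (agrees-wk ag))))))) (eval e ρ))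
compile-sound (callᵉ as b) ag = compileArgs-sound as b ag (agrees λ ())

compileArgs-sound ∙        b ag ah = compile-sound b ah
compileArgs-sound (a ▸ as) b ag ah =
  ⇓app ⇓fun (compile-sound a ag) (compileArgs-sound as b (agrees-wk (agrees-wk ag)) (agrees-cons refl (agrees-wk (agrees-wk ah))))

-- Size bounds for values, as exponents of a common base: numbers and list
-- lengths are at most N ^ a.
Deg : Type → Set
Deg boolᵗ      = ⊤
Deg natᵗ       = ℕ
Deg ratᵗ       = ⊤
Deg (A ×ᵗ B)   = Deg A × Deg B
Deg (maybeᵗ A) = Deg A
Deg (listᵗ A)  = ℕ × Deg A

zeroᵈ : ∀ A → Deg A
zeroᵈ boolᵗ      = tt
zeroᵈ natᵗ       = 0
zeroᵈ ratᵗ       = tt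
zeroᵈ (A ×ᵗ B)   = zeroᵈ A , zeroᵈ B
zeroᵈ (maybeᵗ A) = zeroᵈ A
zeroᵈ (listᵗ A)  = 0 , zeroᵈ A

maxᵈ : ∀ A → Deg A → Deg A → Deg A
maxᵈ boolᵗ      a       b         = tt
maxᵈ natᵗ       a       b         = a ⊔ b
maxᵈ ratᵗ       a       b         = tt
maxᵈ (A ×ᵗ B)   (a , b) (a′ , b′) = maxᵈ A a a′ , maxᵈ B b b′
maxᵈ (maybeᵗ A) a       b         = maxᵈ A a b
maxᵈ (listᵗ A)  (a , b) (a′ , b′) = a ⊔ a′ , maxᵈ A b b′

leᵈ : ∀ A → Deg A → Deg A → Bool
leᵈ boolᵗ      a       b         = true
leᵈ natᵗ       a       b         = a ℕ.≤ᵇ b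
leᵈ ratᵗ       a       b         = true
leᵈ (A ×ᵗ B)   (a , b) (a′ , b′) = leᵈ A a a′ ∧ leᵈ B b b′
leᵈ (maybeᵗ A) a       b         = leᵈ A a b
leᵈ (listᵗ A)  (a , b) (a′ , b′) = (a ℕ.≤ᵇ a′) ∧ leᵈ A b b′

Degs : Cx → Set
Degs = All Deg

record Analysis (A : Type) : Set where
  constructor ⟨_,_,_⟩
  field
    deg  : Deg A
    time : ℕ
    ok   : Bool
open Analysis

-- m ≤ N ^ a and n ≤ N ^ b give m + n ≤ N ^ (a ⊞ b).
infixr 6 _⊞_
_⊞_ : ℕ → ℕ → ℕ
a ⊞ b = suc (a ⊔ b)

thenᵃ : ∀ {A B} → Analysis A → Analysis B → Analysis B
thenᵃ r r′ = ⟨ deg r′ , suc (suc (time r) ⊞ time r′) , ok r ∧ ok r′ ⟩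

letᵃ : ∀ {A B} → Analysis A → (Deg A → Analysis B) → Analysis B
letᵃ r k = thenᵃ r (k (deg r))

sucᵃ : ∀ {A B} → (Deg A → Deg B) → Analysis A → Analysis B
sucᵃ f r = ⟨ f (deg r) , suc (time r) , ok r ⟩

pairᵃ : ∀ {A B C} → (Deg A → Deg B → Deg C) → Analysis A → Analysis B → Analysis C
pairᵃ f r r′ = ⟨ f (deg r) (deg r′) , suc (time r ⊞ time r′) , ok r ∧ ok r′ ⟩

branchᵃ : ∀ {A B} → Analysis A → Analysis B → (Deg A → Analysis B) → Analysis B
branchᵃ {A} {B} r r₁ k = join (k (deg r))
  where
  join : Analysis B → Analysis B
  join r₂ = ⟨ maxᵈ B (deg r₁) (deg r₂) , suc (time r ⊞ (time r₁ ⊔ time r₂)) , ok r ∧ ok r₁ ∧ ok r₂ ⟩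

mapᵃ : ∀ {A B} → Analysis (listᵗ A) → (Deg A → Analysis B) → Analysis (listᵗ B)
mapᵃ {A} {B} r k = close (k (proj₂ (deg r)))
  where
  close : Analysis B → Analysis (listᵗ B)
  close r′ = ⟨ (proj₁ (deg r) , deg r′)
             , suc (suc (time r) ⊞ (suc (proj₁ (deg r)) + (4 + time r′))) , ok r ∧ ok r′ ⟩

-- A loop is accepted when one unfolding of its body already stabilises the
-- bound on the accumulator.
loopᵃ : ∀ {A B} → Analysis A → ℕ → Analysis B → (Deg B → Analysis B) → Analysis B
loopᵃ {B = B} r a r₀ k = close (maxᵈ B (deg r₀) (deg (k (deg r₀))))
  where
  close′ : Deg B → Analysis B → Analysis B
  close′ d r′ = ⟨ d , suc (suc (time r) ⊞ (suc a + (4 + (time r₀ ⊔ time r′))))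
                , ok r ∧ ok r₀ ∧ ok r′ ∧ leᵈ B (deg r′) d ⟩
  close : Deg B → Analysis B
  close d = close′ d (k d)

analyse     : ∀ {Γ A} → Exp Γ A → Degs Γ → Analysis A
analyseArgs : ∀ {Γ Ξ Θ B} → Args Γ Ξ Θ → Exp Θ B → Degs Γ → Degs Ξ → Analysis B

analyse (varᵉ x) δ = ⟨ All.lookup δ x , 0 , true ⟩
analyse (letᵉ e b) δ = letᵃ (analyse e δ) (λ d → analyse b (d ∷ δ))
analyse trueᵉ δ = ⟨ tt , 1 , true ⟩
analyse falseᵉ δ = ⟨ tt , 1 , true ⟩
analyse (ifᵉ c t e) δ = branchᵃ (analyse c δ) (analyse t δ) (λ _ → analyse e δ)
analyse zeroᵉ δ = ⟨ 0 , 0 , true ⟩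
analyse (sucᵉ e) δ = sucᵃ suc (analyse e δ)
analyse (caseNᵉ e z s) δ = branchᵃ (analyse e δ) (analyse z δ) (λ d → analyse s (d ∷ δ))
analyse 0ℚᵉ δ = ⟨ tt , 0 , true ⟩
analyse (addᵉ e f) δ = pairᵃ (λ _ _ → tt) (analyse e δ) (analyse f δ)
analyse (leqᵉ e f) δ = pairᵃ (λ _ _ → tt) (analyse e δ) (analyse f δ)
analyse (pairᵉ e f) δ = pairᵃ _,_ (analyse e δ) (analyse f δ)
analyse (fstᵉ e) δ = sucᵃ proj₁ (analyse e δ)
analyse (sndᵉ e) δ = sucᵃ proj₂ (analyse e δ)
analyse (noneᵉ {A}) δ = ⟨ zeroᵈ A , 1 , true ⟩
analyse (someᵉ e) δ = sucᵃ (λ d → d) (analyse e δ)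
analyse (caseMᵉ e n j) δ = branchᵃ (analyse e δ) (analyse n δ) (λ d → analyse j (d ∷ δ))
analyse (nilᵉ {A}) δ = ⟨ (0 , zeroᵈ A) , 0 , true ⟩
analyse (consᵉ {A} e f) δ =
  pairᵃ (λ { d (a , d′) → suc a , maxᵈ A d d′ }) (analyse e δ) (analyse f δ)
analyse (caseLᵉ e n c) δ =
  branchᵃ (analyse e δ) (analyse n δ) (λ d → analyse c (proj₂ d ∷ d ∷ δ))
analyse (mapᵉ e b) δ = mapᵃ (analyse e δ) (λ d → analyse b (d ∷ δ))
analyse (foldᵉ e z s) δ =
  loopᵃ (analyse e δ) (proj₁ (deg (analyse e δ))) (analyse z δ)
        (λ d → analyse s (d ∷ proj₂ (deg (analyse e δ)) ∷ δ))
analyse (iterᵉ e z s) δ =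
  loopᵃ (analyse e δ) (deg (analyse e δ)) (analyse z δ) (λ d → analyse s (d ∷ δ))
analyse (callᵉ as b) δ = analyseArgs as b δ []

analyseArgs ∙        b δ ξ = analyse b ξ
analyseArgs (a ▸ as) b δ ξ = letᵃ (analyse a δ) (λ d → analyseArgs as b δ (d ∷ ξ))

module Bounds (N : ℕ) (2≤N : 2 ≤ N) where

  instance
    N≢0 : ℕ.NonZero N
    N≢0 = ℕ.>-nonZero (ℕ.≤-trans (s≤s z≤n) 2≤N)

  pow-mono : ∀ {a b} → a ≤ b → N ^ a ≤ N ^ b
  pow-mono = ℕ.^-monoʳ-≤ N

  pow-pos : ∀ a → 1 ≤ N ^ a
  pow-pos a = ℕ.m^n>0 N a

  pow-double : ∀ a → N ^ a + N ^ a ≤ N ^ suc a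
  pow-double a = ℕ.≤-trans (ℕ.≤-reflexive (cong (N ^ a +_) (sym (ℕ.+-identityʳ _))))
                           (ℕ.*-monoˡ-≤ (N ^ a) 2≤N)

  -- A record, so that the exponent can be inferred.
  infix 4 _≼_
  record _≼_ (m a : ℕ) : Set where
    constructor le
    field power : m ≤ N ^ a
  open _≼_ public

  ≼-trans : ∀ {m n a} → m ≤ n → n ≼ a → m ≼ a
  ≼-trans p (le q) = le (ℕ.≤-trans p q)

  ≼-mono : ∀ {m a b} → a ≤ b → m ≼ a → m ≼ b
  ≼-mono p (le q) = le (ℕ.≤-trans q (pow-mono p))

  ≼-suc : ∀ {m a} → m ≼ a → suc m ≼ suc a
  ≼-suc {a = a} (le p) = le (ℕ.≤-trans (ℕ.+-mono-≤ (pow-pos a) p) (pow-double a))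

  ≼-plus : ∀ {m n a b} → m ≼ a → n ≼ b → m + n ≼ a ⊞ b
  ≼-plus {a = a} {b} (le p) (le q) = le
    (ℕ.≤-trans (ℕ.+-mono-≤ (ℕ.≤-trans p (pow-mono (ℕ.m≤m⊔n a b)))
                           (ℕ.≤-trans q (pow-mono (ℕ.m≤n⊔m a b))))
               (pow-double (a ⊔ b)))

  ≼-maxˡ : ∀ {m a} b → m ≼ a → m ≼ a ⊔ b
  ≼-maxˡ {a = a} b = ≼-mono (ℕ.m≤m⊔n a b)

  ≼-maxʳ : ∀ {m b} a → m ≼ b → m ≼ a ⊔ b
  ≼-maxʳ {b = b} a = ≼-mono (ℕ.m≤n⊔m a b)

  ≼-times : ∀ {m n a b} → m ≼ a → n ≼ b → m * n ≼ a + b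
  ≼-times {a = a} {b} (le p) (le q) = le
    (ℕ.≤-trans (ℕ.*-mono-≤ p q) (ℕ.≤-reflexive (sym (ℕ.^-distribˡ-+-* N a b))))

  ≼-const : ∀ {m} a → m ≤ 2 ^ a → m ≼ a
  ≼-const a p = le (ℕ.≤-trans p (ℕ.^-monoˡ-≤ a 2≤N))

  ≼-1 : 1 ≼ 0
  ≼-1 = le ℕ.≤-refl

  ≼-pow : ∀ {a} → N ^ a ≼ a
  ≼-pow = le ℕ.≤-refl

  Fits : ∀ A → ⟦ A ⟧ → Deg A → Set
  Fits boolᵗ      x        a       = ⊤
  Fits natᵗ       m        a       = m ≼ a
  Fits ratᵗ       x        a       = ⊤
  Fits (A ×ᵗ B)   (x , y)  (a , b) = Fits A x a × Fits B y b
  Fits (maybeᵗ A) nothing  a       = ⊤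
  Fits (maybeᵗ A) (just x) a       = Fits A x a
  Fits (listᵗ A)  xs       (a , b) = List.length xs ≼ a × All (λ x → Fits A x b) xs

  fits-maxˡ : ∀ A {x a} b → Fits A x a → Fits A x (maxᵈ A a b)
  fits-maxˡ boolᵗ      b p = tt
  fits-maxˡ natᵗ       b p = ≼-maxˡ b p
  fits-maxˡ ratᵗ       b p = tt
  fits-maxˡ (A ×ᵗ B)   (b , c) (p , q) = fits-maxˡ A b p , fits-maxˡ B c q
  fits-maxˡ (maybeᵗ A) {nothing} b p = tt
  fits-maxˡ (maybeᵗ A) {just x}  b p = fits-maxˡ A b p
  fits-maxˡ (listᵗ A)  (b , c) (p , q) = ≼-maxˡ b p , All.map (fits-maxˡ A c) q

  fits-maxʳ : ∀ A {x b} a → Fits A x b → Fits A x (maxᵈ A a b)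
  fits-maxʳ boolᵗ      b p = tt
  fits-maxʳ natᵗ       b p = ≼-maxʳ b p
  fits-maxʳ ratᵗ       b p = tt
  fits-maxʳ (A ×ᵗ B)   (b , c) (p , q) = fits-maxʳ A b p , fits-maxʳ B c q
  fits-maxʳ (maybeᵗ A) {nothing} b p = tt
  fits-maxʳ (maybeᵗ A) {just x}  b p = fits-maxʳ A b p
  fits-maxʳ (listᵗ A)  (b , c) (p , q) = ≼-maxʳ b p , All.map (fits-maxʳ A c) q

  T-both : ∀ {a b} → T (a ∧ b) → T a × T b
  T-both = Equivalence.to T-∧

  fits-le : ∀ A {x} a b → T (leᵈ A a b) → Fits A x a → Fits A x b
  fits-le boolᵗ      a b t p = tt
  fits-le natᵗ       a b t p = ≼-mono (ℕ.≤ᵇ⇒≤ a b t) p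
  fits-le ratᵗ       a b t p = tt
  fits-le (A ×ᵗ B)   (a , c) (b , d) t (p , q) with T-both {leᵈ A a b} t
  ... | t₁ , t₂ = fits-le A a b t₁ p , fits-le B c d t₂ q
  fits-le (maybeᵗ A) {nothing} a b t p = tt
  fits-le (maybeᵗ A) {just x}  a b t p = fits-le A a b t p
  fits-le (listᵗ A)  (a , c) (b , d) t (p , q) with T-both {a ℕ.≤ᵇ b} t
  ... | t₁ , t₂ = ≼-mono (ℕ.≤ᵇ⇒≤ a b t₁) p , All.map (fits-le A c d t₂) q

  data FitsEnv : ∀ {Γ} → Vals Γ → Degs Γ → Set where
    []  : FitsEnv [] []
    _∷_ : ∀ {Γ A x a} {ρ : Vals Γ} {δ} → Fits A x a → FitsEnv ρ δ →
          FitsEnv {A ∷ Γ} (x ∷ ρ) (a ∷ δ)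

  fits-lookup : ∀ {Γ A} {ρ : Vals Γ} {δ} → FitsEnv ρ δ → (x : A ∈ˡ Γ) →
                Fits A (All.lookup ρ x) (All.lookup δ x)
  fits-lookup (p ∷ ps) (here refl) = p
  fits-lookup (p ∷ ps) (there x)   = fits-lookup ps x

  mapSteps-≤ : ∀ {A : Set} {c : A → ℕ} {K} xs → (∀ {x} → x ∈ˡ xs → c x ≤ K) →
               mapSteps c xs ≤ suc (List.length xs) * (8 + K)
  mapSteps-≤ {K = K} [] p = ℕ.≤-trans (ℕ.m≤m+n 3 (5 + K)) (ℕ.≤-reflexive (sym (ℕ.+-identityʳ _)))
  mapSteps-≤ {c = c} {K} (x ∷ xs) p =
    ℕ.≤-trans (ℕ.≤-reflexive (lem (c x) (mapSteps c xs)))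
      (ℕ.+-mono-≤ (ℕ.≤-trans (ℕ.+-monoʳ-≤ 6 (p (here refl))) (ℕ.m≤n+m (6 + K) 2)) (mapSteps-≤ xs (p ∘ there)))
    where
    lem : ∀ a b → suc (suc (suc (a + suc (suc (suc b))))) ≡ suc (suc (suc (suc (suc (suc (a + b))))))
    lem a b = cong (3 +_) (trans (ℕ.+-suc a _) (cong suc (trans (ℕ.+-suc a _) (cong suc (ℕ.+-suc a b)))))

  module _ {A B : Set} {f : A → B → B} {z : B} {i : ℕ} {c : A → B → ℕ} {K : ℕ} where

    -- The invariant may depend on the part of the list already consumed.
    foldSteps-≤ : (P : List A → B → Set) → P [] z →
                  ∀ xs → (∀ {x ys acc} → x ∈ˡ xs → List.length ys ℕ.< List.length xs → P ys acc →
                          P (x ∷ ys) (f x acc) × c x acc ≤ K) →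
                  i ≤ K →
                  P xs (foldr f z xs) × foldSteps f z i c xs ≤ suc (List.length xs) * (8 + K)
    foldSteps-≤ P pz [] p q = pz , ℕ.≤-trans (s≤s (s≤s q))
      (ℕ.≤-trans (ℕ.m≤n+m (2 + K) 6) (ℕ.≤-reflexive (sym (ℕ.+-identityʳ _))))
    foldSteps-≤ P pz (x ∷ xs) p q with foldSteps-≤ P pz xs (λ y∈ lt → p (there y∈) (ℕ.m<n⇒m<1+n lt)) q
    ... | pa , r with p (here refl) ℕ.≤-refl pa
    ... | pb , s = pb ,
      ℕ.≤-trans (ℕ.≤-reflexive (cong (7 +_) (ℕ.+-comm (foldSteps f z i c xs) _)))
        (ℕ.+-mono-≤ (ℕ.≤-trans (ℕ.+-monoʳ-≤ 7 s) (ℕ.n≤1+n (7 + K))) r)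

  module _ {B : Set} {z : B} {f : B → B} {i : ℕ} {c : B → ℕ} {K : ℕ} where

    iterSteps-≤ : (P : ℕ → B → Set) → P 0 z →
                  ∀ m → (∀ {j acc} → j ℕ.< m → P j acc → P (suc j) (f acc) × c acc ≤ K) →
                  i ≤ K →
                  P m (iter m z f) × iterSteps z f i c m ≤ suc m * (8 + K)
    iterSteps-≤ P pz zero p q = pz , ℕ.≤-trans (s≤s (s≤s q))
      (ℕ.≤-trans (ℕ.m≤n+m (2 + K) 6) (ℕ.≤-reflexive (sym (ℕ.+-identityʳ _))))
    iterSteps-≤ P pz (suc m) p q with iterSteps-≤ P pz m (λ j<m → p (ℕ.m<n⇒m<1+n j<m)) q
    ... | pa , r with p (ℕ.n<1+n m) pa
    ... | pb , s = pb ,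
      ℕ.≤-trans (ℕ.≤-reflexive (cong (7 +_) (ℕ.+-comm (iterSteps z f i c m) _)))
        (ℕ.+-mono-≤ (ℕ.≤-trans (ℕ.+-monoʳ-≤ 7 s) (ℕ.n≤1+n (7 + K))) r)

  8+-≼ : ∀ {a} → 8 + N ^ a ≼ 4 + a
  8+-≼ {a} = ≼-trans (ℕ.+-mono-≤ (ℕ.m≤m*n 8 (N ^ a) ⦃ ℕ.>-nonZero (pow-pos a) ⦄) (ℕ.m≤m+n (N ^ a) _))
               (≼-trans (ℕ.≤-reflexive (sym (ℕ.*-distribʳ-+ (N ^ a) 8 8)))
                        (≼-times {a = 4} (≼-const 4 ℕ.≤-refl) (≼-pow {a})))

  record RunsAs {A} (x : ⟦ A ⟧) (c : ℕ) (d : Deg A) (t : ℕ) : Set where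
    constructor runs
    field
      fits  : Fits A x d
      quick : c ≼ t
  open RunsAs public

  Runs : ∀ {Γ A} → Exp Γ A → Vals Γ → Deg A → ℕ → Set
  Runs {A = A} e ρ d t = RunsAs {A} (eval e ρ) (steps e ρ) d t

  if-≤ : ∀ b {m n a c} → m ≼ a → n ≼ c → (if b then m else n) ≼ (a ⊔ c)
  if-≤ true  {c = c} p q = ≼-maxˡ c p
  if-≤ false {a = a} p q = ≼-maxʳ a q

  if-fits : ∀ A b {x y d d′} → Fits A x d → Fits A y d′ → Fits A (if b then x else y) (maxᵈ A d d′)
  if-fits A true  {d′ = d′} p q = fits-maxˡ A d′ p
  if-fits A false {d = d}   p q = fits-maxʳ A d q

  map-fits : ∀ {A : Set} {B d} {f : A → ⟦ B ⟧} xs → (∀ {x} → x ∈ˡ xs → Fits B (f x) d) →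
             All (λ y → Fits B y d) (map f xs)
  map-fits []       p = []
  map-fits (x ∷ xs) p = p (here refl) ∷ map-fits xs (p ∘ there)

  runs-let : ∀ {Γ A B} {e : Exp Γ A} {b : Exp (A ∷ Γ) B} {ρ d t d′ t′} →
             Runs e ρ d t → Runs b (eval e ρ ∷ ρ) d′ t′ → Runs (letᵉ e b) ρ d′ (suc (suc t ⊞ t′))
  runs-let (runs _ q) (runs p′ q′) = runs p′ (≼-suc (≼-plus (≼-suc q) q′))

  runs-fold : ∀ {Γ A B} {e : Exp Γ (listᵗ A)} {z : Exp Γ B} {s : Exp (B ∷ A ∷ Γ) B} {ρ a d₁ i j l d} →
              (P : List ⟦ A ⟧ → ⟦ B ⟧ → Set) → P [] (eval z ρ) →
              (∀ {x ys acc} → x ∈ˡ eval e ρ → List.length ys ℕ.< List.length (eval e ρ) → P ys acc →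
                 P (x ∷ ys) (eval s (acc ∷ x ∷ ρ)) × steps s (acc ∷ x ∷ ρ) ≼ l) →
              (P (eval e ρ) (eval (foldᵉ e z s) ρ) → Fits B (eval (foldᵉ e z s) ρ) d) →
              Runs e ρ (a , d₁) i → steps z ρ ≼ j →
              Runs (foldᵉ e z s) ρ d (suc (suc i ⊞ (suc a + (4 + (j ⊔ l)))))
  runs-fold {e = e} {ρ = ρ} {a = a} {j = j} {l} P pz p fin (runs (f , _) qe) qz
    with foldSteps-≤ {K = N ^ (j ⊔ l)} P pz (eval e ρ)
           (λ x∈ lt pa → let r , s = p x∈ lt pa in r , power (≼-maxʳ j s)) (power (≼-maxˡ l qz))
  ... | pf , qf = runs (fin pf)
    (≼-suc (≼-plus (≼-suc qe) (≼-trans qf (≼-times (≼-suc f) (8+-≼ {j ⊔ l})))))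

  runs-iter : ∀ {Γ B} {e : Exp Γ natᵗ} {z : Exp Γ B} {s : Exp (B ∷ Γ) B} {ρ a i j l d} →
              (P : ℕ → ⟦ B ⟧ → Set) → P 0 (eval z ρ) →
              (∀ {m acc} → m ℕ.< eval e ρ → P m acc →
                 P (suc m) (eval s (acc ∷ ρ)) × steps s (acc ∷ ρ) ≼ l) →
              (P (eval e ρ) (eval (iterᵉ e z s) ρ) → Fits B (eval (iterᵉ e z s) ρ) d) →
              Runs e ρ a i → steps z ρ ≼ j →
              Runs (iterᵉ e z s) ρ d (suc (suc i ⊞ (suc a + (4 + (j ⊔ l)))))
  runs-iter {e = e} {ρ = ρ} {a = a} {j = j} {l} P pz p fin (runs f qe) qz
    with iterSteps-≤ {K = N ^ (j ⊔ l)} P pz (eval e ρ)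
           (λ x∈ pa → let r , s = p x∈ pa in r , power (≼-maxʳ j s)) (power (≼-maxˡ l qz))
  ... | pf , qf = runs (fin pf)
    (≼-suc (≼-plus (≼-suc qe) (≼-trans qf (≼-times (≼-suc f) (8+-≼ {j ⊔ l})))))

  runs-map : ∀ {Γ A B} {e : Exp Γ (listᵗ A)} {b : Exp (A ∷ Γ) B} {ρ a d i d′ l} →
             Runs e ρ (a , d) i → (∀ {x} → Fits A x d → Runs b (x ∷ ρ) d′ l) →
             Runs (mapᵉ e b) ρ (a , d′) (suc (suc i ⊞ (suc a + (4 + l))))
  runs-map {B = B} {e} {b} {ρ} {l = l} (runs (f , fs) q) p =
    runs (≼-trans (ℕ.≤-reflexive (length-map _ (eval e ρ))) f
         , map-fits {B = B} (eval e ρ) (λ x∈ → fits (p (All.lookup fs x∈))))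
      (≼-suc (≼-plus (≼-suc q)
        (≼-trans (mapSteps-≤ (eval e ρ) (λ x∈ → power (quick (p (All.lookup fs x∈)))))
                   (≼-times (≼-suc f) (8+-≼ {l})))))

  branchˡ : ∀ {Γ B} {e : Exp Γ B} {ρ c t d d′ j l} → c ≼ t → Runs e ρ d j →
            RunsAs {B} (eval e ρ) (suc (c + steps e ρ)) (maxᵈ B d d′) (suc (t ⊞ (j ⊔ l)))
  branchˡ {B = B} {l = l} p (runs f q) = runs (fits-maxˡ B _ f) (≼-suc (≼-plus p (≼-maxˡ l q)))

  branchʳ : ∀ {Γ B} {e : Exp Γ B} {ρ c t d d′ j l} → c ≼ t → Runs e ρ d′ l →
            RunsAs {B} (eval e ρ) (suc (c + steps e ρ)) (maxᵈ B d d′) (suc (t ⊞ (j ⊔ l)))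
  branchʳ {B = B} {j = j} p (runs f q) = runs (fits-maxʳ B _ f) (≼-suc (≼-plus p (≼-maxʳ j q)))

  analyse-sound : ∀ {Γ A} (e : Exp Γ A) {ρ δ} → FitsEnv ρ δ → T (ok (analyse e δ)) →
                  Runs e ρ (deg (analyse e δ)) (time (analyse e δ))
  analyseArgs-sound : ∀ {Γ Ξ Θ B} (as : Args Γ Ξ Θ) (b : Exp Θ B) {ρ δ ξ ε} →
                      FitsEnv ρ δ → FitsEnv ξ ε → T (ok (analyseArgs as b δ ε)) →
                      RunsAs {B} (eval b (evalArgs as ρ ξ)) (stepsArgs as b ρ ξ) (deg (analyseArgs as b δ ε)) (time (analyseArgs as b δ ε))

  analyse-sound (varᵉ x) fe t = runs (fits-lookup fe x) ≼-1
  analyse-sound (letᵉ e b) {δ = δ} fe t with T-both {ok (analyse e δ)} t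
  ... | t₁ , t₂ = let r = analyse-sound e fe t₁ in
    runs-let {e = e} {b} r (analyse-sound b (fits r ∷ fe) t₂)
  analyse-sound trueᵉ fe t = runs tt (≼-const 1 ℕ.≤-refl)
  analyse-sound falseᵉ fe t = runs tt (≼-const 1 ℕ.≤-refl)
  analyse-sound (ifᵉ {A} c t e) {ρ} {δ} fe ts with T-both {ok (analyse c δ)} ts
  ... | t₁ , ts′ with T-both {ok (analyse t δ)} ts′
  ... | t₂ , t₃ with analyse-sound c fe t₁ | analyse-sound t fe t₂ | analyse-sound e fe t₃
  ... | rc | rt | re =
    runs (if-fits A (eval c ρ) (fits rt) (fits re))
         (≼-suc (≼-plus (quick rc) (if-≤ (eval c ρ) (quick rt) (quick re))))
  analyse-sound zeroᵉ fe t = runs (le z≤n) ≼-1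
  analyse-sound (sucᵉ e) fe t = let r = analyse-sound e fe t in
    runs (≼-suc (fits r)) (≼-suc (quick r))
  analyse-sound (caseNᵉ e z s) {ρ} {δ} fe ts with T-both {ok (analyse e δ)} ts
  ... | t₁ , ts′ with T-both {ok (analyse z δ)} ts′
  ... | t₂ , t₃ with analyse-sound e fe t₁
  ... | re with eval e ρ | fits re
  ... | zero  | _ = branchˡ {e = z} {t = time (analyse e δ)} (quick re) (analyse-sound z fe t₂)
  ... | suc m | f = branchʳ {e = s} {t = time (analyse e δ)} (quick re) (analyse-sound s (≼-trans (ℕ.n≤1+n m) f ∷ fe) t₃)
  analyse-sound 0ℚᵉ fe t = runs tt ≼-1
  analyse-sound (addᵉ e f) {δ = δ} fe t with T-both {ok (analyse e δ)} t
  ... | t₁ , t₂ = runs tt (≼-suc (≼-plus (quick (analyse-sound e fe t₁)) (quick (analyse-sound f fe t₂))))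
  analyse-sound (leqᵉ e f) {δ = δ} fe t with T-both {ok (analyse e δ)} t
  ... | t₁ , t₂ = runs tt (≼-suc (≼-plus (quick (analyse-sound e fe t₁)) (quick (analyse-sound f fe t₂))))
  analyse-sound (pairᵉ e f) {δ = δ} fe t with T-both {ok (analyse e δ)} t
  ... | t₁ , t₂ with analyse-sound e fe t₁ | analyse-sound f fe t₂
  ... | re | rf = runs (fits re , fits rf) (≼-suc (≼-plus (quick re) (quick rf)))
  analyse-sound (fstᵉ e) fe t = let r = analyse-sound e fe t in
    runs (proj₁ (fits r)) (≼-suc (quick r))
  analyse-sound (sndᵉ e) fe t = let r = analyse-sound e fe t in
    runs (proj₂ (fits r)) (≼-suc (quick r))
  analyse-sound noneᵉ fe t = runs tt (≼-const 1 ℕ.≤-refl)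
  analyse-sound (someᵉ e) fe t = let r = analyse-sound e fe t in
    runs (fits r) (≼-suc (quick r))
  analyse-sound (caseMᵉ e n j) {ρ} {δ} fe ts with T-both {ok (analyse e δ)} ts
  ... | t₁ , ts′ with T-both {ok (analyse n δ)} ts′
  ... | t₂ , t₃ with analyse-sound e fe t₁
  ... | re with eval e ρ | fits re
  ... | nothing | _ = branchˡ {e = n} {t = time (analyse e δ)} (quick re) (analyse-sound n fe t₂)
  ... | just x  | f = branchʳ {e = j} {t = time (analyse e δ)} (quick re) (analyse-sound j (f ∷ fe) t₃)
  analyse-sound nilᵉ fe t = runs (le z≤n , []) ≼-1
  analyse-sound (consᵉ {A} e f) {δ = δ} fe t with T-both {ok (analyse e δ)} t
  ... | t₁ , t₂ with analyse-sound e fe t₁ | analyse-sound f fe t₂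
  ... | re | rf =
    runs (≼-suc (proj₁ (fits rf)) , fits-maxˡ A (proj₂ (deg (analyse f δ))) (fits re)
                                    ∷ All.map (fits-maxʳ A (deg (analyse e δ))) (proj₂ (fits rf)))
         (≼-suc (≼-plus (quick re) (quick rf)))
  analyse-sound (caseLᵉ e n c) {ρ} {δ} fe ts with T-both {ok (analyse e δ)} ts
  ... | t₁ , ts′ with T-both {ok (analyse n δ)} ts′
  ... | t₂ , t₃ with analyse-sound e fe t₁
  ... | re with eval e ρ | fits re
  ... | []     | _ = branchˡ {e = n} {t = time (analyse e δ)} (quick re) (analyse-sound n fe t₂)
  ... | x ∷ xs | l , f ∷ fs = branchʳ {e = c} {t = time (analyse e δ)} (quick re) (analyse-sound c (f ∷ (≼-trans (ℕ.n≤1+n _) l , fs) ∷ fe) t₃)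
  analyse-sound (mapᵉ e b) {ρ} {δ} fe t with T-both {ok (analyse e δ)} t
  ... | t₁ , t₂ = runs-map {e = e} {b} {ρ} (analyse-sound e fe t₁) (λ f → analyse-sound b (f ∷ fe) t₂)
  analyse-sound (foldᵉ {A} {B} e z s) {ρ} {δ} fe ts with T-both {ok (analyse e δ)} ts
  ... | t₁ , ts′ with T-both {ok (analyse z δ)} ts′
  ... | t₂ , ts″ with T-both {ok (analyse s (_ ∷ proj₂ (deg (analyse e δ)) ∷ δ))} ts″
  ... | t₃ , t₄ with analyse-sound e fe t₁ | analyse-sound z fe t₂
  ... | re | rz =
    runs-fold {e = e} {z} {s} {ρ} (λ _ acc → Fits B acc _) (fits-maxˡ B _ (fits rz))
      (λ x∈ _ fa → let r = analyse-sound s (fa ∷ All.lookup (proj₂ (fits re)) x∈ ∷ fe) t₃ in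
                 fits-le B _ _ t₄ (fits r) , quick r)
      (λ f → f) re (quick rz)
  analyse-sound (iterᵉ {B} e z s) {ρ} {δ} fe ts with T-both {ok (analyse e δ)} ts
  ... | t₁ , ts′ with T-both {ok (analyse z δ)} ts′
  ... | t₂ , ts″ with T-both {ok (analyse s (_ ∷ δ))} ts″
  ... | t₃ , t₄ with analyse-sound e fe t₁ | analyse-sound z fe t₂
  ... | re | rz =
    runs-iter {e = e} {z} {s} {ρ} (λ _ acc → Fits B acc _) (fits-maxˡ B _ (fits rz))
      (λ _ fa → let r = analyse-sound s (fa ∷ fe) t₃ in
                fits-le B _ _ t₄ (fits r) , quick r)
      (λ f → f) re (quick rz)
  analyse-sound (callᵉ as b) fe t = analyseArgs-sound as b fe [] t

  analyseArgs-sound ∙        b fe fx t = analyse-sound b fx t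
  analyseArgs-sound (a ▸ as) b {δ = δ} fe fx t with T-both {ok (analyse a δ)} t
  ... | t₁ , t₂ with analyse-sound a fe t₁
  ... | ra with analyseArgs-sound as b fe (fits ra ∷ fx) t₂
  ... | runs f q = runs f (≼-suc (≼-plus (≼-suc (quick ra)) q))

-- The algorithm as functions on lists. The expressions below evaluate to them
-- definitionally.

opaque
  allB : ∀ {A : Set} → (A → Bool) → List A → Bool
  allB p = foldr (λ x acc → if p x then acc else false) true

  anyB : ∀ {A : Set} → (A → Bool) → List A → Bool
  anyB p = foldr (λ x acc → if p x then true else acc) false

isJust : ∀ {A : Set} → Maybe A → Bool
isJust = caseM false (λ _ → true)

opaque
  _≤ᵇ_ : ℚ → ℚ → Bool
  _≤ᵇ_ = ℚ._≤ᵇ_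

opaque
  isEq : ℕ → ℕ → Bool
  isEq x y = caseM false (caseN true (λ _ → false))
               (iter y (just x) (caseM nothing (caseN nothing just)))

  at : ∀ {A : Set} → A → List A → ℕ → A
  at d xs i = caseL d (λ x _ → x) (iter i xs (caseL [] (λ _ ys → ys)))

  isIn : ℕ → List ℕ → Bool
  isIn v = anyB (λ x → isEq x v)

Row Lab : Set
Row = List ℕ
Lab = List Row

Part : Set
Part = List (ℕ × Row)

Table : Set
Table = List (Part × List (Maybe Lab))

opaque
  find : Part → ℕ → Maybe Row
  find σ v = foldr (λ p acc → if isEq (proj₁ p) v then just (proj₂ p) else acc) nothing σ

-- A row lists, for the levels k , ... , 0 in this order, the point of that or
-- a smaller level which is nearest to its owner v. The parent of v is the entry
-- one level below the lowest level at which v itself is the entry; points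
-- outside the tree, and the root, are their own parents.
scan : ℕ → Row → Maybe ℕ × ℕ
scan v = foldr (λ x acc → caseM (if isEq x v then (just (proj₂ acc) , x) else (nothing , x))
                                (λ _ → acc) (proj₁ acc))
               (nothing , v)

opaque
  par : ℕ → Row → ℕ
  par v l = caseM v (λ p → p) (proj₁ (scan v l))

iota : ∀ {A : Set} → List A → List ℕ
iota = foldr (λ _ acc → 0 ∷ map suc acc) []

flatten : ∀ {A : Set} → List (List A) → List A
flatten = foldr (λ xs acc → foldr (λ x acc → x ∷ acc) acc xs) []

extend : ∀ {A : Set} → List A → List (List A) → List (List A)
extend xs ts = flatten (map (λ t → map (λ x → x ∷ t) xs) ts)

mat : ∀ {A : Set} → List ℕ → (ℕ → ℕ → A) → List (List A)
mat vs f = map (λ u → map (λ v → f u v) vs) vs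

entry : ∀ {A : Set} → A → List (List A) → ℕ → ℕ → A
entry d M u v = at d (at [] M u) v

minM addM : Maybe ℚ → Maybe ℚ → Maybe ℚ
minM a b = caseM b (λ p → caseM (just p) (λ q → if p ≤ᵇ q then just p else just q) b) a
addM a b = caseM nothing (λ p → caseM nothing (λ q → just (p ℚ.+ q)) b) a

module _ (vs : List ℕ) where

  module _ (W : List (List (Maybe ℚ))) where

    hop : ℕ → ℕ → Maybe ℚ
    hop u v = if isEq u v then just 0ℚ else entry nothing W u v

    relax : List (List (Maybe ℚ)) → List (List (Maybe ℚ))
    relax S = mat vs λ u v → foldr (λ w acc → minM (addM (hop u w) (entry nothing S w v)) acc) nothing vs

    distances : List (List ℚ)
    distances = map (map (caseM 0ℚ (λ q → q))) (foldr (λ _ S → relax S) (mat vs hop) vs)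

  irreducible : List (List ℚ) → List (List Bool)
  irreducible D = mat vs λ u v →
    if isEq u v then false else
    allB (λ w → if isEq w u then true else
                if isEq w v then true else
                if (entry 0ℚ D u w ℚ.+ entry 0ℚ D w v) ≤ᵇ entry 0ℚ D u v then false else true) vs

-- ps lists the positions in a row; df stands in for missing labels.
module Solver (vs : List ℕ) (X : List Bool) (D : List (List ℚ)) (A : List (List Bool))
              (ps : List ℕ) (df : Row) where

  dist : ℕ → ℕ → ℚ
  dist = entry 0ℚ D

  opaque
    price : ℕ → Row → ℚ
    price v l = dist v (par v l)

  between : ℕ → ℕ → ℕ → Bool
  between v u a = (dist v u ℚ.+ dist u a) ≤ᵇ dist v a

  -- If u lies on a shortest path from v to an entry of v, then u must have the
  -- same entry, and vice versa.
  opaque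
    agree : ℕ → Row → ℕ → Row → Bool
    agree v l u l′ = allB (λ i →
      if isEq (at 0 l i) (at 0 l′ i) then true else
      if between v u (at 0 l i) then false else
      if between u v (at 0 l′ i) then false else true) ps

    unary : ℕ → Row → Bool
    unary v l = if at false X v then isIn v l else true

  domain : Part → List Bool
  domain τ = map (λ v → isJust (find τ v)) vs

  grow : List Bool → List Bool → List Bool
  grow W S = map (λ v →
    if at false W v then false else
    if at false S v then true else
    anyB (λ u → if at false S u then entry false A u v else false) vs) vs

  opaque
    component : List Bool → ℕ → List Bool
    component W x = foldr (λ _ S → grow W S) (map (λ v → if at false W v then false else isEq v x) vs) vs

  pick : Part → Part → List (Maybe Lab) → ℕ → Row
  pick σ τ row v = caseM (caseM (caseM df (λ m → at df m v) (at nothing row v))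
                                (λ l → l) (find τ v))
                         (λ l → l) (find σ v)

  merge : Part → Part → List (Maybe Lab) → Lab
  merge σ τ row = map (pick σ τ row) vs

  covered : Part → List (Maybe Lab) → ℕ → Bool
  covered τ row v = if isJust (find τ v) then true else isJust (at nothing row v)

  -- Outer neighbours of C must lie in the bag τ, so that every result certifies
  -- that C can be decomposed with bags of this size.
  validEdge : List Bool → Part → Lab → ℕ → ℕ → Bool
  validEdge C τ m v u =
    if entry false A v u
    then (if (if at false C u then true else isJust (find τ u))
          then agree v (at df m v) u (at df m u) else false)
    else true

  validAt : List Bool → Part → List (Maybe Lab) → Lab → ℕ → Bool
  validAt C τ row m v =
    if at false C v
    then (if covered τ row v
          then (if unary v (at df m v) then allB (validEdge C τ m v) vs else false)
          else false)
    else true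

  candidate : List Bool → Part → Part × List (Maybe Lab) → Maybe Lab
  candidate C σ (τ , row) =
    if allB (validAt C τ row (merge σ τ row)) vs then just (merge σ τ row) else nothing

  total : List Bool → Lab → ℚ
  total C m = foldr (λ v acc → (if at false C v then price v (at df m v) else 0ℚ) ℚ.+ acc) 0ℚ vs

  better : List Bool → Maybe Lab → Maybe Lab → Maybe Lab
  better C new old =
    caseM old (λ m → caseM (just m) (λ m′ → if total C m ≤ᵇ total C m′ then just m else just m′) old) new

  best : List Bool → Part → Table → Maybe Lab
  best C σ = foldr (λ p acc → better C (candidate C σ p) acc) nothing

  table₀ : List Part → Table
  table₀ U = map (λ τ → τ , map (λ _ → nothing) vs) U

  round : Table → Table
  round T = map (λ p → proj₁ p , map (λ x → best (component (domain (proj₁ p)) x) (proj₁ p) T) vs) T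

  everything : List Bool
  everything = map (λ _ → true) vs

  solve : List Part → Maybe Lab
  solve U = best everything [] (foldr (λ _ T → round T) (table₀ U) vs)

  -- The bag size grows by one in every step until a solution is found.
  searchStep : List (ℕ × Row) → List Part × Maybe Lab → List Part × Maybe Lab
  searchStep pairs acc =
    caseM (extend pairs (proj₁ acc) , solve (extend pairs (proj₁ acc))) (λ _ → acc) (proj₂ acc)

  search : List (ℕ × Row) → List Part × Maybe Lab
  search pairs = foldr (λ _ acc → searchStep pairs acc) ([] ∷ [] , nothing) vs

  output : Lab → List Bool × List (List Bool)
  output m = map (λ v → isIn v (at df m v)) vs
           , mat vs λ u v → if isEq u v then false else
                            if isEq (par v (at df m v)) u then true else
                            isEq (par u (at df m u)) v

allRows : List ℕ → ℕ → ℕ → List Row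
allRows vs r k = iter k ((r ∷ []) ∷ []) (extend vs)

allPairs : List ℕ → List Row → List (ℕ × Row)
allPairs vs rows = flatten (map (λ v → map (λ l → v , l) rows) vs)

firstOr : ∀ {A : Set} → A → List A → A
firstOr d = caseL d (λ x _ → x)

opaque
  general : List ℕ → List (List ℚ) → List Bool → List Row → List Bool × List (List Bool)
  general vs D X rows = output (caseM [] (λ m → m) (proj₂ (search (allPairs vs rows))))
    where open Solver vs X D (irreducible vs D) (iota (firstOr [] rows)) (firstOr [] rows)

-- One point needs its own branch: there the time must not depend on k.
solution : List (List (Maybe ℚ)) × List Bool × ℕ × ℕ → List Bool × List (List Bool)
solution (W , X , r , k) =
  caseL ([] , [])
    (λ _ rest → caseL (true ∷ [] , (false ∷ []) ∷ [])
                      (λ _ _ → general (iota W) (distances (iota W) W) X (allRows (iota W) r k)) rest) W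

-- Expressions

x0 : ∀ {Γ A} → Exp (A ∷ Γ) A
x0 = varᵉ i0
x1 : ∀ {Γ A B} → Exp (B ∷ A ∷ Γ) A
x1 = varᵉ i1
x2 : ∀ {Γ A B C} → Exp (C ∷ B ∷ A ∷ Γ) A
x2 = varᵉ i2
x3 : ∀ {Γ A B C D} → Exp (D ∷ C ∷ B ∷ A ∷ Γ) A
x3 = varᵉ i3
x4 : ∀ {Γ A B C D E} → Exp (E ∷ D ∷ C ∷ B ∷ A ∷ Γ) A
x4 = varᵉ (there i3)
x5 : ∀ {Γ A B C D E F} → Exp (F ∷ E ∷ D ∷ C ∷ B ∷ A ∷ Γ) A
x5 = varᵉ (there (there i3))
x6 : ∀ {Γ A B C D E F G} → Exp (G ∷ F ∷ E ∷ D ∷ C ∷ B ∷ A ∷ Γ) A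
x6 = varᵉ (there (there (there i3)))
x7 : ∀ {Γ A B C D E F G H} → Exp (H ∷ G ∷ F ∷ E ∷ D ∷ C ∷ B ∷ A ∷ Γ) A
x7 = varᵉ (there (there (there (there i3))))

rowᵗ labᵗ partᵗ tableᵗ setᵗ vsᵗ probᵗ resᵗ : Type
rowᵗ   = listᵗ natᵗ
labᵗ   = listᵗ rowᵗ
partᵗ  = listᵗ (natᵗ ×ᵗ rowᵗ)
tableᵗ = listᵗ (partᵗ ×ᵗ listᵗ (maybeᵗ labᵗ))
setᵗ   = listᵗ boolᵗ
vsᵗ    = listᵗ natᵗ
resᵗ   = listᵗ partᵗ ×ᵗ maybeᵗ labᵗ
probᵗ  = vsᵗ ×ᵗ setᵗ ×ᵗ listᵗ (listᵗ ratᵗ) ×ᵗ listᵗ (listᵗ boolᵗ) ×ᵗ vsᵗ ×ᵗ rowᵗ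

module _ {Γ : Cx} where

  allᵉ anyᵉ : ∀ {A} → Exp Γ (listᵗ A) → Exp (boolᵗ ∷ A ∷ Γ) boolᵗ → Exp Γ boolᵗ
  allᵉ xs p = foldᵉ xs trueᵉ (ifᵉ p x0 falseᵉ)
  anyᵉ xs p = foldᵉ xs falseᵉ (ifᵉ p trueᵉ x0)

  isJustᵉ : ∀ {A} → Exp Γ (maybeᵗ A) → Exp Γ boolᵗ
  isJustᵉ m = caseMᵉ m falseᵉ trueᵉ

  isEqᵉ : Exp Γ natᵗ → Exp Γ natᵗ → Exp Γ boolᵗ
  isEqᵉ x y = callᵉ {Θ = natᵗ ∷ natᵗ ∷ []} (x ▸ y ▸ ∙)
    (caseMᵉ (iterᵉ x0 (someᵉ x1) (caseMᵉ x0 noneᵉ (caseNᵉ x0 noneᵉ (someᵉ x0))))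
            falseᵉ (caseNᵉ x0 trueᵉ falseᵉ))

  atᵉ : ∀ {A} → Exp Γ A → Exp Γ (listᵗ A) → Exp Γ natᵗ → Exp Γ A
  atᵉ {A} d xs i = callᵉ {Θ = natᵗ ∷ listᵗ A ∷ A ∷ []} (d ▸ xs ▸ i ▸ ∙)
    (caseLᵉ (iterᵉ x0 x1 (caseLᵉ x0 nilᵉ x1)) x2 x0)

  entryᵉ : ∀ {A} → Exp Γ A → Exp Γ (listᵗ (listᵗ A)) → Exp Γ natᵗ → Exp Γ natᵗ → Exp Γ A
  entryᵉ d M u v = atᵉ d (atᵉ nilᵉ M u) v

module _ {Γ : Cx} where

  isInᵉ : Exp Γ natᵗ → Exp Γ rowᵗ → Exp Γ boolᵗ
  isInᵉ v l = callᵉ {Θ = rowᵗ ∷ natᵗ ∷ []} (v ▸ l ▸ ∙) (anyᵉ x0 (isEqᵉ x1 x3))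

  findᵉ : Exp Γ partᵗ → Exp Γ natᵗ → Exp Γ (maybeᵗ rowᵗ)
  findᵉ σ v = callᵉ {Θ = natᵗ ∷ partᵗ ∷ []} (σ ▸ v ▸ ∙)
    (foldᵉ x1 noneᵉ (ifᵉ (isEqᵉ (fstᵉ x1) x2) (someᵉ (sndᵉ x1)) x0))

  parᵉ : Exp Γ natᵗ → Exp Γ rowᵗ → Exp Γ natᵗ
  parᵉ v l = callᵉ {Θ = rowᵗ ∷ natᵗ ∷ []} (v ▸ l ▸ ∙)
    (caseMᵉ (fstᵉ (foldᵉ x0 (pairᵉ noneᵉ x1)
       (caseMᵉ (fstᵉ x0)
         (ifᵉ (isEqᵉ x1 x3) (pairᵉ (someᵉ (sndᵉ x0)) x1) (pairᵉ noneᵉ x1))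
         x1)))
      x1 x0)

  iotaᵉ : ∀ {A} → Exp Γ (listᵗ A) → Exp Γ vsᵗ
  iotaᵉ xs = foldᵉ xs nilᵉ (consᵉ zeroᵉ (mapᵉ x0 (sucᵉ x0)))

  flattenᵉ : ∀ {A} → Exp Γ (listᵗ (listᵗ A)) → Exp Γ (listᵗ A)
  flattenᵉ xss = foldᵉ xss nilᵉ (foldᵉ x1 x0 (consᵉ x1 x0))

  hopᵉ : Exp Γ (listᵗ (listᵗ (maybeᵗ ratᵗ))) → Exp Γ natᵗ → Exp Γ natᵗ → Exp Γ (maybeᵗ ratᵗ)
  hopᵉ W u v = ifᵉ (isEqᵉ u v) (someᵉ 0ℚᵉ) (entryᵉ noneᵉ W u v)

  minMᵉ addMᵉ : Exp Γ (maybeᵗ ratᵗ) → Exp Γ (maybeᵗ ratᵗ) → Exp Γ (maybeᵗ ratᵗ)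
  minMᵉ a b = callᵉ {Θ = maybeᵗ ratᵗ ∷ maybeᵗ ratᵗ ∷ []} (a ▸ b ▸ ∙)
    (caseMᵉ x1 x0 (caseMᵉ x1 (someᵉ x0) (ifᵉ (leqᵉ x1 x0) (someᵉ x1) (someᵉ x0))))
  addMᵉ a b = callᵉ {Θ = maybeᵗ ratᵗ ∷ maybeᵗ ratᵗ ∷ []} (a ▸ b ▸ ∙)
    (caseMᵉ x1 noneᵉ (caseMᵉ x1 noneᵉ (someᵉ (addᵉ x1 x0))))

module _ {A : Type} where

  extendᵉ : Exp (listᵗ (listᵗ A) ∷ listᵗ A ∷ []) (listᵗ (listᵗ A))
  extendᵉ = flattenᵉ (mapᵉ x0 (mapᵉ x2 (consᵉ x0 x1)))

opaque
  distancesᵉ : Exp (listᵗ (listᵗ (maybeᵗ ratᵗ)) ∷ vsᵗ ∷ []) (listᵗ (listᵗ ratᵗ))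
  distancesᵉ = mapᵉ (foldᵉ x1 (mapᵉ x1 (mapᵉ x2 (hopᵉ x2 x1 x0)))
                           (mapᵉ x3 (mapᵉ x4
                             (foldᵉ x5 noneᵉ (minMᵉ (addMᵉ (hopᵉ x6 x3 x1) (entryᵉ noneᵉ x4 x1 x2)) x0)))))
                    (mapᵉ x0 (caseMᵉ x0 0ℚᵉ x0))

  irreducibleᵉ : Exp (listᵗ (listᵗ ratᵗ) ∷ vsᵗ ∷ []) (listᵗ (listᵗ boolᵗ))
  irreducibleᵉ =
    mapᵉ x1 (mapᵉ x2 (ifᵉ (isEqᵉ x1 x0) falseᵉ
      (allᵉ x3
        (ifᵉ (isEqᵉ x1 x3) trueᵉ
        (ifᵉ (isEqᵉ x1 x2) trueᵉ
        (ifᵉ (leqᵉ (addᵉ (entryᵉ 0ℚᵉ x4 x3 x1) (entryᵉ 0ℚᵉ x4 x1 x2)) (entryᵉ 0ℚᵉ x4 x3 x2)) falseᵉ trueᵉ))))))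

module _ {Γ : Cx} (p : Exp Γ probᵗ) where

  vsᵉ : Exp Γ vsᵗ
  vsᵉ = fstᵉ p
  Xᵉ : Exp Γ setᵗ
  Xᵉ = fstᵉ (sndᵉ p)
  Dᵉ : Exp Γ (listᵗ (listᵗ ratᵗ))
  Dᵉ = fstᵉ (sndᵉ (sndᵉ p))
  Aᵉ : Exp Γ (listᵗ (listᵗ boolᵗ))
  Aᵉ = fstᵉ (sndᵉ (sndᵉ (sndᵉ p)))
  psᵉ : Exp Γ vsᵗ
  psᵉ = fstᵉ (sndᵉ (sndᵉ (sndᵉ (sndᵉ p))))
  dfᵉ : Exp Γ rowᵗ
  dfᵉ = sndᵉ (sndᵉ (sndᵉ (sndᵉ (sndᵉ p))))

  distᵉ : Exp Γ natᵗ → Exp Γ natᵗ → Exp Γ ratᵗ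
  distᵉ = entryᵉ 0ℚᵉ Dᵉ

agreeᵉ : Exp (rowᵗ ∷ natᵗ ∷ rowᵗ ∷ natᵗ ∷ probᵗ ∷ []) boolᵗ
agreeᵉ = allᵉ (psᵉ x4)
  (letᵉ (atᵉ zeroᵉ x4 x1) (letᵉ (atᵉ zeroᵉ x3 x2)
    (ifᵉ (isEqᵉ x1 x0) trueᵉ
    (ifᵉ (leqᵉ (addᵉ (distᵉ p v u) (distᵉ p u x1)) (distᵉ p v x1)) falseᵉ
    (ifᵉ (leqᵉ (addᵉ (distᵉ p u v) (distᵉ p v x0)) (distᵉ p u x0)) falseᵉ trueᵉ)))))
  where
  v u : Exp (natᵗ ∷ natᵗ ∷ boolᵗ ∷ natᵗ ∷ rowᵗ ∷ natᵗ ∷ rowᵗ ∷ natᵗ ∷ probᵗ ∷ []) natᵗ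
  u = x5
  v = x7
  p : Exp (natᵗ ∷ natᵗ ∷ boolᵗ ∷ natᵗ ∷ rowᵗ ∷ natᵗ ∷ rowᵗ ∷ natᵗ ∷ probᵗ ∷ []) probᵗ
  p = varᵉ (there (there (there (there (there i3)))))

unaryᵉ : Exp (rowᵗ ∷ natᵗ ∷ probᵗ ∷ []) boolᵗ
unaryᵉ = ifᵉ (atᵉ falseᵉ (Xᵉ x2) x1) (isInᵉ x1 x0) trueᵉ

componentᵉ : Exp (natᵗ ∷ setᵗ ∷ probᵗ ∷ []) setᵗ
componentᵉ =
  foldᵉ (vsᵉ x2) (mapᵉ (vsᵉ x2) (ifᵉ (atᵉ falseᵉ x2 x0) falseᵉ (isEqᵉ x0 x1)))
    (mapᵉ (vsᵉ x4) (ifᵉ (atᵉ falseᵉ x4 x0) falseᵉ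
                   (ifᵉ (atᵉ falseᵉ x1 x0) trueᵉ
                   (anyᵉ (vsᵉ x5) (ifᵉ (atᵉ falseᵉ x3 x1) (entryᵉ falseᵉ (Aᵉ x7) x1 x2) falseᵉ)))))

mergeᵉ : Exp (listᵗ (maybeᵗ labᵗ) ∷ partᵗ ∷ partᵗ ∷ probᵗ ∷ []) labᵗ
mergeᵉ = mapᵉ (vsᵉ x3)
  (caseMᵉ (findᵉ x3 x0)
    (caseMᵉ (findᵉ x2 x0) (caseMᵉ (atᵉ noneᵉ x1 x0) (dfᵉ x4) (atᵉ (dfᵉ x5) x0 x1)) x0)
    x0)

validᵉ : Exp (labᵗ ∷ listᵗ (maybeᵗ labᵗ) ∷ partᵗ ∷ setᵗ ∷ probᵗ ∷ []) boolᵗ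
validᵉ = allᵉ (vsᵉ x4)
  (ifᵉ (atᵉ falseᵉ x5 x1)
    (ifᵉ (ifᵉ (isJustᵉ (findᵉ x4 x1)) trueᵉ (isJustᵉ (atᵉ noneᵉ x3 x1)))
      (ifᵉ (callᵉ (x6 ▸ x1 ▸ atᵉ (dfᵉ x6) x2 x1 ▸ ∙) unaryᵉ)
        (allᵉ (vsᵉ x6)
          (ifᵉ (entryᵉ falseᵉ (Aᵉ p) x3 x1)
            (ifᵉ (ifᵉ (atᵉ falseᵉ x7 x1) trueᵉ (isJustᵉ (findᵉ x6 x1)))
              (callᵉ (p ▸ x3 ▸ atᵉ (dfᵉ p) x4 x3 ▸ x1 ▸ atᵉ (dfᵉ p) x4 x1 ▸ ∙) agreeᵉ)
              falseᵉ)
            trueᵉ))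
        falseᵉ)
      falseᵉ)
    trueᵉ)
  where
  p : Exp (boolᵗ ∷ natᵗ ∷ boolᵗ ∷ natᵗ ∷ labᵗ ∷ listᵗ (maybeᵗ labᵗ) ∷ partᵗ ∷ setᵗ ∷ probᵗ ∷ []) probᵗ
  p = varᵉ (there (there (there (there (there i3)))))

candidateᵉ : Exp (partᵗ ×ᵗ listᵗ (maybeᵗ labᵗ) ∷ partᵗ ∷ setᵗ ∷ probᵗ ∷ []) (maybeᵗ labᵗ)
candidateᵉ =
  letᵉ (callᵉ (x3 ▸ x1 ▸ fstᵉ x0 ▸ sndᵉ x0 ▸ ∙) mergeᵉ)
    (ifᵉ (callᵉ (x4 ▸ x3 ▸ fstᵉ x1 ▸ sndᵉ x1 ▸ x0 ▸ ∙) validᵉ) (someᵉ x0) noneᵉ)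

totalᵉ : Exp (labᵗ ∷ setᵗ ∷ probᵗ ∷ []) ratᵗ
totalᵉ = foldᵉ (vsᵉ x2) 0ℚᵉ
  (addᵉ (ifᵉ (atᵉ falseᵉ x3 x1) (distᵉ x4 x1 (parᵉ x1 (atᵉ (dfᵉ x4) x2 x1))) 0ℚᵉ) x0)

bestᵉ : Exp (tableᵗ ∷ partᵗ ∷ setᵗ ∷ probᵗ ∷ []) (maybeᵗ labᵗ)
bestᵉ = foldᵉ x0 noneᵉ
  (caseMᵉ (callᵉ (x5 ▸ x4 ▸ x3 ▸ x1 ▸ ∙) candidateᵉ)
    x0
    (caseMᵉ x1
      (someᵉ x0)
      (ifᵉ (leqᵉ (callᵉ (x7 ▸ x6 ▸ x1 ▸ ∙) totalᵉ) (callᵉ (x7 ▸ x6 ▸ x0 ▸ ∙) totalᵉ)) (someᵉ x1) (someᵉ x0))))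

roundᵉ : Exp (tableᵗ ∷ probᵗ ∷ []) tableᵗ
roundᵉ = mapᵉ x0 (pairᵉ (fstᵉ x0)
  (letᵉ (mapᵉ (vsᵉ x2) (isJustᵉ (findᵉ (fstᵉ x1) x0)))
    (mapᵉ (vsᵉ x3) (callᵉ (x4 ▸ callᵉ (x4 ▸ x1 ▸ x0 ▸ ∙) componentᵉ ▸ fstᵉ x2 ▸ x3 ▸ ∙) bestᵉ))))

opaque
  solveᵉ : Exp (listᵗ partᵗ ∷ probᵗ ∷ []) (maybeᵗ labᵗ)
  solveᵉ = callᵉ (x1 ▸ mapᵉ (vsᵉ x1) trueᵉ ▸ nilᵉ ▸
      foldᵉ (vsᵉ x1) (mapᵉ x0 (pairᵉ x0 (mapᵉ (vsᵉ x2) noneᵉ))) (callᵉ (x3 ▸ x0 ▸ ∙) roundᵉ) ▸ ∙) bestᵉ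

searchStepᵉ : Exp (listᵗ partᵗ ∷ probᵗ ∷ []) (maybeᵗ labᵗ) →
              Exp (resᵗ ∷ partᵗ ∷ probᵗ ∷ []) (resᵗ)
searchStepᵉ solver =
  caseMᵉ (sndᵉ x0)
    (letᵉ (callᵉ (x1 ▸ fstᵉ x0 ▸ ∙) extendᵉ) (pairᵉ x0 (callᵉ (x3 ▸ x0 ▸ ∙) solver)))
    x1

searchᵉ : Exp (resᵗ ∷ partᵗ ∷ probᵗ ∷ []) (resᵗ) →
          Exp (partᵗ ∷ probᵗ ∷ []) (resᵗ)
searchᵉ step = foldᵉ (vsᵉ x1) (pairᵉ (consᵉ nilᵉ nilᵉ) noneᵉ) (callᵉ (x3 ▸ x2 ▸ x0 ▸ ∙) step)

opaque
  outputᵉ : Exp (labᵗ ∷ probᵗ ∷ []) (setᵗ ×ᵗ listᵗ setᵗ)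
  outputᵉ = pairᵉ
    (mapᵉ (vsᵉ x1) (isInᵉ x0 (atᵉ (dfᵉ x2) x1 x0)))
    (mapᵉ (vsᵉ x1) (mapᵉ (vsᵉ x2)
      (ifᵉ (isEqᵉ x1 x0) falseᵉ
      (ifᵉ (isEqᵉ (parᵉ x0 (atᵉ (dfᵉ x3) x2 x0)) x1) trueᵉ
      (isEqᵉ (parᵉ x1 (atᵉ (dfᵉ x3) x2 x1)) x0)))))

allRowsᵉ : Exp (natᵗ ∷ natᵗ ∷ vsᵗ ∷ []) labᵗ
allRowsᵉ = iterᵉ x0 (consᵉ (consᵉ x1 nilᵉ) nilᵉ) (callᵉ (x3 ▸ x0 ▸ ∙) extendᵉ)

instᵗ solᵗ : Type
instᵗ = listᵗ (listᵗ (maybeᵗ ratᵗ)) ×ᵗ setᵗ ×ᵗ natᵗ ×ᵗ natᵗ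
solᵗ  = setᵗ ×ᵗ listᵗ setᵗ

problemᵉ : Exp (labᵗ ∷ vsᵗ ∷ instᵗ ∷ []) probᵗ
problemᵉ =
  letᵉ (callᵉ (x1 ▸ fstᵉ x2 ▸ ∙) distancesᵉ)
  (letᵉ (caseLᵉ x1 nilᵉ x0)
  (letᵉ (iotaᵉ x0)
  (pairᵉ x4 (pairᵉ (fstᵉ (sndᵉ x5)) (pairᵉ x2 (pairᵉ (callᵉ (x4 ▸ x2 ▸ ∙) irreducibleᵉ) (pairᵉ x0 x1)))))))

pairsᵉ : Exp (labᵗ ∷ vsᵗ ∷ instᵗ ∷ []) partᵗ
pairsᵉ = flattenᵉ (mapᵉ x1 (mapᵉ x1 (pairᵉ x1 x0)))

generalᵉ : Exp (instᵗ ∷ []) vsᵗ → Exp (vsᵗ ∷ instᵗ ∷ []) labᵗ → Exp (labᵗ ∷ vsᵗ ∷ instᵗ ∷ []) probᵗ →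
           Exp (probᵗ ∷ labᵗ ∷ vsᵗ ∷ instᵗ ∷ []) partᵗ → Exp (partᵗ ∷ probᵗ ∷ labᵗ ∷ vsᵗ ∷ instᵗ ∷ []) resᵗ →
           Exp (instᵗ ∷ []) solᵗ
generalᵉ points rows problem pairs result =
  letᵉ points (letᵉ rows (letᵉ problem (letᵉ pairs (letᵉ result
    (callᵉ (x2 ▸ caseMᵉ (sndᵉ x0) nilᵉ x0 ▸ ∙) outputᵉ)))))

mainᵉ : Exp (instᵗ ∷ []) solᵗ → Exp (instᵗ ∷ []) solᵗ
mainᵉ body =
  caseLᵉ (fstᵉ x0) (pairᵉ nilᵉ nilᵉ)
    (caseLᵉ x1 (pairᵉ (consᵉ trueᵉ nilᵉ) (consᵉ (consᵉ falseᵉ nilᵉ) nilᵉ))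
      (callᵉ (x4 ▸ ∙) body))

pointsᵉ : Exp (instᵗ ∷ []) vsᵗ
pointsᵉ = iotaᵉ (fstᵉ x0)

callRowsᵉ : Exp (vsᵗ ∷ instᵗ ∷ []) labᵗ
callRowsᵉ = callᵉ (x0 ▸ fstᵉ (sndᵉ (sndᵉ x1)) ▸ sndᵉ (sndᵉ (sndᵉ x1)) ▸ ∙) allRowsᵉ

callProblemᵉ : Exp (labᵗ ∷ vsᵗ ∷ instᵗ ∷ []) probᵗ
callProblemᵉ = callᵉ (x2 ▸ x1 ▸ x0 ▸ ∙) problemᵉ

callPairsᵉ : Exp (probᵗ ∷ labᵗ ∷ vsᵗ ∷ instᵗ ∷ []) partᵗ
callPairsᵉ = callᵉ (x3 ▸ x2 ▸ x1 ▸ ∙) pairsᵉ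

callSearchᵉ : Exp (partᵗ ∷ probᵗ ∷ labᵗ ∷ vsᵗ ∷ instᵗ ∷ []) resᵗ
callSearchᵉ = callᵉ (x1 ▸ x0 ▸ ∙) (searchᵉ (searchStepᵉ solveᵉ))

programᵉ : Exp (instᵗ ∷ []) solᵗ
programᵉ = generalᵉ pointsᵉ callRowsᵉ callProblemᵉ callPairsᵉ callSearchᵉ

opaque
  unfolding allB anyB _≤ᵇ_ isEq at isIn find par Solver.price Solver.agree Solver.unary Solver.component
            general distancesᵉ solveᵉ outputᵉ

  eval-main : ∀ inst → eval (mainᵉ programᵉ) (inst ∷ []) ≡ solution inst
  eval-main inst = refl

  eval-problem : ∀ rows vs W X r k → eval problemᵉ (rows ∷ vs ∷ (W , X , r , k) ∷ []) ≡
    (vs , X , distances vs W , irreducible vs (distances vs W) , iota (firstOr [] rows) , firstOr [] rows)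
  eval-problem rows vs W X r k = refl

  eval-searchStep : ∀ vs X D A ps df pairs acc →
    eval (searchStepᵉ solveᵉ) (acc ∷ pairs ∷ (vs , X , D , A , ps , df) ∷ []) ≡ Solver.searchStep vs X D A ps df pairs acc
  eval-searchStep vs X D A ps df pairs acc = refl

-- Booleans

bool? : ∀ b → b ≡ true ⊎ b ≡ false
bool? true  = inj₁ refl
bool? false = inj₂ refl

true≢false : ∀ {b} → b ≡ true → b ≡ false → ⊥
true≢false refl ()

¬true : ∀ {b} → ¬ (b ≡ true) → b ≡ false
¬true {true}  p = ⊥-elim (p refl)
¬true {false} p = refl

bool-ext : ∀ {a b} → (a ≡ true → b ≡ true) → (b ≡ true → a ≡ true) → a ≡ b
bool-ext {true}  p q = sym (p refl)
bool-ext {false} p q = sym (¬true (λ r → true≢false (q r) refl))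

T⇒≡ : ∀ {b} → T b → b ≡ true
T⇒≡ {true} _ = refl

≡⇒T : ∀ {b} → b ≡ true → T b
≡⇒T refl = tt

and-elim : ∀ {a b} → (if a then b else false) ≡ true → a ≡ true × b ≡ true
and-elim {true} p = refl , p

and-intro : ∀ {a b} → a ≡ true → b ≡ true → (if a then b else false) ≡ true
and-intro refl p = p

or-elim : ∀ {a b} → (if a then true else b) ≡ true → a ≡ true ⊎ b ≡ true
or-elim {true}  p = inj₁ refl
or-elim {false} p = inj₂ p

or-introˡ : ∀ {a b} → a ≡ true → (if a then true else b) ≡ true
or-introˡ refl = refl

or-introʳ : ∀ {a b} → b ≡ true → (if a then true else b) ≡ true
or-introʳ {true}  p = refl
or-introʳ {false} p = p

imp-elim : ∀ {a b} → (if a then b else true) ≡ true → a ≡ true → b ≡ true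
imp-elim p refl = p

imp-intro : ∀ {a b} → (a ≡ true → b ≡ true) → (if a then b else true) ≡ true
imp-intro {true}  p = p refl
imp-intro {false} p = refl

nand-elim : ∀ {a b} → (if a then false else b) ≡ true → a ≡ false × b ≡ true
nand-elim {false} p = refl , p

nand-intro : ∀ {a b} → a ≡ false → b ≡ true → (if a then false else b) ≡ true
nand-intro refl p = p

if-true : ∀ {A : Set} {b} {x y : A} → b ≡ true → (if b then x else y) ≡ x
if-true refl = refl

if-false : ∀ {A : Set} {b} {x y : A} → b ≡ false → (if b then x else y) ≡ y
if-false refl = refl

opaque
  unfolding _≤ᵇ_

  ≤ᵇ-true : ∀ {p q} → (p ≤ᵇ q) ≡ true → p ℚ.≤ q
  ≤ᵇ-true e = ℚ.≤ᵇ⇒≤ (≡⇒T e)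

  ≤ᵇ-intro : ∀ {p q} → p ℚ.≤ q → (p ≤ᵇ q) ≡ true
  ≤ᵇ-intro = T⇒≡ ∘ ℚ.≤⇒≤ᵇ

≤ᵇ-false : ∀ {p q} → (p ≤ᵇ q) ≡ false → q ℚ.< p
≤ᵇ-false e = ℚ.≰⇒> (λ p≤q → true≢false (≤ᵇ-intro p≤q) e)

≤ᵇ-intro-false : ∀ {p q} → q ℚ.< p → (p ≤ᵇ q) ≡ false
≤ᵇ-intro-false q<p = ¬true (λ e → ℚ.<-irrefl refl (ℚ.<-≤-trans q<p (≤ᵇ-true e)))

module _ {A : Set} {p : A → Bool} where

  opaque
    unfolding allB anyB

    allB-elim : ∀ {xs} → allB p xs ≡ true → ∀ {x} → x ∈ˡ xs → p x ≡ true
    allB-elim {y ∷ ys} e (here refl) = proj₁ (and-elim {p y} e)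
    allB-elim {y ∷ ys} e (there x∈)  = allB-elim (proj₂ (and-elim {p y} e)) x∈

    allB-intro : ∀ xs → (∀ {x} → x ∈ˡ xs → p x ≡ true) → allB p xs ≡ true
    allB-intro []       f = refl
    allB-intro (x ∷ xs) f = and-intro (f (here refl)) (allB-intro xs (f ∘ there))

    anyB-elim : ∀ xs → anyB p xs ≡ true → ∃[ x ] (x ∈ˡ xs × p x ≡ true)
    anyB-elim (x ∷ xs) e with or-elim {p x} e
    ... | inj₁ f = x , here refl , f
    ... | inj₂ f with anyB-elim xs f
    ... | y , y∈ , g = y , there y∈ , g

    anyB-intro : ∀ {xs x} → x ∈ˡ xs → p x ≡ true → anyB p xs ≡ true
    anyB-intro (here refl) e = or-introˡ e
    anyB-intro {y ∷ ys} (there x∈) e = or-introʳ {p y} (anyB-intro x∈ e)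

-- Numbers and positions

iter-shift : ∀ {B : Set} m (f : B → B) z → f (iter m z f) ≡ iter m (f z) f
iter-shift zero    f z = refl
iter-shift (suc m) f z = cong f (iter-shift m f z)

isEq-nothing : ∀ y → iter y nothing (caseM nothing (caseN nothing just)) ≡ nothing
isEq-nothing zero    = refl
isEq-nothing (suc y) = cong (caseM nothing (caseN nothing just)) (isEq-nothing y)

opaque
  unfolding isEq

  isEq-≡ᵇ : ∀ x y → isEq x y ≡ (x ℕ.≡ᵇ y)
  isEq-≡ᵇ zero    zero    = refl
  isEq-≡ᵇ (suc x) zero    = refl
  isEq-≡ᵇ zero    (suc y)
    rewrite iter-shift y (caseM nothing (caseN nothing just)) (just 0) | isEq-nothing y = refl
  isEq-≡ᵇ (suc x) (suc y)
    rewrite iter-shift y (caseM nothing (caseN nothing just)) (just (suc x)) = isEq-≡ᵇ x y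

isEq-true : ∀ {x y} → isEq x y ≡ true → x ≡ y
isEq-true {x} {y} e = ℕ.≡ᵇ⇒≡ x y (≡⇒T (trans (sym (isEq-≡ᵇ x y)) e))

isEq-intro : ∀ {x y} → x ≡ y → isEq x y ≡ true
isEq-intro {x} {y} e = trans (isEq-≡ᵇ x y) (T⇒≡ (ℕ.≡⇒≡ᵇ x y e))

isEq-≢ : ∀ {x y} → x ≢ y → isEq x y ≡ false
isEq-≢ p = ¬true (p ∘ isEq-true)

isEq-false : ∀ {x y} → isEq x y ≡ false → x ≢ y
isEq-false e p = true≢false (isEq-intro p) e

tails-[] : ∀ {A : Set} i → iter {List A} i [] (caseL [] (λ _ ys → ys)) ≡ []
tails-[] zero    = refl
tails-[] (suc i) = cong (caseL [] (λ _ ys → ys)) (tails-[] i)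

opaque
  unfolding at

  at-[] : ∀ {A : Set} {d : A} i → at d [] i ≡ d
  at-[] {d = d} i = cong (caseL d (λ x _ → x)) (tails-[] i)

  at-zero : ∀ {A : Set} {d x : A} {xs} → at d (x ∷ xs) 0 ≡ x
  at-zero = refl

  at-suc : ∀ {A : Set} {d x : A} {xs} i → at d (x ∷ xs) (suc i) ≡ at d xs i
  at-suc {x = x} {xs} i rewrite iter-shift i (caseL [] (λ _ ys → ys)) (x ∷ xs) = refl

at-tabulate : ∀ {A : Set} {d : A} {n} (f : Fin n → A) v → at d (tabulate f) (toℕ v) ≡ f v
at-tabulate f zero    = at-zero
at-tabulate f (suc v) = trans (at-suc (toℕ v)) (at-tabulate (f ∘ suc) v)

at-All : ∀ {A : Set} {P : A → Set} {d xs} → P d → All P xs → ∀ i → P (at d xs i)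
at-All {P = P} pd []                  i       = subst P (sym (at-[] i)) pd
at-All {P = P} pd (px ∷ pxs)          zero    = subst P (sym at-zero) px
at-All {P = P} pd (_∷_ {x} {xs} px pxs) (suc i) = subst P (sym (at-suc i)) (at-All pd pxs i)

V : ∀ n → List ℕ
V n = tabulate {n = n} toℕ

at-V : ∀ {A : Set} {d : A} {n} (f : ℕ → A) (v : Fin n) → at d (map f (V n)) (toℕ v) ≡ f (toℕ v)
at-V {n = n} f v rewrite map-tabulate (toℕ {n}) f = at-tabulate (f ∘ toℕ) v

entry-V : ∀ {A : Set} {d : A} {n} (f : ℕ → ℕ → A) (u v : Fin n) →
          entry d (mat (V n) f) (toℕ u) (toℕ v) ≡ f (toℕ u) (toℕ v)
entry-V {n = n} f u v rewrite at-V {d = []} (λ u → map (f u) (V n)) u = at-V (f (toℕ u)) v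

∈-V : ∀ {n} (v : Fin n) → toℕ v ∈ˡ V n
∈-V = go toℕ
  where
  go : ∀ {n} (f : Fin n → ℕ) v → f v ∈ˡ tabulate f
  go f zero    = here refl
  go f (suc v) = there (go (f ∘ suc) v)

V-∈ : ∀ {n x} → x ∈ˡ V n → ∃[ v ] x ≡ toℕ {n} v
V-∈ = go toℕ
  where
  go : ∀ {n x} (f : Fin n → ℕ) → x ∈ˡ tabulate f → ∃[ v ] x ≡ f v
  go {suc n} f (here p)  = zero , p
  go {suc n} f (there p) with go (f ∘ suc) p
  ... | v , q = suc v , q

allV-elim : ∀ {n p} → allB p (V n) ≡ true → ∀ v → p (toℕ v) ≡ true
allV-elim {n} {p} e v = allB-elim {p = p} {V n} e (∈-V v)

allV-intro : ∀ {n p} → (∀ v → p (toℕ {n} v) ≡ true) → allB p (V n) ≡ true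
allV-intro {n} {p} f = allB-intro (V n) λ x∈ → let v , e = V-∈ x∈ in trans (cong p e) (f v)

anyV-elim : ∀ {n p} → anyB p (V n) ≡ true → ∃[ v ] p (toℕ {n} v) ≡ true
anyV-elim {n} {p} e with anyB-elim {p = p} (V n) e
... | x , x∈ , f = let v , g = V-∈ x∈ in v , trans (cong p (sym g)) f

anyV-intro : ∀ {n p} v → p (toℕ {n} v) ≡ true → anyB p (V n) ≡ true
anyV-intro {p = p} v e = anyB-intro {p = p} (∈-V v) e

map-V-cong : ∀ {A : Set} {n} {f g : ℕ → A} → (∀ v → f (toℕ {n} v) ≡ g (toℕ v)) → map f (V n) ≡ map g (V n)
map-V-cong {n = n} {f} {g} p =
  trans (map-tabulate toℕ f) (trans (tab p) (sym (map-tabulate toℕ g)))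
  where
  tab : ∀ {A : Set} {n} {f g : Fin n → A} → (∀ v → f v ≡ g v) → tabulate f ≡ tabulate g
  tab {n = zero}  p = refl
  tab {n = suc n} p = cong₂ _∷_ (p zero) (tab (p ∘ suc))

iota-V : ∀ {A : Set} (xs : List A) → iota xs ≡ V (List.length xs)
iota-V []       = refl
iota-V (x ∷ xs) = cong (0 ∷_) (trans (cong (map suc) (iota-V xs)) (map-tabulate toℕ suc))

module _ {A : Set} where

  ∈-flatten : ∀ {x : A} xss → x ∈ˡ flatten xss → ∃[ xs ] (xs ∈ˡ xss × x ∈ˡ xs)
  ∈-flatten (xs ∷ xss) p with split xs p
    where
    split : ∀ {x : A} {zs} ys → x ∈ˡ foldr (λ x acc → x ∷ acc) zs ys → x ∈ˡ ys ⊎ x ∈ˡ zs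
    split []       p         = inj₂ p
    split (y ∷ ys) (here e)  = inj₁ (here e)
    split (y ∷ ys) (there p) with split ys p
    ... | inj₁ q = inj₁ (there q)
    ... | inj₂ q = inj₂ q
  ... | inj₁ q = xs , here refl , q
  ... | inj₂ q with ∈-flatten xss q
  ... | ys , r , s = ys , there r , s

  flatten-∈ : ∀ {x : A} {xs xss} → xs ∈ˡ xss → x ∈ˡ xs → x ∈ˡ flatten xss
  flatten-∈ {xss = ys ∷ xss} (here refl) q = inˡ q
    where
    inˡ : ∀ {x : A} {ys zs} → x ∈ˡ ys → x ∈ˡ foldr (λ x acc → x ∷ acc) zs ys
    inˡ (here e)  = here e
    inˡ (there q) = there (inˡ q)
  flatten-∈ {xss = ys ∷ xss} (there p) q = inʳ ys (flatten-∈ p q)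
    where
    inʳ : ∀ {x : A} ys {zs} → x ∈ˡ zs → x ∈ˡ foldr (λ x acc → x ∷ acc) zs ys
    inʳ []       q = q
    inʳ (y ∷ ys) q = there (inʳ ys q)

  length-flatten : ∀ {m} (xss : List (List A)) → (∀ {xs} → xs ∈ˡ xss → List.length xs ≡ m) →
                   List.length (flatten xss) ≡ List.length xss ℕ.* m
  length-flatten []         p = refl
  length-flatten (xs ∷ xss) p =
    trans (len xs) (cong₂ ℕ._+_ (p (here refl)) (length-flatten xss (p ∘ there)))
    where
    len : ∀ {zs} (ys : List A) → List.length (foldr (λ x acc → x ∷ acc) zs ys) ≡ List.length ys ℕ.+ List.length zs
    len []       = refl
    len (y ∷ ys) = cong suc (len ys)

-- Sums and minima

∑ : ∀ {n} → (Fin n → ℚ) → ℚ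
∑ {zero}  f = 0ℚ
∑ {suc n} f = f zero ℚ.+ ∑ (f ∘ suc)

∑-tabulate : ∀ {n} {A : Set} (f : A → ℚ) (g : Fin n → A) →
             foldr (λ v acc → f v ℚ.+ acc) 0ℚ (tabulate g) ≡ ∑ (f ∘ g)
∑-tabulate {zero}  f g = refl
∑-tabulate {suc n} f g = cong (f (g zero) ℚ.+_) (∑-tabulate f (g ∘ suc))

∑-cong : ∀ {n} {f g : Fin n → ℚ} → (∀ v → f v ≡ g v) → ∑ f ≡ ∑ g
∑-cong {zero}  p = refl
∑-cong {suc n} p = cong₂ ℚ._+_ (p zero) (∑-cong (p ∘ suc))

∑-mono : ∀ {n} {f g : Fin n → ℚ} → (∀ v → f v ℚ.≤ g v) → ∑ f ℚ.≤ ∑ g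
∑-mono {zero}  p = ℚ.≤-refl
∑-mono {suc n} p = ℚ.+-mono-≤ (p zero) (∑-mono (p ∘ suc))

∑-0 : ∀ n → ∑ {n} (λ _ → 0ℚ) ≡ 0ℚ
∑-0 zero    = refl
∑-0 (suc n) = trans (ℚ.+-identityˡ _) (∑-0 n)

+-interchange : ∀ a b c d → (a ℚ.+ b) ℚ.+ (c ℚ.+ d) ≡ (a ℚ.+ c) ℚ.+ (b ℚ.+ d)
+-interchange a b c d =
  trans (ℚ.+-assoc a b _)
    (trans (cong (a ℚ.+_) (trans (sym (ℚ.+-assoc b c d))
                             (trans (cong (ℚ._+ d) (ℚ.+-comm b c)) (ℚ.+-assoc c b d))))
           (sym (ℚ.+-assoc a c _)))

∑-+ : ∀ {n} (f g : Fin n → ℚ) → ∑ (λ v → f v ℚ.+ g v) ≡ ∑ f ℚ.+ ∑ g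
∑-+ {zero}  f g = refl
∑-+ {suc n} f g = trans (cong ((f zero ℚ.+ g zero) ℚ.+_) (∑-+ (f ∘ suc) (g ∘ suc)))
                        (+-interchange (f zero) (g zero) _ _)

∑-swap : ∀ {n m} (f : Fin n → Fin m → ℚ) → ∑ (λ u → ∑ (f u)) ≡ ∑ (λ v → ∑ (λ u → f u v))
∑-swap {zero}  {m} f = sym (∑-0 m)
∑-swap {suc n} f = trans (cong (∑ (f zero) ℚ.+_) (∑-swap (f ∘ suc)))
                         (sym (∑-+ (f zero) (λ v → ∑ (λ u → f (suc u) v))))

Nearest : ∀ {n} → (Fin n → Bool) → (Fin n → ℚ) → Fin n → Set
Nearest P f m = P m ≡ true × (∀ y → P y ≡ true → f m ℚ.≤ f y × (f y ℚ.≤ f m → toℕ m ℕ.≤ toℕ y))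

nearest? : ∀ {n} (P : Fin n → Bool) (f : Fin n → ℚ) → (∀ y → P y ≡ false) ⊎ ∃ (Nearest P f)
nearest? {zero}  P f = inj₁ λ ()
nearest? {suc n} P f with bool? (P zero) | nearest? (P ∘ suc) (f ∘ suc)
... | inj₂ p | inj₁ q = inj₁ λ { zero → p ; (suc y) → q y }
... | inj₂ p | inj₂ (m , pm , min) = inj₂ (suc m , pm , λ
  { zero    e → ⊥-elim (true≢false e p)
  ; (suc y) e → proj₁ (min y e) , s≤s ∘ proj₂ (min y e) })
... | inj₁ p | inj₁ q = inj₂ (zero , p , λ
  { zero    e → ℚ.≤-refl , λ _ → z≤n
  ; (suc y) e → ⊥-elim (true≢false e (q y)) })
... | inj₁ p | inj₂ (m , pm , min) with f zero ℚ.≤? f (suc m)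
... | yes z≤m = inj₂ (zero , p , λ
  { zero    e → ℚ.≤-refl , λ _ → z≤n
  ; (suc y) e → ℚ.≤-trans z≤m (proj₁ (min y e)) , λ _ → z≤n })
... | no z≰m = inj₂ (suc m , pm , λ
  { zero    e → ℚ.<⇒≤ (ℚ.≰⇒> z≰m) , λ z≤m → ⊥-elim (z≰m z≤m)
  ; (suc y) e → proj₁ (min y e) , s≤s ∘ proj₂ (min y e) })

nearest : ∀ {n} (P : Fin n → Bool) (f : Fin n → ℚ) {x} → P x ≡ true → ∃ (Nearest P f)
nearest P f {x} px with nearest? P f
... | inj₁ none = ⊥-elim (true≢false px (none x))
... | inj₂ m    = m

-- Walks

module _ {n} {G : Graph n} where

  step-sym : ∀ {u v} → Adj G u v → Adj G v u
  step-sym {u} {v} = subst T (adj-sym G u v)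

  reverse : ∀ {u v} → Walk G u v → Walk G v u
  reverse ε       = ε
  reverse (e ◅ p) = reverse p ◅◅ (step-sym e ◅ ε)

  suffix : ∀ {u v x} (p : Walk G u v) → IsPath G p → x ∈ˡ walkVertices G p → ∃[ q ] IsPath G {x} {v} q
  suffix ε       up       (here refl) = ε , up
  suffix (e ◅ p) up       (here refl) = e ◅ p , up
  suffix (e ◅ p) (_ ∷ up) (there x∈)  = suffix p up x∈

  _∈?ˡ_ : (u : Fin n) (xs : List (Fin n)) → Dec (u ∈ˡ xs)
  _∈?ˡ_ = _∈?_ where open import Data.List.Membership.DecPropositional (Fin._≟_ {n})

  toPath : ∀ {u v} → Walk G u v → ∃[ q ] IsPath G {u} {v} q
  toPath ε = ε , ([] ∷ [])
  toPath {u} (e ◅ p) with toPath p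
  ... | q , uq with u ∈?ˡ walkVertices G q
  ... | yes u∈ = suffix q uq u∈
  ... | no u∉  = e ◅ q , (All.¬Any⇒All¬ _ u∉ ∷ uq)

  length-vertices : ∀ {u v} (p : Walk G u v) → List.length (walkVertices G p) ≡ suc (#edges G p)
  length-vertices ε       = refl
  length-vertices (e ◅ p) = cong suc (length-vertices p)

  unique-≤ : ∀ (xs : List (Fin n)) → Unique xs → List.length xs ℕ.≤ n
  unique-≤ xs ux = Fin.injective⇒≤ (λ {i} {j} → inj xs ux i j)
    where
    inj : ∀ (xs : List (Fin n)) → Unique xs → ∀ i j → List.lookup xs i ≡ List.lookup xs j → i ≡ j
    inj (x ∷ xs) u        zero    zero    e = refl
    inj (x ∷ xs) (p ∷ u)  zero    (suc j) e = ⊥-elim (All.lookup p (∈-lookup {xs = xs} j) e)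
    inj (x ∷ xs) (p ∷ u)  (suc i) zero    e = ⊥-elim (All.lookup p (∈-lookup {xs = xs} i) (sym e))
    inj (x ∷ xs) (p ∷ u)  (suc i) (suc j) e = cong suc (inj xs u i j e)

  path-short : ∀ {u v} (p : Walk G u v) → IsPath G p → #edges G p ℕ.< n
  path-short p up = subst (ℕ._≤ n) (length-vertices p) (unique-≤ _ up)

[_]_ : ∀ {n} → (Fin n → Bool) → (Fin n → ℚ) → Fin n → ℚ
([ P ] f) v = if P v then f v else 0ℚ

_∖_ : ∀ {n} → (Fin n → Bool) → (Fin n → Bool) → Fin n → Bool
(R ∖ K) v = if K v then false else R v

∑-split : ∀ {n} {R K : Fin n → Bool} (f : Fin n → ℚ) → (∀ v → K v ≡ true → R v ≡ true) →
          ∑ ([ R ] f) ≡ ∑ ([ K ] f) ℚ.+ ∑ ([ R ∖ K ] f)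
∑-split {R = R} {K} f K⊆R = trans (∑-cong pointwise) (∑-+ ([ K ] f) ([ R ∖ K ] f))
  where
  pointwise : ∀ v → ([ R ] f) v ≡ ([ K ] f) v ℚ.+ ([ R ∖ K ] f) v
  pointwise v with K v | K⊆R v
  ... | true  | p rewrite p refl = sym (ℚ.+-identityʳ (f v))
  ... | false | p = sym (ℚ.+-identityˡ _)

module _ {n} {c c′ : Fin n → ℚ} {K : Fin n → Fin n → Bool} where

  ∑-classes : (ys : List (Fin n)) (R : Fin n → Bool) → (∀ v → R v ≡ true → v ∈ˡ ys) →
              (∀ v → R v ≡ true → K v v ≡ true) →
              (∀ v u → R v ≡ true → K v u ≡ true → R u ≡ true) →
              (∀ y v u → R y ≡ true → R v ≡ true → K v u ≡ true → K y u ≡ true → K y v ≡ true) →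
              (∀ v → R v ≡ true → ∑ ([ K v ] c) ℚ.≤ ∑ ([ K v ] c′)) →
              ∑ ([ R ] c) ℚ.≤ ∑ ([ R ] c′)
  ∑-classes [] R in-ys rf cl eq le =
    ℚ.≤-reflexive (∑-cong λ v → trans (empty {c} v) (sym (empty {c′} v)))
    where
    empty : ∀ {f : Fin n → ℚ} v → ([ R ] f) v ≡ 0ℚ
    empty v with bool? (R v)
    ... | inj₂ e = if-false e
    ... | inj₁ e with in-ys v e
    ... | ()
  ∑-classes (y ∷ ys) R in-ys rf cl eq le with bool? (R y)
  ... | inj₂ e = ∑-classes ys R (λ v r → tail v r (in-ys v r)) rf cl eq le
    where
    tail : ∀ v → R v ≡ true → v ∈ˡ (y ∷ ys) → v ∈ˡ ys
    tail v r (here refl) = ⊥-elim (true≢false r e)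
    tail v r (there p)   = p
  ... | inj₁ e = begin
    ∑ ([ R ] c)                             ≡⟨ ∑-split c (λ v → cl y v e) ⟩
    ∑ ([ K y ] c) ℚ.+ ∑ ([ R ∖ K y ] c)     ≤⟨ ℚ.+-mono-≤ (le y e) rest ⟩
    ∑ ([ K y ] c′) ℚ.+ ∑ ([ R ∖ K y ] c′)   ≡⟨ ∑-split c′ (λ v → cl y v e) ⟨
    ∑ ([ R ] c′)                            ∎
    where
    open ℚ.≤-Reasoning
    old : ∀ v → (R ∖ K y) v ≡ true → K y v ≡ false × R v ≡ true
    old v r = nand-elim {K y v} r
    tail : ∀ v → (R ∖ K y) v ≡ true → v ∈ˡ (y ∷ ys) → v ∈ˡ ys
    tail v r (here refl) = ⊥-elim (true≢false (rf y e) (proj₁ (old v r)))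
    tail v r (there p)   = p
    rest : ∑ ([ R ∖ K y ] c) ℚ.≤ ∑ ([ R ∖ K y ] c′)
    rest = ∑-classes ys (R ∖ K y) (λ v r → tail v r (in-ys v (proj₂ (old v r))))
      (λ v r → rf v (proj₂ (old v r)))
      (λ v u r k → nand-intro
        (¬true λ k′ → true≢false (eq y v u e (proj₂ (old v r)) k k′) (proj₁ (old v r)))
        (cl v u (proj₂ (old v r)) k))
      (λ z v u r r′ → eq z v u (proj₂ (old z r)) (proj₂ (old v r′)))
      (λ v r → le v (proj₂ (old v r)))

nor-comm : ∀ a b → (if a then false else if b then false else true) ≡ true →
           (if b then false else if a then false else true) ≡ true
nor-comm false false p = refl

caseM-nothing : ∀ {A B : Set} {d : B} {f : A → B} {m} → m ≡ nothing → caseM d f m ≡ d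
caseM-nothing refl = refl

caseM-just : ∀ {A B : Set} {d : B} {f : A → B} {m x} → m ≡ just x → caseM d f m ≡ f x
caseM-just refl = refl

isJust-elim : ∀ {A : Set} {m : Maybe A} → isJust m ≡ true → ∃[ x ] m ≡ just x
isJust-elim {m = just x} _ = x , refl

isJust-false : ∀ {A : Set} {m : Maybe A} → isJust m ≡ false → m ≡ nothing
isJust-false {m = nothing} _ = refl


opaque
  unfolding find isIn anyB

  isJust-find : ∀ (σ : Part) v → isJust (find σ v) ≡ isIn v (map proj₁ σ)
  isJust-find []            v = refl
  isJust-find ((x , l) ∷ σ) v with isEq x v
  ... | true  = refl
  ... | false = isJust-find σ v

  find-restrict : ∀ (ℓ : ℕ → Row) B {v l} → find (map (λ b → b , ℓ b) B) v ≡ just l → l ≡ ℓ v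
  find-restrict ℓ (b ∷ B) {v} e with bool? (isEq b v)
  ... | inj₁ q rewrite q with e
  ... | refl = cong ℓ (isEq-true q)
  find-restrict ℓ (b ∷ B) {v} e | inj₂ q rewrite q = find-restrict ℓ B {v} e

  find-All : ∀ {P : Row → Set} {σ : Part} {v l} → All (P ∘ proj₂) σ → find σ v ≡ just l → P l
  find-All {σ = (x , l′) ∷ σ} {v} (p ∷ ps) e with isEq x v
  ... | true  = subst _ (just-injective e) p
  ... | false = find-All {v = v} ps e

module Correct {n} (X : List Bool) (D : List (List ℚ)) (A : List (List Bool)) (ps : List ℕ) (df : Row)
               (M : Graph n) (A-M : ∀ u v → entry false A (toℕ u) (toℕ v) ≡ adj M u v) where

  open Solver (V n) X D A ps df public

  mem : List Bool → Fin n → Bool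
  mem C v = at false C (toℕ v)

  infix 4 _∋_
  _∋_ : List Bool → Fin n → Set
  C ∋ v = mem C v ≡ true

  opaque
    unfolding agree

    agree-sym : ∀ v l u l′ → agree v l u l′ ≡ true → agree u l′ v l ≡ true
    agree-sym v l u l′ e = allB-intro ps λ {i} i∈ → swap i (allB-elim e i∈)
      where
      swap : ∀ i →
        (if isEq (at 0 l i) (at 0 l′ i) then true else
         if between v u (at 0 l i) then false else if between u v (at 0 l′ i) then false else true) ≡ true →
        (if isEq (at 0 l′ i) (at 0 l i) then true else
         if between u v (at 0 l′ i) then false else if between v u (at 0 l i) then false else true) ≡ true
      swap i p with or-elim {isEq (at 0 l i) (at 0 l′ i)} p
      ... | inj₁ q = or-introˡ (isEq-intro (sym (isEq-true q)))
      ... | inj₂ q = or-introʳ {isEq (at 0 l′ i) (at 0 l i)}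
                       (nor-comm (between v u (at 0 l i)) (between u v (at 0 l′ i)) q)

  -- Components

  minus : List Bool → Graph n
  minus W = record
    { adj        = λ u v → adj M u v ∧ (not (at false W (toℕ u)) ∧ not (at false W (toℕ v)))
    ; adj-sym    = λ u v → cong₂ _∧_ (adj-sym M u v) (∧-comm (not (at false W (toℕ u))) _)
    ; adj-irrefl = λ v → cong (_∧ (not (at false W (toℕ v)) ∧ not (at false W (toℕ v)))) (adj-irrefl M v)
    }

  minus-elim : ∀ W {u v} → Adj (minus W) u v →
               Adj M u v × at false W (toℕ u) ≡ false × at false W (toℕ v) ≡ false
  minus-elim W {u} {v} p with adj M u v | at false W (toℕ u) | at false W (toℕ v)
  ... | true | false | false = tt , refl , refl

  minus-intro : ∀ W {u v} → Adj M u v → at false W (toℕ u) ≡ false → at false W (toℕ v) ≡ false →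
                Adj (minus W) u v
  minus-intro W {u} {v} p q r with adj M u v
  ... | true rewrite q | r = tt

  edge⇒Adj : ∀ {u v} → entry false A (toℕ u) (toℕ v) ≡ true → Adj M u v
  edge⇒Adj {u} {v} e = ≡⇒T (trans (sym (A-M u v)) e)

  Adj⇒edge : ∀ {u v} → Adj M u v → entry false A (toℕ u) (toℕ v) ≡ true
  Adj⇒edge {u} {v} p = trans (A-M u v) (T⇒≡ p)

  module _ (W : List Bool) (x : Fin n) where

    start : ℕ → Bool
    start v = if at false W v then false else isEq v (toℕ x)

    reach : List ℕ → List Bool
    reach = foldr (λ _ S → grow W S) (map start (V n))

    reach-sound : ∀ xs v → reach xs ∋ v → at false W (toℕ v) ≡ false × Walk (minus W) v x
    reach-sound [] v e with nand-elim (trans (sym (at-V start v)) e)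
    ... | p , q with Fin.toℕ-injective {i = v} {x} (isEq-true q)
    ... | refl = p , ε
    reach-sound (_ ∷ xs) v e with nand-elim (trans (sym (at-V _ v)) e)
    ... | p , q with or-elim {at false (reach xs) (toℕ v)} q
    ... | inj₁ r = reach-sound xs v r
    ... | inj₂ r with anyV-elim {n} r
    ... | u , s with and-elim {at false (reach xs) (toℕ u)} s
    ... | s₁ , s₂ with reach-sound xs u s₁
    ... | pu , wu = p , minus-intro W (step-sym {G = M} (edge⇒Adj s₂)) p pu ◅ wu

    reach-complete : ∀ xs {v} (p : Walk (minus W) v x) → at false W (toℕ x) ≡ false →
                     #edges (minus W) p ℕ.≤ List.length xs → reach xs ∋ v
    reach-complete [] ε e _ = trans (at-V start x) (nand-intro e (isEq-intro refl))
    reach-complete (y ∷ xs) ε e _ =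
      trans (at-V _ x) (nand-intro e (or-introˡ (reach-complete xs ε e z≤n)))
    reach-complete (y ∷ xs) {v} (_◅_ {j = u} s p) e (s≤s l) with minus-elim W s
    ... | a , pv , pu = trans (at-V _ v) (nand-intro pv (or-introʳ {at false (reach xs) (toℕ v)}
      (anyV-intro {p = λ u → if at false (reach xs) u then entry false A u (toℕ v) else false} u
         (and-intro (reach-complete xs p e l) (Adj⇒edge (step-sym {G = M} a))))))

  opaque
    unfolding component

    reach-component : ∀ W x → component W (toℕ x) ≡ reach W x (V n)
    reach-component W x = refl

  component-map : ∀ W x → ∃[ f ] component W (toℕ x) ≡ map f (V n)
  component-map W x = proj₁ (go (V n)) , trans (reach-component W x) (proj₂ (go (V n)))
    where
    go : ∀ xs → ∃[ f ] reach W x xs ≡ map f (V n)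
    go []       = _ , refl
    go (_ ∷ xs) = _ , refl

  component-sound : ∀ W x {v} → component W (toℕ x) ∋ v →
                    at false W (toℕ v) ≡ false × Walk (minus W) v x
  component-sound W x {v} e = reach-sound W x (V n) v (trans (cong (λ S → mem S v) (sym (reach-component W x))) e)

  component-complete : ∀ W {x v} → Walk (minus W) v x → at false W (toℕ x) ≡ false →
                       component W (toℕ x) ∋ v
  component-complete W {x} {v} p e with toPath p
  ... | q , uq = trans (cong (λ S → mem S v) (reach-component W x)) (reach-complete W x (V n) q e
    (subst (#edges (minus W) q ℕ.≤_) (sym (length-tabulate {n = n} toℕ)) (ℕ.<⇒≤ (path-short q uq))))

  set-ext : ∀ f g → (∀ v → f (toℕ {n} v) ≡ true → g (toℕ v) ≡ true) →
            (∀ v → g (toℕ {n} v) ≡ true → f (toℕ v) ≡ true) → map f (V n) ≡ map g (V n)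
  set-ext f g p q = map-V-cong λ v → bool-ext (p v) (q v)

  component-≡ : ∀ W {x y} → component W (toℕ x) ∋ y → component W (toℕ x) ≡ component W (toℕ y)
  component-≡ W {x} {y} e with component-map W x | component-map W y
  ... | f , p | g , q = trans p (trans (set-ext f g there′ back) (sym q))
    where
    val : ∀ {z h} → component W z ≡ map h (V n) → ∀ v → at false (component W z) (toℕ v) ≡ h (toℕ v)
    val {h = h} r v = trans (cong (λ l → at false l (toℕ v)) r) (at-V h v)
    y-free : at false W (toℕ y) ≡ false
    y-free = proj₁ (component-sound W x e)
    y⇝x : Walk (minus W) y x
    y⇝x = proj₂ (component-sound W x e)
    x-free : at false W (toℕ x) ≡ false
    x-free = last y⇝x y-free
      where
      last : ∀ {a} → Walk (minus W) a x → at false W (toℕ a) ≡ false → at false W (toℕ x) ≡ false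
      last ε       p = p
      last (s ◅ w) p = last w (proj₂ (proj₂ (minus-elim W s)))
    there′ : ∀ v → f (toℕ v) ≡ true → g (toℕ v) ≡ true
    there′ v r = trans (sym (val q v)) (component-complete W
      (proj₂ (component-sound W x (trans (val p v) r)) ◅◅ reverse {G = minus W} y⇝x) y-free)
    back : ∀ v → g (toℕ v) ≡ true → f (toℕ v) ≡ true
    back v r = trans (sym (val p v)) (component-complete W
      (proj₂ (component-sound W y (trans (val q v) r)) ◅◅ y⇝x) x-free)

  -- Feasible labellings

  record Feasible (C : List Bool) (σ : Part) (ℓ : ℕ → Row) : Set where
    field
      extends : ∀ {u l} → find σ (toℕ {n} u) ≡ just l → ℓ (toℕ u) ≡ l
      unaries : ∀ {v} → C ∋ v → unary (toℕ v) (ℓ (toℕ v)) ≡ true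
      edges   : ∀ {v u} → C ∋ v → Adj M v u → agree (toℕ v) (ℓ (toℕ v)) (toℕ u) (ℓ (toℕ u)) ≡ true
  open Feasible public

  priceOf : (ℕ → Row) → Fin n → ℚ
  priceOf ℓ v = price (toℕ v) (ℓ (toℕ v))

  total-∑ : ∀ C m → total C m ≡ ∑ ([ mem C ] priceOf (at df m))
  total-∑ C m = ∑-tabulate {n} (λ v → if at false C v then price v (at df m v) else 0ℚ) toℕ

  at-merge : ∀ σ τ row v → at df (merge σ τ row) (toℕ v) ≡ pick σ τ row (toℕ v)
  at-merge σ τ row v = at-V (pick σ τ row) v

  candidate-elim : ∀ C σ {τ row m} → candidate C σ (τ , row) ≡ just m →
                   m ≡ merge σ τ row × (∀ v → validAt C τ row m (toℕ v) ≡ true)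
  candidate-elim C σ {τ} {row} e with bool? (allB (validAt C τ row (merge σ τ row)) (V n))
  ... | inj₁ q with trans (sym (if-true q)) e
  ... | refl = refl , allV-elim {n} q
  candidate-elim C σ {τ} {row} e | inj₂ q with trans (sym (if-false q)) e
  ... | ()

  candidate-intro : ∀ C σ {τ row} → (∀ v → validAt C τ row (merge σ τ row) (toℕ v) ≡ true) →
                    candidate C σ (τ , row) ≡ just (merge σ τ row)
  candidate-intro C σ {τ} {row} p = if-true (allV-intro {n} {validAt C τ row (merge σ τ row)} p)

  module _ {C σ τ row m} (e : candidate C σ (τ , row) ≡ just m) where

    valid : ∀ {v} → C ∋ v → covered τ row (toℕ v) ≡ true × unary (toℕ v) (at df m (toℕ v)) ≡ true ×
            (∀ u → validEdge C τ m (toℕ v) (toℕ u) ≡ true)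
    valid {v} v∈C with and-elim {covered τ row (toℕ v)} (imp-elim (proj₂ (candidate-elim C σ e) v) v∈C)
    ... | p , q with and-elim {unary (toℕ v) (at df m (toℕ v))} q
    ... | r , s = p , r , allV-elim {n} s

    valid-edge : ∀ {v u} → C ∋ v → Adj M v u →
                 (if mem C u then true else isJust (find τ (toℕ u))) ≡ true
                 × agree (toℕ v) (at df m (toℕ v)) (toℕ u) (at df m (toℕ u)) ≡ true
    valid-edge {v} {u} v∈C a = and-elim (imp-elim (proj₂ (proj₂ (valid v∈C)) u) (Adj⇒edge a))

    candidate-feasible : Feasible C σ (at df m)
    candidate-feasible .extends {u} f =
      trans (cong (λ m → at df m (toℕ u)) (proj₁ (candidate-elim C σ e)))
        (trans (at-merge σ τ row u) (caseM-just f))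
    candidate-feasible .unaries v∈C = proj₁ (proj₂ (valid v∈C))
    candidate-feasible .edges v∈C a = proj₂ (valid-edge v∈C a)

  better-cases : ∀ C new old {m} → better C new old ≡ just m → new ≡ just m ⊎ old ≡ just m
  better-cases C nothing  old      e = inj₂ e
  better-cases C (just a) nothing  e = inj₁ e
  better-cases C (just a) (just b) e with total C a ≤ᵇ total C b
  ... | true  = inj₁ e
  ... | false = inj₂ e

  better-newer : ∀ C {m} old → ∃[ m′ ] (better C (just m) old ≡ just m′ × total C m′ ℚ.≤ total C m)
  better-newer C {m} nothing  = m , refl , ℚ.≤-refl
  better-newer C {m} (just b) with bool? (total C m ≤ᵇ total C b)
  ... | inj₁ q = m , if-true q , ℚ.≤-refl
  ... | inj₂ q = b , if-false q , ℚ.<⇒≤ (≤ᵇ-false q)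

  better-older : ∀ C new {m} → ∃[ m′ ] (better C new (just m) ≡ just m′ × total C m′ ℚ.≤ total C m)
  better-older C nothing  {m} = m , refl , ℚ.≤-refl
  better-older C (just a) {m} with bool? (total C a ≤ᵇ total C m)
  ... | inj₁ q = a , if-true q , ≤ᵇ-true q
  ... | inj₂ q = m , if-false q , ℚ.≤-refl

  best-∈ : ∀ C σ T {m} → best C σ T ≡ just m → ∃[ p ] (p ∈ˡ T × candidate C σ p ≡ just m)
  best-∈ C σ (p ∷ T) e with better-cases C (candidate C σ p) (best C σ T) e
  ... | inj₁ f = p , here refl , f
  ... | inj₂ f with best-∈ C σ T f
  ... | q , q∈ , g = q , there q∈ , g

  best-≤ : ∀ C σ T {p m} → p ∈ˡ T → candidate C σ p ≡ just m →
           ∃[ m′ ] (best C σ T ≡ just m′ × total C m′ ℚ.≤ total C m)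
  best-≤ C σ (p ∷ T) (here refl) e with better-newer C (best C σ T)
  ... | m′ , f , le = m′ , trans (cong (λ c → better C c (best C σ T)) e) f , le
  best-≤ C σ (p ∷ T) (there q∈)  e with best-≤ C σ T q∈ e
  ... | m′ , f , le with better-older C (candidate C σ p) {m′}
  ... | m″ , g , le′ = m″ , trans (cong (better C (candidate C σ p)) f) g , ℚ.≤-trans le′ le

  best-feasible : ∀ C σ T {m} → best C σ T ≡ just m → Feasible C σ (at df m)
  best-feasible C σ T e with best-∈ C σ T e
  ... | _ , _ , f = candidate-feasible f

  -- Decompositions and the table

  bagSet : List ℕ → List Bool
  bagSet B = map (λ v → isIn v B) (V n)

  domain-bagSet : ∀ τ → domain τ ≡ bagSet (map proj₁ τ)
  domain-bagSet τ = map-V-cong {n = n} λ v → isJust-find τ (toℕ v)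

  mem-bagSet : ∀ B v → mem (bagSet B) v ≡ isIn (toℕ v) B
  mem-bagSet B v = at-V (λ v → isIn v B) v

  -- A tree decomposition with bags of s points, in the form in which the table
  -- recursion explores it.
  data Decomposable (s : ℕ) : ℕ → List Bool → Set where
    node : ∀ {j C} (B : List ℕ) → List.length B ≡ s → All (_∈ˡ V n) B →
           (∀ {v u} → C ∋ v → Adj M v u → C ∋ u ⊎ isIn (toℕ u) B ≡ true) →
           (∀ {v} → C ∋ v → isIn (toℕ v) B ≡ false → Decomposable s j (component (bagSet B) (toℕ v))) →
           Decomposable s (suc j) C

  module Rounds (R : Row → Set) (R-df : R df) (s : ℕ) (U : List Part)
                (U-sound : ∀ {τ} → τ ∈ˡ U → List.length τ ≡ s × All (λ p → proj₁ p ∈ˡ V n × R (proj₂ p)) τ)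
                (U-complete : ∀ {τ} → List.length τ ≡ s → All (λ p → proj₁ p ∈ˡ V n × R (proj₂ p)) τ → τ ∈ˡ U)
                where

    tab : List ℕ → Table
    tab = foldr (λ _ T → round T) (table₀ U)

    rowOf : List ℕ → Part → List (Maybe Lab)
    rowOf []       τ = map (λ _ → nothing) (V n)
    rowOf (_ ∷ xs) τ = map (λ x → best (component (domain τ) x) τ (tab xs)) (V n)

    tab-map : ∀ xs → tab xs ≡ map (λ τ → τ , rowOf xs τ) U
    tab-map []       = refl
    tab-map (x ∷ xs) = trans (cong (map step) (tab-map xs)) (sym (map-∘ U))
      where
      step : Part × List (Maybe Lab) → Part × List (Maybe Lab)
      step p = proj₁ p , map (λ x → best (component (domain (proj₁ p)) x) (proj₁ p) (tab xs)) (V n)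

    ∈-tab : ∀ xs {p} → p ∈ˡ tab xs → proj₁ p ∈ˡ U × p ≡ (proj₁ p , rowOf xs (proj₁ p))
    ∈-tab xs {p} p∈ with ∈-map⁻ (λ τ → τ , rowOf xs τ) (subst (λ T → p ∈ˡ T) (tab-map xs) p∈)
    ... | τ , τ∈ , refl = τ∈ , refl

    tab-∈ : ∀ xs {τ} → τ ∈ˡ U → (τ , rowOf xs τ) ∈ˡ tab xs
    tab-∈ xs τ∈ = subst (λ T → (_ , rowOf xs _) ∈ˡ T) (sym (tab-map xs)) (∈-map⁺ (λ τ → τ , rowOf xs τ) τ∈)

    best-decomposable : ∀ xs {C σ m} → best C σ (tab xs) ≡ just m → Decomposable s (suc (List.length xs)) C
    best-decomposable xs {C} {σ} e with best-∈ C σ (tab xs) e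
    ... | (τ , _) , p∈ , f with ∈-tab xs p∈
    ... | τ∈ , refl with U-sound τ∈
    ... | len , ok = node (map proj₁ τ) (trans (length-map proj₁ τ) len) (All.map⁺ (All.map proj₁ ok))
      (λ {v} {u} v∈ a → closed (or-elim {mem C u} (proj₁ (valid-edge f v∈ a))))
      (λ {v} v∈ v∉ → sub xs v v∉ (proj₁ (valid f v∈)))
      where
      closed : ∀ {u} → C ∋ u ⊎ isJust (find τ (toℕ u)) ≡ true → C ∋ u ⊎ isIn (toℕ u) (map proj₁ τ) ≡ true
      closed         (inj₁ p) = inj₁ p
      closed {u = u} (inj₂ p) = inj₂ (trans (sym (isJust-find τ (toℕ u))) p)
      sub : ∀ xs v → isIn (toℕ v) (map proj₁ τ) ≡ false → covered τ (rowOf xs τ) (toℕ v) ≡ true →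
            Decomposable s (List.length xs) (component (bagSet (map proj₁ τ)) (toℕ v))
      sub xs v v∉ p with or-elim {isJust (find τ (toℕ v))} p
      ... | inj₁ q = ⊥-elim (true≢false q (trans (isJust-find τ (toℕ v)) v∉))
      sub [] v v∉ p | inj₂ q with trans (sym (cong isJust (at-V (λ _ → nothing) v))) q
      ... | ()
      sub (x ∷ xs) v v∉ p | inj₂ q with isJust-elim (trans (cong isJust (sym (at-V _ v))) q)
      ... | m , g = subst (λ W → Decomposable s _ (component W (toℕ v))) (domain-bagSet τ)
                      (best-decomposable xs g)

    best-rows : ∀ xs {C σ m} → All (R ∘ proj₂) σ → best C σ (tab xs) ≡ just m → All R m
    best-rows xs {C} {σ} Rσ e with best-∈ C σ (tab xs) e
    ... | (τ , _) , p∈ , f with ∈-tab xs p∈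
    ... | τ∈ , refl with candidate-elim C σ f
    ... | refl , _ = All.map⁺ (All.tabulate λ x∈ → subst (λ x → R (pick σ τ (rowOf xs τ) x))
                                                     (sym (proj₂ (V-∈ x∈))) (picked (proj₁ (V-∈ x∈))))
      where
      stored : ∀ xs v → R (caseM df (λ m → at df m (toℕ v)) (at nothing (rowOf xs τ) (toℕ v)))
      stored [] v = subst R (sym (caseM-nothing (at-V (λ _ → nothing) v))) R-df
      stored (x ∷ xs) v with at nothing (rowOf (x ∷ xs) τ) (toℕ v) in eq
      ... | nothing = R-df
      ... | just m = at-All R-df (best-rows xs (All.map proj₂ (proj₂ (U-sound τ∈))) (trans (sym (at-V _ v)) eq)) (toℕ v)
      picked : ∀ v → R (pick σ τ (rowOf xs τ) (toℕ v))
      picked v with find σ (toℕ v) in eσ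
      ... | just l = find-All Rσ eσ
      ... | nothing with find τ (toℕ v) in eτ
      ... | just l = find-All (All.map proj₂ (proj₂ (U-sound τ∈))) eτ
      ... | nothing = stored xs v

    best-length : ∀ xs {C σ m} → best C σ (tab xs) ≡ just m → List.length m ≡ n
    best-length xs {C} {σ} e with best-∈ C σ (tab xs) e
    ... | (τ , row) , p∈ , f with candidate-elim C σ f
    ... | refl , _ = trans (length-map (pick σ τ row) (V n)) (length-tabulate {n = n} toℕ)

    optimal : ∀ xs {C σ ℓ} → Decomposable s (suc (List.length xs)) C →
              (∀ v → R (ℓ (toℕ {n} v))) → (∀ {v} → C ∋ v → find σ (toℕ v) ≡ nothing) →
              Feasible C σ ℓ →
              ∃[ m ] (best C σ (tab xs) ≡ just m × total C m ℚ.≤ ∑ ([ mem C ] priceOf ℓ))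
    optimal xs {C} {σ} {ℓ} (node B len B⊆V closed sub) Rℓ disjoint feas =
      let m , e , le = best-≤ C σ (tab xs) (tab-∈ xs τ∈U) (candidate-intro C σ valid-m) in
      m , e , ℚ.≤-trans le (ℚ.≤-trans (ℚ.≤-reflexive (total-∑ C _)) cheap)
      where
      τ : Part
      τ = map (λ b → b , ℓ b) B
      W : List Bool
      W = domain τ
      keys : map proj₁ τ ≡ B
      keys = trans (sym (map-∘ B)) (ids B)
        where
        ids : ∀ (xs : List ℕ) → map (λ b → b) xs ≡ xs
        ids []       = refl
        ids (x ∷ xs) = cong (x ∷_) (ids xs)
      W≡ : W ≡ bagSet B
      W≡ = trans (domain-bagSet τ) (cong bagSet keys)
      find-bag : ∀ v → isJust (find τ v) ≡ isIn v B
      find-bag v = trans (isJust-find τ v) (cong (isIn v) keys)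
      memW : ∀ v → mem W v ≡ isIn (toℕ v) B
      memW v = trans (cong (λ S → mem S v) W≡) (mem-bagSet B v)
      τ∈U : τ ∈ˡ U
      τ∈U = U-complete (trans (length-map _ B) len) (All.map⁺ (All.map (λ b∈ → b∈ , Rb b∈) B⊆V))
        where
        Rb : ∀ {b} → b ∈ˡ V n → R (ℓ b)
        Rb b∈ with V-∈ b∈
        ... | v , refl = Rℓ v
      row : List (Maybe Lab)
      row = rowOf xs τ
      mg : Lab
      mg = merge σ τ row
      K : Fin n → Fin n → Bool
      K v = mem (component W (toℕ v))
      out : ∀ {v} → isIn (toℕ v) B ≡ false → mem W v ≡ false
      out {v} e = trans (memW v) e
      K-refl : ∀ {v} → isIn (toℕ v) B ≡ false → K v v ≡ true
      K-refl e = component-complete W ε (out e)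
      K⊆C : ∀ {v u} → C ∋ v → K v u ≡ true → C ∋ u
      K⊆C {v} v∈ k = go (proj₂ (component-sound W v k))
        where
        go : ∀ {u} → Walk (minus W) u v → C ∋ u
        go ε = v∈
        go {u} (_◅_ {j = w} s p) with minus-elim W s
        ... | a , fu , _ with closed (go p) (step-sym {G = M} a)
        ... | inj₁ q = q
        ... | inj₂ q = ⊥-elim (true≢false q (trans (sym (memW u)) fu))
      K-out : ∀ {v u} → K v u ≡ true → isIn (toℕ u) B ≡ false
      K-out {v} {u} k = trans (sym (memW u)) (proj₁ (component-sound W v k))
      known : ∀ u → isIn (toℕ u) B ≡ true ⊎ (∃[ l ] find σ (toℕ u) ≡ just l) →
              at df mg (toℕ u) ≡ ℓ (toℕ u)
      known u p with find σ (toℕ u) in eσ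
      ... | just l = trans (at-merge σ τ row u) (trans (caseM-just eσ) (sym (feas .extends eσ)))
      known u (inj₁ p) | nothing with isJust-elim (trans (find-bag (toℕ u)) p)
      ... | l , g = trans (at-merge σ τ row u)
                      (trans (caseM-nothing eσ) (trans (caseM-just g) (find-restrict ℓ B g)))
      known u (inj₂ (_ , ())) | nothing

      record Part-of (v : Fin n) : Set where
        field
          lab   : Lab
          entry-row : at nothing row (toℕ v) ≡ just lab
          value : at df mg (toℕ v) ≡ at df lab (toℕ v)
          good  : Feasible (component W (toℕ v)) τ (at df lab)
          low   : ∑ ([ K v ] priceOf (at df lab)) ℚ.≤ ∑ ([ K v ] priceOf ℓ)
          same  : ∀ {u} (k : K v u ≡ true) → at nothing row (toℕ u) ≡ just lab
      open Part-of

      part-of : ∀ xs′ → row ≡ rowOf xs′ τ → (∀ {v} → C ∋ v → isIn (toℕ v) B ≡ false →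
                Decomposable s (List.length xs′) (component (bagSet B) (toℕ v))) →
                ∀ v → C ∋ v → isIn (toℕ v) B ≡ false → Part-of v
      part-of [] eq sub v v∈ v∉ with sub v∈ v∉
      ... | ()
      part-of (x ∷ xs′) eq sub v v∈ v∉
        with optimal xs′ {component W (toℕ v)} {τ} {ℓ}
               (subst (λ S → Decomposable s _ (component S (toℕ v))) (sym W≡) (sub v∈ v∉)) Rℓ
               (λ k → isJust-false (trans (find-bag _) (K-out {v} k)))
               (record { extends = λ f → sym (find-restrict ℓ B f)
                       ; unaries = λ k → feas .unaries (K⊆C v∈ k)
                       ; edges   = λ k → feas .edges (K⊆C v∈ k) })
      ... | m , e , le = record
        { lab = m
        ; entry-row = here-v
        ; value = trans (at-merge σ τ row v) (trans (caseM-nothing (disjoint v∈))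
                    (trans (caseM-nothing {m = find τ (toℕ v)} (isJust-false (trans (find-bag _) v∉))) (caseM-just here-v)))
        ; good = best-feasible _ τ (tab xs′) e
        ; low = ℚ.≤-trans (ℚ.≤-reflexive (sym (total-∑ _ m))) le
        ; same = λ {u} k → trans (cong (λ r → at nothing r (toℕ u)) eq) (trans (at-V _ u)
                   (trans (cong (λ S → best S τ (tab xs′)) (sym (component-≡ W k))) e))
        }
        where
        here-v : at nothing row (toℕ v) ≡ just m
        here-v = trans (cong (λ r → at nothing r (toℕ v)) eq) (trans (at-V _ v) e)

      part : ∀ {v} → C ∋ v → isIn (toℕ v) B ≡ false → Part-of v
      part {v} = part-of xs refl sub v

      value-same : ∀ {v u} (v∈ : C ∋ v) (v∉ : isIn (toℕ v) B ≡ false) → K v u ≡ true →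
                   at df mg (toℕ u) ≡ at df (lab (part v∈ v∉)) (toℕ u)
      value-same {v} {u} v∈ v∉ k =
        trans (value pu) (cong (λ m → at df m (toℕ u))
          (just-injective (trans (sym (entry-row pu)) (same (part v∈ v∉) k))))
        where
        pu : Part-of u
        pu = part (K⊆C v∈ k) (K-out {v} k)

      in-bag : ∀ {v u} (v∈ : C ∋ v) (v∉ : isIn (toℕ v) B ≡ false) → isIn (toℕ u) B ≡ true →
               at df mg (toℕ u) ≡ at df (lab (part v∈ v∉)) (toℕ u)
      in-bag {v} {u} v∈ v∉ u∈B with isJust-elim (trans (find-bag (toℕ u)) u∈B)
      ... | l , f = trans (known u (inj₁ u∈B))
                      (trans (sym (find-restrict ℓ B f)) (sym (good (part v∈ v∉) .extends f)))

      near : ∀ {v u} → isIn (toℕ v) B ≡ false → isIn (toℕ u) B ≡ false → Adj M v u → K v u ≡ true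
      near v∉ u∉ a = component-complete W
        (minus-intro W (step-sym {G = M} a) (out u∉) (out v∉) ◅ ε) (out v∉)

      agree-≡ : ∀ {v u l l₁ l′ l₁′} → l ≡ l₁ → l′ ≡ l₁′ →
                agree v l₁ u l₁′ ≡ true → agree v l u l′ ≡ true
      agree-≡ refl refl p = p

      edge-m : ∀ v u → C ∋ v → Adj M v u → agree (toℕ v) (at df mg (toℕ v)) (toℕ u) (at df mg (toℕ u)) ≡ true
      edge-m v u v∈ a with bool? (isIn (toℕ v) B) | bool? (isIn (toℕ u) B)
      ... | inj₁ vB | inj₁ uB = agree-≡ (known v (inj₁ vB)) (known u (inj₁ uB)) (feas .edges v∈ a)
      ... | inj₂ v∉ | inj₁ uB = agree-≡ (value (part v∈ v∉)) (in-bag v∈ v∉ uB)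
                                  (good (part v∈ v∉) .edges (K-refl v∉) a)
      ... | inj₂ v∉ | inj₂ u∉ = agree-≡ (value (part v∈ v∉)) (value-same {v} {u} v∈ v∉ (near v∉ u∉ a))
                                  (good (part v∈ v∉) .edges (K-refl v∉) a)
      ... | inj₁ vB | inj₂ u∉ with closed v∈ a
      ... | inj₂ uB = ⊥-elim (true≢false uB u∉)
      ... | inj₁ u∈ = agree-≡ (in-bag u∈ u∉ vB) (value (part u∈ u∉))
        (agree-sym (toℕ u) (at df (lab (part u∈ u∉)) (toℕ u)) (toℕ v) (at df (lab (part u∈ u∉)) (toℕ v))
          (good (part u∈ u∉) .edges (K-refl u∉) (step-sym {G = M} a)))

      unary-m : ∀ v → C ∋ v → unary (toℕ v) (at df mg (toℕ v)) ≡ true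
      unary-m v v∈ with bool? (isIn (toℕ v) B)
      ... | inj₁ vB = trans (cong (unary (toℕ v)) (known v (inj₁ vB))) (feas .unaries v∈)
      ... | inj₂ v∉ = trans (cong (unary (toℕ v)) (value (part v∈ v∉)))
                        (good (part v∈ v∉) .unaries (K-refl v∉))

      covered-m : ∀ v → C ∋ v → covered τ row (toℕ v) ≡ true
      covered-m v v∈ with bool? (isIn (toℕ v) B)
      ... | inj₁ vB = or-introˡ (trans (find-bag (toℕ v)) vB)
      ... | inj₂ v∉ = or-introʳ {isJust (find τ (toℕ v))} (cong isJust (entry-row (part v∈ v∉)))

      valid-m : ∀ v → validAt C τ row mg (toℕ v) ≡ true
      valid-m v = imp-intro λ v∈ → and-intro (covered-m v v∈) (and-intro (unary-m v v∈)
        (allV-intro {n} {validEdge C τ mg (toℕ v)} λ u → imp-intro λ e → and-intro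
          (seen u (closed v∈ (edge⇒Adj e))) (edge-m v u v∈ (edge⇒Adj e))))
        where
        seen : ∀ u → C ∋ u ⊎ isIn (toℕ u) B ≡ true → (if mem C u then true else isJust (find τ (toℕ u))) ≡ true
        seen u (inj₁ p) = or-introˡ p
        seen u (inj₂ p) = or-introʳ {mem C u} (trans (find-bag (toℕ u)) p)

      inB C∩B : Fin n → Bool
      inB v = isIn (toℕ v) B
      C∩B v = if inB v then mem C v else false

      cheap : ∑ ([ mem C ] priceOf (at df mg)) ℚ.≤ ∑ ([ mem C ] priceOf ℓ)
      cheap = begin
        ∑ ([ mem C ] new)                                ≡⟨ ∑-split new C∩B⊆C ⟩
        ∑ ([ C∩B ] new) ℚ.+ ∑ ([ mem C ∖ C∩B ] new)      ≤⟨ ℚ.+-mono-≤ (ℚ.≤-reflexive (∑-cong on-bag)) off-bag ⟩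
        ∑ ([ C∩B ] old) ℚ.+ ∑ ([ mem C ∖ C∩B ] old)      ≡⟨ ∑-split old C∩B⊆C ⟨
        ∑ ([ mem C ] old)                                ∎
        where
        open ℚ.≤-Reasoning
        new old : Fin n → ℚ
        new = priceOf (at df mg)
        old = priceOf ℓ
        C∩B⊆C : ∀ v → C∩B v ≡ true → mem C v ≡ true
        C∩B⊆C v e = proj₂ (and-elim {inB v} e)
        on-bag : ∀ v → ([ C∩B ] new) v ≡ ([ C∩B ] old) v
        on-bag v with bool? (C∩B v)
        ... | inj₁ e = trans (if-true e)
          (trans (cong (price (toℕ v)) (known v (inj₁ (proj₁ (and-elim {inB v} e))))) (sym (if-true e)))
        ... | inj₂ e = trans (if-false e) (sym (if-false e))
        rest : ∀ v → (mem C ∖ C∩B) v ≡ true → C ∋ v × isIn (toℕ v) B ≡ false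
        rest v e with nand-elim {C∩B v} e
        ... | p , q = q , ¬true λ vB → true≢false (and-intro vB q) p
        rest-intro : ∀ {v} → C ∋ v → isIn (toℕ v) B ≡ false → (mem C ∖ C∩B) v ≡ true
        rest-intro v∈ v∉ = nand-intro (if-false v∉) v∈
        off-bag : ∑ ([ mem C ∖ C∩B ] new) ℚ.≤ ∑ ([ mem C ∖ C∩B ] old)
        off-bag = ∑-classes {K = K} (allFin n) (mem C ∖ C∩B) (λ v _ → ∈-allFin v)
          (λ v e → K-refl (proj₂ (rest v e)))
          (λ v u e k → rest-intro (K⊆C (proj₁ (rest v e)) k) (K-out {v} k))
          (λ y v u _ e k k′ → subst (λ S → mem S v ≡ true)
             (trans (component-≡ W k) (sym (component-≡ W k′)))
             (K-refl (proj₂ (rest v e))))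
          (λ v e → ℚ.≤-trans (ℚ.≤-reflexive (∑-cong (on-class v e))) (low (part (proj₁ (rest v e)) (proj₂ (rest v e)))))
          where
          on-class : ∀ v e u → ([ K v ] new) u ≡
                     ([ K v ] priceOf (at df (lab (part (proj₁ (rest v e)) (proj₂ (rest v e)))))) u
          on-class v e u with bool? (K v u)
          ... | inj₁ k = trans (if-true k)
            (trans (cong (price (toℕ u)) (value-same (proj₁ (rest v e)) (proj₂ (rest v e)) k)) (sym (if-true k)))
          ... | inj₂ k = trans (if-false k) (sym (if-false k))

opaque
  unfolding isIn

  isIn-elim : ∀ {v l} → isIn v l ≡ true → v ∈ˡ l
  isIn-elim {v} {l} e with anyB-elim {p = λ x → isEq x v} l e
  ... | x , x∈ , f = subst (_∈ˡ l) (isEq-true f) x∈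

  isIn-intro : ∀ {v l} → v ∈ˡ l → isIn v l ≡ true
  isIn-intro {v} v∈ = anyB-intro {p = λ x → isEq x v} v∈ (isEq-intro {v} refl)

members : ∀ {m} → Subset m → List (Fin m)
members Vec.[]            = []
members (true Vec.∷ p)  = zero ∷ map suc (members p)
members (false Vec.∷ p) = map suc (members p)

length-members : ∀ {m} (p : Subset m) → List.length (members p) ≡ ∣ p ∣
length-members Vec.[]            = refl
length-members (true Vec.∷ p)  = cong suc (trans (length-map suc (members p)) (length-members p))
length-members (false Vec.∷ p) = trans (length-map suc (members p)) (length-members p)

members-intro : ∀ {m} (p : Subset m) {v} → lookup p v ≡ true → v ∈ˡ members p
members-intro (true Vec.∷ p)  {zero}  e = here refl
members-intro (true Vec.∷ p)  {suc v} e = there (∈-map⁺ suc (members-intro p e))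
members-intro (false Vec.∷ p) {suc v} e = ∈-map⁺ suc (members-intro p e)

members-elim : ∀ {m} (p : Subset m) {v} → v ∈ˡ members p → lookup p v ≡ true
members-elim (true Vec.∷ p) (here refl) = refl
members-elim (true Vec.∷ p) (there v∈) with ∈-map⁻ suc v∈
... | u , u∈ , refl = members-elim p u∈
members-elim (false Vec.∷ p) v∈ with ∈-map⁻ suc v∈
... | u , u∈ , refl = members-elim p u∈

∈⇒lookup : ∀ {m} {p : Subset m} {v} → v Subset.∈ p → lookup p v ≡ true
∈⇒lookup = Vec.[]=⇒lookup

lookup⇒∈ : ∀ {m} {p : Subset m} {v} → lookup p v ≡ true → v Subset.∈ p
lookup⇒∈ {p = p} {v} = Vec.lookup⇒[]= v p

module _ {n} {G G′ : Graph n} (f : ∀ {u v} → Adj G u v → Adj G′ u v) where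

  mapWalk : ∀ {u v} → Walk G u v → Walk G′ u v
  mapWalk ε       = ε
  mapWalk (s ◅ p) = f s ◅ mapWalk p

  mapWalk-vertices : ∀ {u v} (p : Walk G u v) → walkVertices G′ (mapWalk p) ≡ walkVertices G p
  mapWalk-vertices ε       = refl
  mapWalk-vertices (_◅_ {i = u} s p) = cong (u ∷_) (mapWalk-vertices p)

T-∧ˡ : ∀ {a b} → T (a ∧ b) → T a
T-∧ˡ {true} _ = tt

T-∧ʳ : ∀ {a b} → T (a ∧ b) → T b
T-∧ʳ {true} t = t

T-∧-intro : ∀ {a b} → T a → T b → T (a ∧ b)
T-∧-intro {true} _ t = t

module Bridge {m} (G : Graph m) (acyclic : Acyclic G) {p q : Fin m} (pq : Adj G p q) where

  isE : Fin m → Fin m → Bool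
  isE a b = does (a Fin.≟ p) ∧ does (b Fin.≟ q)

  cut : Graph m
  cut = record
    { adj        = λ a b → adj G a b ∧ not (isE a b ∨ isE b a)
    ; adj-sym    = λ a b → cong₂ _∧_ (adj-sym G a b) (cong not (∨-comm (isE a b) (isE b a)))
    ; adj-irrefl = λ a → cong (_∧ not (isE a a ∨ isE a a)) (adj-irrefl G a)
    }

  cut-avoid-p : ∀ {a b} → Adj G a b → a ≢ p → b ≢ p → Adj cut a b
  cut-avoid-p {a} {b} s a≢ b≢ = T-∧-intro s
    (≡⇒T (cong not (cong₂ _∨_ (cong (_∧ does (b Fin.≟ q)) (dec-false (a Fin.≟ p) a≢))
                              (cong (_∧ does (a Fin.≟ q)) (dec-false (b Fin.≟ p) b≢)))))

  cut-avoid-q : ∀ {a b} → Adj G a b → a ≢ q → b ≢ q → Adj cut a b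
  cut-avoid-q {a} {b} s a≢ b≢ = T-∧-intro s
    (≡⇒T (cong not (cong₂ _∨_ (trans (∧-comm (does (a Fin.≟ p)) _) (cong (_∧ does (a Fin.≟ p)) (dec-false (b Fin.≟ q) b≢)))
                              (trans (∧-comm (does (b Fin.≟ p)) _) (cong (_∧ does (b Fin.≟ p)) (dec-false (a Fin.≟ q) a≢))))))

  no-detour : p ≢ q → ¬ Walk cut p q
  no-detour p≢q w with toPath {G = cut} w
  ... | ε , _ = p≢q refl
  ... | (s ◅ ε) , _ = subst T (cong not (cong (_∨ isE q p)
          (cong₂ _∧_ (dec-true (p Fin.≟ p) refl) (dec-true (q Fin.≟ q) refl)))) (T-∧ʳ {adj G p q} s)
  ... | r@(s ◅ s′ ◅ r′) , ur =
    acyclic (mapWalk forget r) (subst Unique (sym (mapWalk-vertices forget r)) ur) (s≤s (s≤s z≤n))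
            (step-sym {G = G} pq)
    where
    forget : ∀ {u v} → Adj cut u v → Adj G u v
    forget = T-∧ˡ

module Existence {n} (X : List Bool) (D : List (List ℚ)) (A : List (List Bool)) (ps : List ℕ) (df : Row)
                 (M : Graph n) (A-M : ∀ u v → entry false A (toℕ u) (toℕ v) ≡ adj M u v) where

  open Correct X D A ps df M A-M

  everything-∋ : ∀ v → everything ∋ v
  everything-∋ v = at-V (λ _ → true) v

  trivially : ∀ j → Decomposable n (suc j) everything
  trivially j = node (V n) (length-tabulate {n = n} toℕ) (All.tabulate λ x∈ → x∈)
    (λ {_} {u} _ _ → inj₁ (everything-∋ u))
    (λ {v} _ v∉ → ⊥-elim (true≢false (isIn-intro (∈-V v)) v∉))

  asSubset : List Bool → Subset n
  asSubset C = Vec.tabulate (mem C)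

  size : List Bool → ℕ
  size C = ∣ asSubset C ∣

  ∈-asSubset : ∀ {C v} → v Subset.∈ asSubset C → C ∋ v
  ∈-asSubset {C} {v} v∈ = trans (sym (Vec.lookup∘tabulate (mem C) v)) (∈⇒lookup v∈)

  asSubset-∈ : ∀ {C v} → C ∋ v → v Subset.∈ asSubset C
  asSubset-∈ {C} {v} v∈ = lookup⇒∈ (trans (Vec.lookup∘tabulate (mem C) v) v∈)

  size-< : ∀ {C C′ v} → (∀ {u} → C ∋ u → C′ ∋ u) → C′ ∋ v → ¬ C ∋ v → size C ℕ.< size C′
  size-< {C} {C′} {v} sub v∈ v∉ = Subset.p⊂q⇒∣p∣<∣q∣
    ((λ u∈ → asSubset-∈ {C′} (sub (∈-asSubset {C} u∈))) , v , asSubset-∈ {C′} v∈ , v∉ ∘ ∈-asSubset {C})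

  module _ {H : Graph n} (M⊆H : ∀ {u v} → Adj M u v → Adj H u v) {ω : ℕ} (td : TreeDecomposition H ω) where

    open TreeDecomposition td hiding (isTree)

    tree-ok : IsTree Subset.⊤ tree
    tree-ok = TreeDecomposition.isTree td

    InBag : Fin n → Fin #nodes → Set
    InBag v b = lookup (bag b) v ≡ true

    HasBag : List ℕ → Fin #nodes → Set
    HasBag B b = (∀ {v} → isIn (toℕ v) B ≡ true → InBag v b) × (∀ {v} → InBag v b → isIn (toℕ v) B ≡ true)

    bagList : ∀ b {z} → InBag z b → ∃[ B ] (List.length B ≡ suc ω × All (_∈ˡ V n) B × HasBag B b)
    bagList b {z} z∈ = map toℕ zs , len , All.map⁺ (All.tabulate λ {v} _ → ∈-V v) , elim , intro
      where
      xs zs : List (Fin n)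
      xs = members (bag b)
      zs = xs ++ replicate (suc ω ℕ.∸ List.length xs) z
      len : List.length (map toℕ zs) ≡ suc ω
      len = trans (length-map toℕ zs) (trans (length-++ xs)
        (trans (cong (List.length xs ℕ.+_) (length-replicate (suc ω ℕ.∸ List.length xs)))
               (ℕ.m+[n∸m]≡n (subst (ℕ._≤ suc ω) (sym (length-members (bag b))) (bag-size b)))))
      elim : ∀ {v} → isIn (toℕ v) (map toℕ zs) ≡ true → InBag v b
      elim {v} e with ∈-map⁻ toℕ (isIn-elim e)
      ... | u , u∈ , eq with Fin.toℕ-injective eq
      ... | refl with ∈-++⁻ xs u∈
      ... | inj₁ q = members-elim (bag b) q
      ... | inj₂ q = go _ q
        where
        go : ∀ k → v ∈ˡ replicate k z → InBag v b
        go (suc k) (here refl) = z∈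
        go (suc k) (there r)   = go k r
      intro : ∀ {v} → InBag v b → isIn (toℕ v) (map toℕ zs) ≡ true
      intro e = isIn-intro (∈-map⁺ toℕ (∈-++⁺ˡ (members-intro (bag b) e)))

    node-of : ∀ v → ∃ (InBag v)
    node-of v with IsTree.nonempty (subtrees v)
    ... | b , b∈ = b , trans (sym (Vec.lookup∘tabulate (λ b → lookup (bag b) v) b)) (∈⇒lookup b∈)

    cover : ∀ {u v} → Adj M u v → ∃[ b ] (InBag u b × InBag v b)
    cover a with edges-covered (M⊆H a)
    ... | b , u∈ , v∈ = b , ∈⇒lookup u∈ , ∈⇒lookup v∈

    hold : ∀ {v a b} → InBag v a → InBag v b → Walk (induced tree (nodesContaining v)) a b
    hold {v} {a} {b} p q = IsTree.connected (subtrees v) (into a p) (into b q)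
      where
      into : ∀ c → InBag v c → c Subset.∈ nodesContaining v
      into c r = lookup⇒∈ (trans (Vec.lookup∘tabulate (λ b → lookup (bag b) v) c) r)

    hold-step : ∀ {v a b} → Adj (induced tree (nodesContaining v)) a b → Adj tree a b × InBag v a × InBag v b
    hold-step {v} {a} {b} s = T-∧ˡ s , out a (T-∧ˡ (T-∧ʳ {adj tree a b} s))
                            , out b (T-∧ʳ {lookup (nodesContaining v) a} (T-∧ʳ {adj tree a b} s))
      where
      out : ∀ c → T (lookup (nodesContaining v) c) → InBag v c
      out c t = trans (sym (Vec.lookup∘tabulate (λ b → lookup (bag b) v) c)) (T⇒≡ t)

    Untouched : List Bool → Fin #nodes → Set
    Untouched C a = ∀ {v} → C ∋ v → ¬ InBag v a

    Touched : List Bool → Fin #nodes → Set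
    Touched C a = ∃[ v ] (C ∋ v × InBag v a)

    touched? : ∀ C a → Touched C a ⊎ Untouched C a
    touched? C a with Fin.any? (λ v → (mem C v ∧ lookup (bag a) v) Bool.≟ true)
    ... | yes (v , e) = inj₁ (v , T⇒≡ (T-∧ˡ (≡⇒T e)) , T⇒≡ (T-∧ʳ {mem C v} (≡⇒T e)))
    ... | no ¬e = inj₂ λ {v} p q → ¬e (v , T⇒≡ (T-∧-intro (≡⇒T p) (≡⇒T q)))

    data Outside (C : List Bool) : Fin #nodes → Fin #nodes → Set where
      stay : ∀ {a} → Untouched C a → Outside C a a
      move : ∀ {a b c} → Untouched C a → Adj tree a b → Outside C b c → Outside C a c

    outside-end : ∀ {C a b} → Outside C a b → Untouched C b
    outside-end (stay u)     = u
    outside-end (move _ _ o) = outside-end o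

    outside-start : ∀ {C a b} → Outside C a b → Untouched C a
    outside-start (stay u)     = u
    outside-start (move u _ _) = u

    first-hit : ∀ C {a t} → Walk tree a t → Untouched C a → Touched C t →
                ∃[ p ] ∃[ q ] (Outside C a p × Adj tree p q × Touched C q)
    first-hit C ε u (v , p , q) = ⊥-elim (u p q)
    first-hit C {a} (_◅_ {j = b} s w) u t with touched? C b
    ... | inj₁ tb = a , b , stay u , s , tb
    ... | inj₂ ub with first-hit C w ub t
    ... | p , q , o , r = p , q , move u s o , r

    -- The bag of the first node, on the way from b, that meets a component left
    -- by the bag of b contains all neighbours of this component: otherwise the
    -- edge on which this node is entered could be bypassed.
    module Gate (b : Fin #nodes) (B : List ℕ) (B-b : HasBag B b) (x : Fin n) (x∉ : isIn (toℕ x) B ≡ false) where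

      W C : List Bool
      W = bagSet B
      C = component W (toℕ x)

      free⇒ : ∀ {v} → mem W v ≡ false → ¬ InBag v b
      free⇒ {v} e i = true≢false (trans (mem-bagSet B v) (proj₂ B-b i)) e

      x-free : mem W x ≡ false
      x-free = trans (mem-bagSet B x) x∉

      b-untouched : Untouched C b
      b-untouched v∈ = free⇒ (proj₁ (component-sound W x v∈))

      x∈C : C ∋ x
      x∈C = component-complete W ε x-free

      outer : ∀ {v u} → C ∋ v → Adj M v u → C ∋ u ⊎ InBag u b
      outer {v} {u} v∈ a with bool? (mem W u)
      ... | inj₁ e = inj₂ (proj₁ B-b (trans (sym (mem-bagSet B u)) e))
      ... | inj₂ e = inj₁ (component-complete W
        (minus-intro W (step-sym {G = M} a) e (proj₁ (component-sound W x v∈)) ◅ proj₂ (component-sound W x v∈)) x-free)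

      hit : ∃[ p ] ∃[ q ] (Outside C b p × Adj tree p q × Touched C q)
      hit = first-hit C (IsTree.connected tree-ok Subset.∈⊤ Subset.∈⊤) b-untouched
                      (x , x∈C , proj₂ (node-of x))

      p q : Fin #nodes
      p = proj₁ hit
      q = proj₁ (proj₂ hit)
      way : Outside C b p
      way = proj₁ (proj₂ (proj₂ hit))
      pq : Adj tree p q
      pq = proj₁ (proj₂ (proj₂ (proj₂ hit)))
      q-touched : Touched C q
      q-touched = proj₂ (proj₂ (proj₂ (proj₂ hit)))

      open Bridge tree (IsTree.acyclic tree-ok) pq

      touched≢p : ∀ {a} → Touched C a → a ≢ p
      touched≢p (v , v∈ , i) refl = outside-end way v∈ i

      untouched≢q : ∀ {a} → Untouched C a → a ≢ q
      untouched≢q u refl = let v , v∈ , i = q-touched in u v∈ i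

      back : ∀ {a} → Outside C a p → Walk cut p a
      back (stay u)                 = ε
      back (move u s o) = back o ◅◅
        (cut-avoid-q (step-sym {G = tree} s) (untouched≢q (outside-start o)) (untouched≢q u) ◅ ε)

      inside : ∀ {v a c} → C ∋ v → InBag v a → InBag v c → Walk cut a c
      inside {v} v∈ i j = mapWalk {G = induced tree (nodesContaining v)} {G′ = cut} step (hold i j)
        where
        step : ∀ {a c} → Adj (induced tree (nodesContaining v)) a c → Adj cut a c
        step s with hold-step {v} s
        ... | t , ia , ic = cut-avoid-p t (touched≢p (v , v∈ , ia)) (touched≢p (v , v∈ , ic))

      across : ∀ {v a c} → Walk (minus W) v x → InBag v a → InBag x c → Walk cut a c
      across ε i j = inside x∈C i j
      across (s ◅ w) i j with minus-elim W s
      ... | a , _ , _ with cover a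
      ... | f , iv , iu = inside (component-complete W (s ◅ w) x-free) i iv ◅◅ across w iu j

      gate : ∀ {v u} → C ∋ v → Adj M v u → C ∋ u ⊎ InBag u q
      gate {v} {u} v∈ a with outer v∈ a | bool? (lookup (bag q) u)
      ... | inj₁ u∈ | _      = inj₁ u∈
      ... | inj₂ ub | inj₁ i = inj₂ i
      ... | inj₂ ub | inj₂ ¬i with cover a | q-touched | node-of x
      ... | f , iv , iu | c , c∈ , ic | g , ix = ⊥-elim (no-detour p≢q
        (back way ◅◅ mapWalk {G = induced tree (nodesContaining u)} {G′ = cut} step (hold ub iu) ◅◅ across (proj₂ (component-sound W x v∈)) iv ix
          ◅◅ reverse {G = cut} (across (proj₂ (component-sound W x c∈)) ic ix)))
        where
        p≢q : p ≢ q
        p≢q e = touched≢p q-touched (sym e)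
        step : ∀ {a c} → Adj (induced tree (nodesContaining u)) a c → Adj cut a c
        step s with hold-step {u} s
        ... | t , ia , ic = cut-avoid-q t (λ { refl → true≢false ia ¬i }) (λ { refl → true≢false ic ¬i })

    shrink : ∀ {C B q} → HasBag B q → Touched C q → (∀ {v u} → C ∋ v → Adj M v u → C ∋ u ⊎ InBag u q) →
             ∀ {v} → C ∋ v → isIn (toℕ v) B ≡ false →
             size (component (bagSet B) (toℕ v)) ℕ.< size C
    shrink {C} {B} Bq (c , c∈ , ic) closed {v} v∈ v∉ =
      size-< (λ k → go (proj₂ (component-sound W v k))) c∈
             (λ k → true≢false (trans (mem-bagSet B c) (proj₂ Bq ic)) (proj₁ (component-sound W v k)))
      where
      W : List Bool
      W = bagSet B
      go : ∀ {u} → Walk (minus W) u v → C ∋ u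
      go ε = v∈
      go {u} (s ◅ w) with minus-elim W s
      ... | a , fu , _ with closed (go w) (step-sym {G = M} a)
      ... | inj₁ e = e
      ... | inj₂ i = ⊥-elim (true≢false (trans (mem-bagSet B u) (proj₂ Bq i)) fu)

    predecessor : ∀ {k l m} → k ℕ.< l → l ℕ.≤ m → ∃[ m′ ] (m ≡ suc m′ × k ℕ.≤ m′)
    predecessor k<l l≤m with ℕ.<-≤-trans k<l l≤m
    ... | s≤s p = _ , refl , p

    decomposable : ∀ j b B → HasBag B b → ∀ x → isIn (toℕ x) B ≡ false →
                   size (component (bagSet B) (toℕ x)) ℕ.≤ j →
                   Decomposable (suc ω) (suc j) (component (bagSet B) (toℕ x))
    decomposable j b B B-b x x∉ le with Gate.q-touched b B B-b x x∉ | bagList (Gate.q b B B-b x x∉) (proj₂ (proj₂ (Gate.q-touched b B B-b x x∉)))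
    ... | tq | B′ , len , ok , Bq = node B′ len ok closed sub
      where
      open Gate b B B-b x x∉ using (C; q; gate)
      closed : ∀ {v u} → C ∋ v → Adj M v u → C ∋ u ⊎ isIn (toℕ u) B′ ≡ true
      closed v∈ a with gate v∈ a
      ... | inj₁ e = inj₁ e
      ... | inj₂ i = inj₂ (proj₂ Bq i)
      sub : ∀ {v} → C ∋ v → isIn (toℕ v) B′ ≡ false → Decomposable (suc ω) j (component (bagSet B′) (toℕ v))
      sub {v} v∈ v∉ with predecessor (shrink {C} Bq tq gate v∈ v∉) le
      ... | j′ , refl , le′ = decomposable j′ q B′ Bq v v∉ le′

    everything-decomposable : Fin n → Decomposable (suc ω) (suc n) everything
    everything-decomposable r with node-of r
    ... | b , i with bagList b i
    ... | B , len , ok , Bb = node B len ok (λ {_} {u} _ _ → inj₁ (everything-∋ u)) sub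
      where
      sub : ∀ {v} → everything ∋ v → isIn (toℕ v) B ≡ false → Decomposable (suc ω) n (component (bagSet B) (toℕ v))
      sub {v} v∈ v∉ with predecessor (shrink {everything} Bb (r , everything-∋ r , i)
                                  (λ {_} {u} _ _ → inj₁ (everything-∋ u)) v∈ v∉)
                               (Subset.∣p∣≤n (asSubset everything))
      ... | n′ , eq , le = subst (λ k → Decomposable (suc ω) k (component (bagSet B) (toℕ v))) (sym eq)
                             (decomposable n′ b B Bb v v∉ le)

-- Trees given by a parent function

module Rooted {n} (W : Fin n → Bool) (e : Fin n → Fin n → Bool) (p : Fin n → Fin n) (h : Fin n → ℕ)
              (r : Fin n) (k : ℕ)
              (e-elim : ∀ {u v} → e u v ≡ true → u ≢ v × (p v ≡ u ⊎ p u ≡ v))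
              (e-intro : ∀ {u v} → u ≢ v → p v ≡ u ⊎ p u ≡ v → e u v ≡ true)
              (r∈W : W r ≡ true) (p-r : p r ≡ r)
              (p-W : ∀ {v} → W v ≡ true → v ≢ r → W (p v) ≡ true × h (p v) ℕ.< h v)
              (p-out : ∀ {v} → W v ≡ false → p v ≡ v)
              (h-≤ : ∀ {v} → W v ≡ true → h v ℕ.≤ k) where

  flip : ∀ {u v} → e u v ≡ true → e v u ≡ true
  flip q with e-elim q
  ... | u≢v , inj₁ a = e-intro (u≢v ∘ sym) (inj₂ a)
  ... | u≢v , inj₂ a = e-intro (u≢v ∘ sym) (inj₁ a)

  G : Graph n
  G = record
    { adj        = e
    ; adj-sym    = λ u v → bool-ext flip flip
    ; adj-irrefl = λ v → ¬true λ q → proj₁ (e-elim q) refl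
    }

  child : ∀ {v} → p v ≢ v → W v ≡ true × W (p v) ≡ true × h (p v) ℕ.< h v
  child {v} ne with bool? (W v)
  ... | inj₂ q = ⊥-elim (ne (p-out q))
  ... | inj₁ q = q , p-W q λ { refl → ne p-r }

  inW : ∀ {v} → W v ≡ true → v Subset.∈ Vec.tabulate W
  inW {v} q = lookup⇒∈ (trans (Vec.lookup∘tabulate W v) q)

  outW : ∀ {v} → v Subset.∈ Vec.tabulate W → W v ≡ true
  outW {v} q = trans (sym (Vec.lookup∘tabulate W v)) (∈⇒lookup q)

  to-root : ∀ v → W v ≡ true → Acc ℕ._<_ (h v) → Walk G v r
  to-root v q (WF.acc rs) with v Fin.≟ r
  ... | yes refl = ε
  ... | no v≢r with p-W q v≢r
  ... | q′ , lt = ≡⇒T (e-intro (λ eq → ℕ.<-irrefl (cong h (sym eq)) lt) (inj₂ refl))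
                  ◅ to-root (p v) q′ (rs lt)

  root-walk : ∀ {v} → W v ≡ true → Walk G v r
  root-walk q = to-root _ q (<-wellFounded _)

  data Step (u v : Fin n) : Set where
    down : p v ≡ u → h u ℕ.< h v → Step u v
    up   : p u ≡ v → h v ℕ.< h u → Step u v

  step : ∀ {u v} → Adj G u v → Step u v
  step s with e-elim (T⇒≡ s)
  ... | u≢v , inj₁ refl = down refl (proj₂ (proj₂ (child u≢v)))
  ... | u≢v , inj₂ refl = up refl (proj₂ (proj₂ (child (u≢v ∘ sym))))

  start-∈ : ∀ {u v} (w : Walk G u v) → u ∈ˡ walkVertices G w
  start-∈ ε       = here refl
  start-∈ (s ◅ w) = here refl

  end-∈ : ∀ {u v} (w : Walk G u v) → v ∈ˡ walkVertices G w
  end-∈ ε       = here refl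
  end-∈ (s ◅ w) = there (end-∈ w)

  descend : ∀ {u x v} (s : Adj G u x) (w : Walk G x v) → IsPath G (s ◅ w) → p x ≡ u → h u ℕ.< h x →
            h u ℕ.+ #edges G (s ◅ w) ℕ.≤ h v × ∃[ z ] (z ∈ˡ walkVertices G (s ◅ w) × p v ≡ z)
  descend {u} s ε pw px lt = ℕ.≤-trans (ℕ.≤-reflexive (ℕ.+-comm (h u) 1)) lt , u , here refl , px
  descend {u} {x} s (s′ ◅ w) (a ∷ pw) px lt with step s′
  ... | up py _ = ⊥-elim (All.lookup a (there (subst (_∈ˡ walkVertices G w) (trans (sym py) px) (start-∈ w))) refl)
  ... | down py lt′ with descend s′ w pw py lt′
  ... | le , z , z∈ , eq =
    ℕ.≤-trans (ℕ.≤-reflexive (ℕ.+-suc (h u) _)) (ℕ.≤-trans (ℕ.+-monoˡ-≤ (suc (#edges G w)) lt) le)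
    , z , there z∈ , eq

  up-or-last-down : ∀ {u v} (w : Walk G u v) → IsPath G w →
                    h v ℕ.≤ h u ⊎ ∃[ z ] (z ∈ˡ walkVertices G w × p v ≡ z)
  up-or-last-down ε pw = inj₁ ℕ.≤-refl
  up-or-last-down (s ◅ w) pw@(_ ∷ pw′) with step s
  ... | down px lt = inj₂ (proj₂ (descend s w pw px lt))
  ... | up px lt with up-or-last-down w pw′
  ... | inj₁ le = inj₁ (ℕ.≤-trans le (ℕ.<⇒≤ lt))
  ... | inj₂ (z , z∈ , eq) = inj₂ (z , there z∈ , eq)

  acyclic : Acyclic G
  acyclic (s ◅ ε) pw (s≤s ()) c
  acyclic {u} {v} (s ◅ s′ ◅ w) (a ∷ a′ ∷ pw) _ c with step s | step c
  ... | up px lt | down pu lt′ = All.lookup a′ (subst (_∈ˡ walkVertices G w) (trans (sym pu) px) (end-∈ w)) refl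
  ... | up px lt | up pv lt′ with up-or-last-down (s′ ◅ w) (a′ ∷ pw)
  ... | inj₁ le = ℕ.<-asym lt′ (ℕ.≤-<-trans le lt)
  ... | inj₂ (z , z∈ , eq) = All.lookup a z∈ (trans (sym pv) eq)
  acyclic {u} {v} (s ◅ s′ ◅ w) (a ∷ a′ ∷ pw) _ c | down px lt | c′ with descend s (s′ ◅ w) (a ∷ a′ ∷ pw) px lt | step s′
  ... | _ | up py _ = All.lookup a (there (subst (_∈ˡ walkVertices G w) (trans (sym py) px) (start-∈ w))) refl
  ... | le , _ | down py lt′ with c′ | descend s′ w (a′ ∷ pw) py lt′
  ... | down pu lt″ | _ = ℕ.<-asym lt″ (ℕ.<-≤-trans (ℕ.m<m+n (h u) (s≤s z≤n)) le)
  ... | up pv _ | _ , z , z∈ , eq = All.lookup a z∈ (trans (sym pv) eq)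

  S : Subtree n
  S = record
    { vertices = Vec.tabulate W
    ; edges    = G
    ; isTree   = record
      { nonempty  = r , inW r∈W
      ; edges⊆W   = λ s → ends (e-elim (T⇒≡ s))
      ; connected = λ u∈ v∈ → root-walk (outW u∈) ◅◅ reverse {G = G} (root-walk (outW v∈))
      ; acyclic   = acyclic
      }
    }
    where
    ends : ∀ {u v} → u ≢ v × (p v ≡ u ⊎ p u ≡ v) → u Subset.∈ Vec.tabulate W × v Subset.∈ Vec.tabulate W
    ends (u≢v , inj₁ refl) = let a , b , _ = child u≢v in inW b , inW a
    ends (u≢v , inj₂ refl) = let a , b , _ = child (u≢v ∘ sym) in inW a , inW b

  hop-bound : ∀ {v} → v Subset.∈ Vec.tabulate W → (w : Walk G r v) → IsPath G w → #edges G w ℕ.≤ k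
  hop-bound v∈ ε pw = z≤n
  hop-bound v∈ (s ◅ w) pw with step s
  ... | down px lt = ℕ.≤-trans (ℕ.m≤n+m _ (h r)) (ℕ.≤-trans (proj₁ (descend s w pw px lt)) (h-≤ (outW v∈)))
  ... | up px lt = ⊥-elim (ℕ.<-irrefl (cong h (trans (sym px) p-r)) lt)

-- Costs as double sums

if-0 : ∀ b → (if b then 0ℚ else 0ℚ) ≡ 0ℚ
if-0 true  = refl
if-0 false = refl

∑-single : ∀ {n} (a : Fin n) (f : Fin n → ℚ) → ∑ (λ v → if does (a Fin.≟ v) then f v else 0ℚ) ≡ f a
∑-single {suc n} zero    f = trans (cong (f zero ℚ.+_) (∑-0 n)) (ℚ.+-identityʳ _)
∑-single {suc n} (suc a) f = trans (ℚ.+-identityˡ _) (trans (∑-cong same) (∑-single a (f ∘ suc)))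
  where
  same : ∀ v → (if does (suc a Fin.≟ suc v) then f (suc v) else 0ℚ) ≡ (if does (a Fin.≟ v) then f (suc v) else 0ℚ)
  same v with a Fin.≟ v
  ... | yes _ = refl
  ... | no  _ = refl

module Costs {n} (d : Fin n → Fin n → ℚ) (d-refl : ∀ v → d v v ≡ 0ℚ) (d-sym : ∀ u v → d u v ≡ d v u)
             (d-pos : ∀ u v → 0ℚ ℚ.≤ d u v) where

  module _ (G : Graph n) where

    chosen : Fin n × Fin n → Bool
    chosen (u , v) = does (u Fin.<? v) ∧ adj G u v

    edgeCost : Fin n × Fin n → ℚ
    edgeCost z = if chosen z then d (proj₁ z) (proj₂ z) else 0ℚ

    listCost : List (Fin n × Fin n) → ℚ
    listCost = foldr (λ z acc → edgeCost z ℚ.+ acc) 0ℚ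

    filter-cost : ∀ zs → foldr ℚ._+_ 0ℚ (map (λ (u , v) → d u v)
                    (filter (λ (u , v) → (u Fin.<? v) ×-dec T? (adj G u v)) zs)) ≡ listCost zs
    filter-cost [] = refl
    filter-cost ((u , v) ∷ zs) with chosen (u , v)
    ... | true  = cong (d u v ℚ.+_) (filter-cost zs)
    ... | false = trans (filter-cost zs) (sym (ℚ.+-identityˡ _))

    listCost-++ : ∀ xs ys → listCost (xs ++ ys) ≡ listCost xs ℚ.+ listCost ys
    listCost-++ []       ys = sym (ℚ.+-identityˡ _)
    listCost-++ (x ∷ xs) ys = trans (cong (edgeCost x ℚ.+_) (listCost-++ xs ys)) (sym (ℚ.+-assoc (edgeCost x) _ _))

    listCost-row : ∀ {m} u (f : Fin m → Fin n) → listCost (map (u ,_) (tabulate f)) ≡ ∑ (λ v → edgeCost (u , f v))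
    listCost-row {zero}  u f = refl
    listCost-row {suc m} u f = cong (edgeCost (u , f zero) ℚ.+_) (listCost-row u (f ∘ suc))

    listCost-product : ∀ {m} (f : Fin m → Fin n) →
                       listCost (cartesianProduct (tabulate f) (allFin n)) ≡ ∑ (λ u → ∑ (λ v → edgeCost (f u , v)))
    listCost-product {zero}  f = refl
    listCost-product {suc m} f =
      trans (listCost-++ (map (f zero ,_) (allFin n)) _)
            (cong₂ ℚ._+_ (listCost-row (f zero) id) (listCost-product (f ∘ suc)))

  cost-∑ : ∀ S → cost d S ≡ ∑ (λ u → ∑ (λ v → edgeCost (edges S) (u , v)))
  cost-∑ S = trans (filter-cost (edges S) (cartesianProduct (allFin n) (allFin n))) (listCost-product (edges S) id)

  module _ (p : Fin n → Fin n) where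

    lt : Fin n → Fin n → ℚ → ℚ
    lt u v x = if does (u Fin.<? v) then x else 0ℚ

    is : Fin n → Fin n → ℚ
    is u v = if does (p u Fin.≟ v) then d u v else 0ℚ

    is-self : ∀ u → is u u ≡ 0ℚ
    is-self u = trans (cong (λ x → if does (p u Fin.≟ u) then x else 0ℚ) (d-refl u)) (if-0 _)

    is-split : ∀ u v → is u v ≡ lt u v (is u v) ℚ.+ lt v u (is u v)
    is-split u v with Fin.<-cmp u v
    ... | tri< a _ c rewrite dec-true (u Fin.<? v) a | dec-false (v Fin.<? u) c = sym (ℚ.+-identityʳ _)
    ... | tri> a _ c rewrite dec-false (u Fin.<? v) a | dec-true (v Fin.<? u) c = sym (ℚ.+-identityˡ _)
    ... | tri≈ _ refl _ = trans (is-self u) (sym (cong₂ ℚ._+_ zeros zeros))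
      where
      zeros : lt u u (is u u) ≡ 0ℚ
      zeros = trans (cong (lt u u) (is-self u)) (if-0 _)

    both : Fin n → Fin n → ℚ
    both u v = lt u v (is u v) ℚ.+ lt u v (is v u)

    parent-sum : ∑ (λ u → d u (p u)) ≡ ∑ (λ u → ∑ (both u))
    parent-sum = begin
      ∑ (λ u → d u (p u))                              ≡⟨ ∑-cong (λ u → sym (∑-single (p u) (d u))) ⟩
      ∑ (λ u → ∑ (is u))                               ≡⟨ ∑-cong (λ u → trans (∑-cong (is-split u)) (∑-+ (λ v → lt u v (is u v)) _)) ⟩
      ∑ (λ u → ∑ (λ v → lt u v (is u v)) ℚ.+ ∑ (λ v → lt v u (is u v)))
                                                       ≡⟨ ∑-+ (λ u → ∑ (λ v → lt u v (is u v))) _ ⟩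
      ∑ (λ u → ∑ (λ v → lt u v (is u v))) ℚ.+ ∑ (λ u → ∑ (λ v → lt v u (is u v)))
        ≡⟨ cong (∑ (λ u → ∑ (λ v → lt u v (is u v))) ℚ.+_) (∑-swap (λ u v → lt v u (is u v))) ⟩
      ∑ (λ u → ∑ (λ v → lt u v (is u v))) ℚ.+ ∑ (λ u → ∑ (λ v → lt u v (is v u)))
        ≡⟨ ∑-+ (λ u → ∑ (λ v → lt u v (is u v))) _ ⟨
      ∑ (λ u → ∑ (λ v → lt u v (is u v)) ℚ.+ ∑ (λ v → lt u v (is v u)))
        ≡⟨ ∑-cong (λ u → sym (∑-+ (λ v → lt u v (is u v)) _)) ⟩
      ∑ (λ u → ∑ (both u)) ∎
      where open Relation.Binary.PropositionalEquality.≡-Reasoning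

    is-pos : ∀ u v → 0ℚ ℚ.≤ is u v
    is-pos u v with does (p u Fin.≟ v)
    ... | true  = d-pos u v
    ... | false = ℚ.≤-refl

    is-true : ∀ {u v} → p u ≡ v → is u v ≡ d u v
    is-true {u} {v} q = if-true (dec-true (p u Fin.≟ v) q)

    cost-≤ : ∀ S → (∀ {u v} → Adj (edges S) u v → p v ≡ u ⊎ p u ≡ v) → cost d S ℚ.≤ ∑ (λ u → d u (p u))
    cost-≤ S par = ℚ.≤-trans (ℚ.≤-reflexive (cost-∑ S))
      (ℚ.≤-trans (∑-mono λ u → ∑-mono λ v → pointwise u v) (ℚ.≤-reflexive (sym parent-sum)))
      where
      pointwise : ∀ u v → edgeCost (edges S) (u , v) ℚ.≤ both u v
      pointwise u v with does (u Fin.<? v)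
      ... | false = ℚ.≤-refl
      ... | true with bool? (adj (edges S) u v)
      ... | inj₂ q rewrite q = ℚ.+-mono-≤ (is-pos u v) (is-pos v u)
      ... | inj₁ q rewrite q with par (≡⇒T q)
      ... | inj₂ a = ℚ.≤-trans (ℚ.≤-reflexive (trans (sym (is-true a)) (sym (ℚ.+-identityʳ _))))
                       (ℚ.+-monoʳ-≤ (is u v) (is-pos v u))
      ... | inj₁ a = ℚ.≤-trans (ℚ.≤-reflexive (trans (trans (d-sym u v) (sym (is-true a))) (sym (ℚ.+-identityˡ _))))
                       (ℚ.+-monoˡ-≤ (is v u) (is-pos u v))

    cost-≥ : ∀ S → (∀ {u v} → u ≢ v → p u ≡ v → Adj (edges S) u v × p v ≢ u) →
             ∑ (λ u → d u (p u)) ℚ.≤ cost d S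
    cost-≥ S par = ℚ.≤-trans (ℚ.≤-reflexive parent-sum)
      (ℚ.≤-trans (∑-mono λ u → ∑-mono λ v → pointwise u v) (ℚ.≤-reflexive (sym (cost-∑ S))))
      where
      edge-pos : ∀ u v → 0ℚ ℚ.≤ (if adj (edges S) u v then d u v else 0ℚ)
      edge-pos u v with adj (edges S) u v
      ... | true  = d-pos u v
      ... | false = ℚ.≤-refl
      pointwise : ∀ u v → both u v ℚ.≤ edgeCost (edges S) (u , v)
      pointwise u v with does (u Fin.<? v) in lt-uv
      ... | false = ℚ.≤-refl
      ... | true with p u Fin.≟ v | p v Fin.≟ u
      ... | no  _ | no _ = edge-pos u v
      ... | yes a | yes b = ⊥-elim (proj₂ (par (λ eq → Fin.<-irrefl eq (ℕ.<ᵇ⇒< (toℕ u) (toℕ v) (≡⇒T lt-uv))) a) b)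
      ... | yes a | no _ = ℚ.≤-reflexive (trans (ℚ.+-identityʳ _)
              (sym (if-true (T⇒≡ (proj₁ (par (λ eq → Fin.<-irrefl eq (ℕ.<ᵇ⇒< (toℕ u) (toℕ v) (≡⇒T lt-uv))) a))))))
      ... | no _ | yes b = ℚ.≤-reflexive (trans (ℚ.+-identityˡ _) (trans (d-sym v u)
              (sym (if-true (T⇒≡ (step-sym {G = edges S} (proj₁ (par (λ eq → Fin.<-irrefl (sym eq) (ℕ.<ᵇ⇒< (toℕ u) (toℕ v) (≡⇒T lt-uv))) b))))))))

-- Parents read off a row

depth : ℕ → Row → ℕ
depth v []      = 0
depth v (x ∷ l) = if isIn v l then depth v l else List.length l

depth-≤ : ∀ v l → depth v l ℕ.≤ List.length l
depth-≤ v []      = z≤n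
depth-≤ v (x ∷ l) with isIn v l
... | true  = ℕ.m≤n⇒m≤1+n (depth-≤ v l)
... | false = ℕ.n≤1+n _

opaque
  unfolding isIn anyB

  isIn-[] : ∀ {v} → isIn v [] ≡ false
  isIn-[] = refl

  isIn-there : ∀ {v x l} → isIn v l ≡ true → isIn v (x ∷ l) ≡ true
  isIn-there {v} {x} e = or-introʳ {isEq x v} e

  isIn-here : ∀ {v l} → isIn v (v ∷ l) ≡ true
  isIn-here {v} = or-introˡ (isEq-intro {v} refl)

  isIn-cases : ∀ {v x l} → isIn v (x ∷ l) ≡ true → x ≡ v ⊎ isIn v l ≡ true
  isIn-cases {v} {x} e with or-elim {isEq x v} e
  ... | inj₁ p = inj₁ (isEq-true p)
  ... | inj₂ p = inj₂ p

  isIn-none : ∀ {v x l} → x ≢ v → isIn v l ≡ false → isIn v (x ∷ l) ≡ false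
  isIn-none {v} {x} ne e = trans (if-false (isEq-≢ ne)) e

isIn-none-tail : ∀ {v x l} → isIn v (x ∷ l) ≡ false → isIn v l ≡ false
isIn-none-tail e = ¬true λ p → true≢false (isIn-there p) e

isIn-none-head : ∀ {v x l} → isIn v (x ∷ l) ≡ false → x ≢ v
isIn-none-head e refl = true≢false isIn-here e

scan-step : ∀ {v x l} → proj₁ (scan v l) ≡ nothing →
            scan v (x ∷ l) ≡ (if isEq x v then (just (proj₂ (scan v l)) , x) else (nothing , x))
scan-step e = caseM-nothing e

scan-none : ∀ v l → isIn v l ≡ false → scan v l ≡ (nothing , firstOr v l)
scan-none v []      e = refl
scan-none v (x ∷ l) e =
  trans (scan-step {v} {x} {l} (cong proj₁ (scan-none v l (isIn-none-tail {x = x} e))))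
        (if-false (isEq-≢ (isIn-none-head {l = l} e)))

scan-some : ∀ v l → isIn v l ≡ true → ∃[ p ] proj₁ (scan v l) ≡ just p
scan-some v []      e = ⊥-elim (true≢false e isIn-[])
scan-some v (x ∷ l) e with bool? (isIn v l)
... | inj₁ p = let q , eq = scan-some v l p in q , trans (cong proj₁ (caseM-just eq)) eq
... | inj₂ p with isIn-cases {l = l} e
... | inj₂ q = ⊥-elim (true≢false q p)
... | inj₁ refl = _ , trans (cong proj₁ (scan-step {v} {x} {l} (cong proj₁ (scan-none v l p))))
                            (cong proj₁ (if-true (isEq-intro {v} refl)))

opaque
  unfolding par

  par-out : ∀ v l → isIn v l ≡ false → par v l ≡ v
  par-out v l e = cong (caseM v id ∘ proj₁) (scan-none v l e)

  par-tail : ∀ v {x} l → isIn v l ≡ true → par v (x ∷ l) ≡ par v l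
  par-tail v {x} l e = cong (caseM v id ∘ proj₁) (caseM-just (proj₂ (scan-some v l e)))

  par-here : ∀ v l → isIn v l ≡ false → par v (v ∷ l) ≡ firstOr v l
  par-here v l e = trans
    (cong (caseM v id ∘ proj₁) (trans (scan-step {v} {v} {l} (cong proj₁ (scan-none v l e)))
                                      (if-true (isEq-intro {v} refl))))
    (cong proj₂ (scan-none v l e))

at-isIn : ∀ l {i} → i ℕ.< List.length l → isIn (at 0 l i) l ≡ true
at-isIn (x ∷ l) {zero}  lt = subst (λ y → isIn y (x ∷ l) ≡ true) (sym at-zero) isIn-here
at-isIn (x ∷ l) {suc i} (s≤s lt) =
  subst (λ y → isIn y (x ∷ l) ≡ true) (sym (at-suc i)) (isIn-there (at-isIn l lt))

depth-at : ∀ v l {i} → i ℕ.< List.length l → at 0 l i ≡ v → suc i ℕ.+ depth v l ℕ.≤ List.length l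
depth-at v (x ∷ l) {zero} lt e with isIn v l
... | true  = s≤s (depth-≤ v l)
... | false = ℕ.≤-refl
depth-at v (x ∷ l) {suc i} (s≤s lt) e with trans (sym (at-suc i)) e
... | e′ rewrite subst (λ y → isIn y l ≡ true) e′ (at-isIn l lt) = s≤s (depth-at v l lt e′)

par-at : ∀ v l → isIn v l ≡ true →
         ∃[ i ] (at 0 l i ≡ v × suc i ℕ.+ depth v l ≡ List.length l ×
                 (par v l ≡ v × suc i ≡ List.length l ⊎ suc i ℕ.< List.length l × par v l ≡ at 0 l (suc i)))
par-at v []      e = ⊥-elim (true≢false e isIn-[])
par-at v (x ∷ l) e with bool? (isIn v l)
... | inj₁ p with par-at v l p
... | i , a , b , c = suc i , trans (at-suc i) a
                    , cong suc (trans (cong (suc i ℕ.+_) (if-true p)) b) , further c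
  where
  further : par v l ≡ v × suc i ≡ List.length l ⊎ suc i ℕ.< List.length l × par v l ≡ at 0 l (suc i) → _
  further (inj₁ (q , r)) = inj₁ (trans (par-tail v l p) q , cong suc r)
  further (inj₂ (q , r)) = inj₂ (s≤s q , trans (par-tail v l p) (trans r (sym (at-suc (suc i)))))
par-at v (x ∷ l) e | inj₂ p with isIn-cases {l = l} e
... | inj₂ q = ⊥-elim (true≢false q p)
... | inj₁ refl = 0 , at-zero , cong suc (if-false p) , first l p
  where
  first : ∀ l → isIn v l ≡ false → par v (v ∷ l) ≡ v × 1 ≡ List.length (v ∷ l) ⊎
                                   1 ℕ.< List.length (v ∷ l) × par v (v ∷ l) ≡ at 0 (v ∷ l) 1
  first []       p = inj₁ (par-here v [] p , refl)
  first (y ∷ l′) p = inj₂ (s≤s (s≤s z≤n) , trans (par-here v (y ∷ l′) p) (sym (trans (at-suc 0) at-zero)))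

anyF : ∀ {n} → (Fin n → Bool) → Bool
anyF P = does (Fin.any? (λ u → P u Bool.≟ true))

anyF-intro : ∀ {n} {P : Fin n → Bool} u → P u ≡ true → anyF P ≡ true
anyF-intro u e = dec-true (Fin.any? _) (u , e)

anyF-elim : ∀ {n} {P : Fin n → Bool} → anyF P ≡ true → ∃[ u ] P u ≡ true
anyF-elim {P = P} e with Fin.any? (λ u → P u Bool.≟ true)
... | yes q = q

data IsRow {n} (r : Fin n) : ℕ → Row → Set where
  root  : IsRow r 0 (toℕ r ∷ [])
  above : ∀ {k l} (v : Fin n) → IsRow r k l → IsRow r (suc k) (toℕ v ∷ l)

module _ {n} {r : Fin n} where

  row-length : ∀ {k l} → IsRow r k l → List.length l ≡ suc k
  row-length root        = refl
  row-length (above v p) = cong suc (row-length p)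

  row-at : ∀ {k l} → IsRow r k l → ∀ i → i ℕ.< suc k → ∃[ u ] at 0 l i ≡ toℕ {n} u
  row-at root        zero    lt = r , at-zero
  row-at root        (suc i) (s≤s ())
  row-at (above v p) zero    lt = v , at-zero
  row-at (above v p) (suc i) (s≤s lt) = let u , e = row-at p i lt in u , trans (at-suc i) e

  row-last : ∀ {k l} → IsRow r k l → at 0 l k ≡ toℕ r
  row-last root                = at-zero
  row-last (above {k} v p) = trans (at-suc k) (row-last p)

  ∈-extend : ∀ {A : Set} {xs : List A} ts {z} → z ∈ˡ extend xs ts →
             ∃[ t ] ∃[ x ] (t ∈ˡ ts × x ∈ˡ xs × z ≡ x ∷ t)
  ∈-extend {xs = xs} ts z∈ with ∈-flatten (map (λ t → map (λ x → x ∷ t) xs) ts) z∈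
  ... | zs , zs∈ , z∈′ with ∈-map⁻ (λ t → map (λ x → x ∷ t) xs) zs∈
  ... | t , t∈ , refl with ∈-map⁻ (λ x → x ∷ t) z∈′
  ... | x , x∈ , refl = t , x , t∈ , x∈ , refl

  extend-∈ : ∀ {A : Set} {xs : List A} {ts t x} → t ∈ˡ ts → x ∈ˡ xs → (x ∷ t) ∈ˡ extend xs ts
  extend-∈ {xs = xs} {ts} {t} t∈ x∈ =
    flatten-∈ (∈-map⁺ (λ t → map (λ x → x ∷ t) xs) t∈) (∈-map⁺ (λ x → x ∷ t) x∈)

  allRows-sound : ∀ k {l} → l ∈ˡ allRows (V n) (toℕ r) k → IsRow r k l
  allRows-sound zero    (here refl) = root
  allRows-sound (suc k) l∈ with ∈-extend (allRows (V n) (toℕ r) k) l∈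
  ... | t , x , t∈ , x∈ , refl with V-∈ x∈
  ... | v , refl = above v (allRows-sound k t∈)

  allRows-complete : ∀ {k l} → IsRow r k l → l ∈ˡ allRows (V n) (toℕ r) k
  allRows-complete root        = here refl
  allRows-complete (above v p) = extend-∈ (allRows-complete p) (∈-V v)

+-cancelˡ-≤ : ∀ p {q r} → p ℚ.+ q ℚ.≤ p ℚ.+ r → q ℚ.≤ r
+-cancelˡ-≤ p {q} {r} le with q ℚ.≤? r
... | yes q≤r = q≤r
... | no  q≰r = ⊥-elim (ℚ.<-irrefl refl (ℚ.<-≤-trans (ℚ.+-monoʳ-< p (ℚ.≰⇒> q≰r)) le))

record Metric {n} (d : Fin n → Fin n → ℚ) : Set where
  field
    d-refl   : ∀ v → d v v ≡ 0ℚ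
    d-zero   : ∀ {u v} → d u v ≡ 0ℚ → u ≡ v
    d-sym    : ∀ u v → d u v ≡ d v u
    d-pos    : ∀ u v → 0ℚ ℚ.≤ d u v
    triangle : ∀ u v w → d u w ℚ.≤ d u v ℚ.+ d v w

  d-≤0 : ∀ {u v} → d u v ℚ.≤ 0ℚ → u ≡ v
  d-≤0 le = d-zero (ℚ.≤-antisym le (d-pos _ _))

  +-≤-zero : ∀ p {u v} → p ℚ.+ d u v ℚ.≤ p → u ≡ v
  +-≤-zero p le = d-≤0 (+-cancelˡ-≤ p (ℚ.≤-trans le (ℚ.≤-reflexive (sym (ℚ.+-identityʳ p)))))

module Encoding {n} (d : Fin n → Fin n → ℚ) (metric : Metric d) (D : List (List ℚ))
                (D-d : ∀ u v → entry 0ℚ D (toℕ u) (toℕ v) ≡ d u v)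
                (X : Subset n) (Xs : List Bool) (X-Xs : ∀ v → at false Xs (toℕ v) ≡ lookup X v)
                (r : Fin n) (r∈X : r Subset.∈ X) (k : ℕ) (df : Row) where

  open Metric metric

  A : List (List Bool)
  A = irreducible (V n) D

  direct : Fin n → Fin n → Set
  direct u v = u ≢ v × (∀ w → w ≢ u → w ≢ v → d u v ℚ.< d u w ℚ.+ d w v)

  via : ℕ → ℕ → ℕ → Bool
  via u v w = if isEq w u then true else if isEq w v then true else
    if (entry 0ℚ D u w ℚ.+ entry 0ℚ D w v) ≤ᵇ entry 0ℚ D u v then false else true

  A-entry : ∀ u v → entry false A (toℕ u) (toℕ v) ≡ (if isEq (toℕ u) (toℕ v) then false else allB (via (toℕ u) (toℕ v)) (V n))
  A-entry u v = entry-V (λ u v → if isEq u v then false else allB (via u v) (V n)) u v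

  D-sum : ∀ u w v → entry 0ℚ D (toℕ u) (toℕ w) ℚ.+ entry 0ℚ D (toℕ w) (toℕ v) ≡ d u w ℚ.+ d w v
  D-sum u w v = cong₂ ℚ._+_ (D-d u w) (D-d w v)

  direct-elim : ∀ {u v} → entry false A (toℕ u) (toℕ v) ≡ true → direct u v
  direct-elim {u} {v} e with nand-elim {isEq (toℕ u) (toℕ v)} (trans (sym (A-entry u v)) e)
  ... | p , q = (λ { refl → isEq-false p refl }) , far
    where
    far : ∀ w → w ≢ u → w ≢ v → d u v ℚ.< d u w ℚ.+ d w v
    far w w≢u w≢v with or-elim {isEq (toℕ w) (toℕ u)} (allV-elim {n} q w)
    ... | inj₁ a = ⊥-elim (w≢u (Fin.toℕ-injective (isEq-true a)))
    ... | inj₂ a with or-elim {isEq (toℕ w) (toℕ v)} a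
    ... | inj₁ b = ⊥-elim (w≢v (Fin.toℕ-injective (isEq-true b)))
    ... | inj₂ b with ≤ᵇ-false (proj₁ (nand-elim b))
    ... | c rewrite D-sum u w v | D-d u v = c

  direct-intro : ∀ {u v} → direct u v → entry false A (toℕ u) (toℕ v) ≡ true
  direct-intro {u} {v} (u≢v , far) = trans (A-entry u v)
    (nand-intro (isEq-≢ (u≢v ∘ Fin.toℕ-injective)) (allV-intro {n} {via (toℕ u) (toℕ v)} each))
    where
    each : ∀ w → via (toℕ u) (toℕ v) (toℕ w) ≡ true
    each w with w Fin.≟ u | w Fin.≟ v
    ... | yes refl | _ = or-introˡ (isEq-intro {toℕ w} refl)
    ... | no _ | yes refl = or-introʳ {isEq (toℕ w) (toℕ u)} (or-introˡ (isEq-intro {toℕ w} refl))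
    ... | no w≢u | no w≢v = or-introʳ {isEq (toℕ w) (toℕ u)} (or-introʳ {isEq (toℕ w) (toℕ v)}
      (nand-intro (≤ᵇ-intro-false (ℚ.≤-<-trans (ℚ.≤-reflexive (D-d u v))
         (ℚ.<-≤-trans (far w w≢u w≢v) (ℚ.≤-reflexive (sym (D-sum u w v)))))) refl))

  direct-sym : ∀ {u v} → direct u v → direct v u
  direct-sym {u} {v} (u≢v , far) = u≢v ∘ sym , λ w w≢v w≢u →
    ℚ.≤-<-trans (ℚ.≤-reflexive (d-sym v u)) (ℚ.<-≤-trans (far w w≢u w≢v)
      (ℚ.≤-reflexive (trans (ℚ.+-comm (d u w) _) (cong₂ ℚ._+_ (d-sym w v) (d-sym u w)))))

  M : Graph n
  M = record
    { adj        = λ u v → entry false A (toℕ u) (toℕ v)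
    ; adj-sym    = λ u v → bool-ext (direct-intro ∘ direct-sym ∘ direct-elim {u}) (direct-intro ∘ direct-sym ∘ direct-elim {v})
    ; adj-irrefl = λ v → ¬true λ e → proj₁ (direct-elim {v} {v} e) refl
    }

  open Correct Xs D A (V (suc k)) df M (λ _ _ → refl) public
  open Costs d d-refl d-sym d-pos using (cost-≤; cost-≥)

  towards : ∀ v u → v ≢ u → ∃[ w ] (Adj M v w × d v w ℚ.+ d w u ℚ.≤ d v u)
  towards v u v≢u with nearest P (d v) {u} Pu
    where
    P : Fin n → Bool
    P w = if isEq (toℕ w) (toℕ v) then false else ((d v w ℚ.+ d w u) ≤ᵇ d v u)
    Pu : P u ≡ true
    Pu = nand-intro (isEq-≢ (v≢u ∘ sym ∘ Fin.toℕ-injective))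
           (≤ᵇ-intro (ℚ.≤-reflexive (trans (cong (d v u ℚ.+_) (d-refl u)) (ℚ.+-identityʳ _))))
  ... | w , Pw , min with nand-elim {isEq (toℕ w) (toℕ v)} Pw
  ... | w≢v , le = w , ≡⇒T (direct-intro ((λ { refl → isEq-false w≢v refl }) , far)) , ≤ᵇ-true le
    where
    far : ∀ x → x ≢ v → x ≢ w → d v w ℚ.< d v x ℚ.+ d x w
    far x x≢v x≢w = ℚ.≰⇒> λ short → x≢w (+-≤-zero (d v x)
      (ℚ.≤-trans short (proj₁ (min x (nand-intro (isEq-≢ (x≢v ∘ Fin.toℕ-injective)) (≤ᵇ-intro (begin
        d v x ℚ.+ d x u                ≤⟨ ℚ.+-monoʳ-≤ (d v x) (triangle x w u) ⟩
        d v x ℚ.+ (d x w ℚ.+ d w u)    ≡⟨ ℚ.+-assoc (d v x) _ _ ⟨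
        (d v x ℚ.+ d x w) ℚ.+ d w u    ≤⟨ ℚ.+-monoˡ-≤ (d w u) short ⟩
        d v w ℚ.+ d w u                ≤⟨ ≤ᵇ-true le ⟩
        d v u                          ∎)))))))
      where open ℚ.≤-Reasoning

  opaque
    unfolding price unary agree

    price-≡ : ∀ v l → price v l ≡ dist v (par v l)
    price-≡ v l = refl

    unary-elim : ∀ {v l} → unary (toℕ v) l ≡ true → lookup X v ≡ true → isIn (toℕ v) l ≡ true
    unary-elim {v} e x = imp-elim e (trans (X-Xs v) x)

    unary-intro : ∀ {v l} → (lookup X v ≡ true → isIn (toℕ v) l ≡ true) → unary (toℕ v) l ≡ true
    unary-intro {v} f = imp-intro λ e → f (trans (sym (X-Xs v)) e)

    agree-elim : ∀ {v l u l′} → agree v l u l′ ≡ true → ∀ i → i ℕ.< suc k →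
                 at 0 l i ≡ at 0 l′ i ⊎ between v u (at 0 l i) ≡ false
    agree-elim {v} {l} {u} {l′} e i lt
      with subst (λ j → (if isEq (at 0 l j) (at 0 l′ j) then true else
                         if between v u (at 0 l j) then false else
                         if between u v (at 0 l′ j) then false else true) ≡ true)
                 (Fin.toℕ-fromℕ< lt) (allV-elim {suc k} e (fromℕ< lt))
    ... | p with or-elim {isEq (at 0 l i) (at 0 l′ i)} p
    ... | inj₁ q = inj₁ (isEq-true q)
    ... | inj₂ q = inj₂ (proj₁ (nand-elim {between v u (at 0 l i)} q))

    agree-intro : ∀ {v l u l′} → (∀ i → i ℕ.< suc k → at 0 l i ≡ at 0 l′ i ⊎
                  between v u (at 0 l i) ≡ false × between u v (at 0 l′ i) ≡ false) → agree v l u l′ ≡ true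
    agree-intro {v} {l} {u} {l′} f = allV-intro {suc k} λ j → each (toℕ j) (Fin.toℕ<n j)
      where
      each : ∀ i → i ℕ.< suc k → (if isEq (at 0 l i) (at 0 l′ i) then true else
                         if between v u (at 0 l i) then false else
                         if between u v (at 0 l′ i) then false else true) ≡ true
      each i lt with f i lt
      ... | inj₁ p = or-introˡ (isEq-intro p)
      ... | inj₂ (p , q) = or-introʳ {isEq (at 0 l i) (at 0 l′ i)} (nand-intro p (nand-intro q refl))

  between-≤ : ∀ v u a → between (toℕ v) (toℕ u) (toℕ a) ≡ ((d v u ℚ.+ d u a) ≤ᵇ d v a)
  between-≤ v u a = cong₂ _≤ᵇ_ (D-sum v u a) (D-d v a)

  -- From labellings to trees

  edgeB : (ℕ → Row) → ℕ → ℕ → Bool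
  edgeB ℓ u v = if isEq u v then false else if isEq (par v (ℓ v)) u then true else isEq (par u (ℓ u)) v

  module ToTree (ℓ : ℕ → Row) (rows : ∀ v → IsRow r k (ℓ (toℕ {n} v))) (feas : Feasible everything [] ℓ) where

    all-∋ : ∀ v → everything ∋ v
    all-∋ v = at-V (λ _ → true) v

    -- Among the vertices with entry u at position i take the one nearest to u: if
    -- it were not u, its neighbour towards u would have entry u as well.
    entries : ∀ i → i ℕ.< suc k → ∀ v u → at 0 (ℓ (toℕ v)) i ≡ toℕ u → at 0 (ℓ (toℕ u)) i ≡ toℕ u
    entries i lt v u e with nearest (λ x → isEq (at 0 (ℓ (toℕ x)) i) (toℕ u)) (λ x → d x u) {v} (isEq-intro e)
    ... | m , Pm , min with m Fin.≟ u
    ... | yes refl = isEq-true Pm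
    ... | no m≢u with towards m u m≢u
    ... | w , a , le = ⊥-elim (absurd (agree-elim (feas .edges (all-∋ m) a) i lt))
      where
      m-entry : at 0 (ℓ (toℕ m)) i ≡ toℕ u
      m-entry = isEq-true Pm
      m≢w : m ≢ w
      m≢w = proj₁ (direct-elim (T⇒≡ a))
      absurd : at 0 (ℓ (toℕ m)) i ≡ at 0 (ℓ (toℕ w)) i ⊎ between (toℕ m) (toℕ w) (at 0 (ℓ (toℕ m)) i) ≡ false → ⊥
      absurd (inj₁ p) = m≢w (d-≤0 (+-cancelˡ-≤ (d w u) (ℚ.≤-trans (ℚ.≤-reflexive (ℚ.+-comm (d w u) _))
        (ℚ.≤-trans le (ℚ.≤-trans (proj₁ (min w (isEq-intro (trans (sym p) m-entry))))
           (ℚ.≤-reflexive (sym (ℚ.+-identityʳ _))))))))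
      absurd (inj₂ p) = true≢false (≤ᵇ-intro le)
        (trans (sym (between-≤ m w u)) (trans (cong (between (toℕ m) (toℕ w)) (sym m-entry)) p))

    W : Fin n → Bool
    W v = isIn (toℕ v) (ℓ (toℕ v))

    h : Fin n → ℕ
    h v = depth (toℕ v) (ℓ (toℕ v))

    len : ∀ v → List.length (ℓ (toℕ v)) ≡ suc k
    len v = row-length (rows v)

    in-row : ∀ v i → i ℕ.< suc k → at 0 (ℓ (toℕ v)) i ≡ toℕ v → W v ≡ true
    in-row v i lt e = subst (λ y → isIn y (ℓ (toℕ v)) ≡ true) e
      (at-isIn (ℓ (toℕ v)) (subst (i ℕ.<_) (sym (len v)) lt))

    data Place (v : Fin n) : Set where
      at-root : v ≡ r → par (toℕ v) (ℓ (toℕ v)) ≡ toℕ v → Place v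
      linked  : v ≢ r → ∀ u → par (toℕ v) (ℓ (toℕ v)) ≡ toℕ u → W u ≡ true → h u ℕ.< h v → Place v

    place : ∀ v → W v ≡ true → Place v × h v ℕ.≤ k
    place v e with par-at (toℕ v) (ℓ (toℕ v)) e
    ... | i , a , b , c = go c , ℕ.≤-pred (ℕ.≤-trans (s≤s (ℕ.m≤n+m (h v) i)) (ℕ.≤-reflexive b′))
      where
      b′ : suc i ℕ.+ h v ≡ suc k
      b′ = trans b (len v)
      go : par (toℕ v) (ℓ (toℕ v)) ≡ toℕ v × suc i ≡ List.length (ℓ (toℕ v)) ⊎
           suc i ℕ.< List.length (ℓ (toℕ v)) × par (toℕ v) (ℓ (toℕ v)) ≡ at 0 (ℓ (toℕ v)) (suc i) → Place v
      go (inj₁ (p , q)) = at-root (Fin.toℕ-injective (trans (sym a)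
        (trans (cong (at 0 (ℓ (toℕ v))) (ℕ.suc-injective (trans q (len v)))) (row-last (rows v))))) p
      go (inj₂ (q , p)) with row-at (rows v) (suc i) (subst (suc i ℕ.<_) (len v) q)
      ... | u , eu = linked v≢r u (trans p eu) (in-row u (suc i) lt there′)
        (ℕ.+-cancelˡ-< (suc i) _ _ (decreasing (depth-at (toℕ u) (ℓ (toℕ u)) (subst (suc i ℕ.<_) (sym (len u)) lt) there′)))
        where
        lt : suc i ℕ.< suc k
        lt = subst (suc i ℕ.<_) (len v) q
        there′ : at 0 (ℓ (toℕ u)) (suc i) ≡ toℕ u
        there′ = entries (suc i) lt v u eu
        decreasing : suc (suc i) ℕ.+ h u ℕ.≤ List.length (ℓ (toℕ u)) → suc i ℕ.+ h u ℕ.< suc i ℕ.+ h v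
        decreasing le = ℕ.≤-trans le (ℕ.≤-reflexive (trans (len u) (sym b′)))
        v≢r : v ≢ r
        v≢r refl = ℕ.<-irrefl refl (ℕ.<-≤-trans lt (ℕ.≤-trans
          (ℕ.m≤m+n (suc k) (h v)) (ℕ.≤-trans (depth-at (toℕ v) (ℓ (toℕ v))
            (subst (k ℕ.<_) (sym (len v)) ℕ.≤-refl) (row-last (rows v))) (ℕ.≤-trans (ℕ.≤-reflexive (trans (len v) (sym b′))) (ℕ.≤-trans (ℕ.+-monoʳ-≤ (suc i) h≤0) (ℕ.≤-reflexive (ℕ.+-identityʳ (suc i))))))))
          where
          h≤0 : h v ℕ.≤ 0
          h≤0 = ℕ.+-cancelˡ-≤ (suc k) _ _ (ℕ.≤-trans (depth-at (toℕ v) (ℓ (toℕ v))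
            (subst (k ℕ.<_) (sym (len v)) ℕ.≤-refl) (row-last (rows v))) (ℕ.≤-reflexive (trans (len v) (sym (ℕ.+-identityʳ (suc k))))))

    parent : ∀ v → ∃[ u ] par (toℕ v) (ℓ (toℕ v)) ≡ toℕ u
    parent v with bool? (W v)
    ... | inj₂ e = v , par-out (toℕ v) (ℓ (toℕ v)) e
    ... | inj₁ e with proj₁ (place v e)
    ... | at-root _ p       = v , p
    ... | linked _ u p _ _ = u , p

    p : Fin n → Fin n
    p v = proj₁ (parent v)

    par-p : ∀ v → par (toℕ v) (ℓ (toℕ v)) ≡ toℕ (p v)
    par-p v = proj₂ (parent v)

    p-≡ : ∀ {v u} → par (toℕ v) (ℓ (toℕ v)) ≡ toℕ u → p v ≡ u
    p-≡ {v} e = Fin.toℕ-injective (trans (sym (par-p v)) e)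

    r∈W : W r ≡ true
    r∈W = in-row r k ℕ.≤-refl (row-last (rows r))

    p-r : p r ≡ r
    p-r with proj₁ (place r r∈W)
    ... | at-root _ e         = p-≡ e
    ... | linked r≢r _ _ _ _ = ⊥-elim (r≢r refl)

    p-W : ∀ {v} → W v ≡ true → v ≢ r → W (p v) ≡ true × h (p v) ℕ.< h v
    p-W {v} e v≢r with proj₁ (place v e)
    ... | at-root v≡r _ = ⊥-elim (v≢r v≡r)
    ... | linked _ u q a b rewrite p-≡ {v} {u} q = a , b

    edge-elim : ∀ {u v} → edgeB ℓ (toℕ u) (toℕ v) ≡ true → u ≢ v × (p v ≡ u ⊎ p u ≡ v)
    edge-elim {u} {v} e with nand-elim {isEq (toℕ u) (toℕ v)} e
    ... | a , b = (λ { refl → isEq-false a refl }) , cases (or-elim b)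
      where
      cases : _ ⊎ _ → p v ≡ u ⊎ p u ≡ v
      cases (inj₁ c) = inj₁ (p-≡ (isEq-true c))
      cases (inj₂ c) = inj₂ (p-≡ (isEq-true c))

    edge-intro : ∀ {u v} → u ≢ v → p v ≡ u ⊎ p u ≡ v → edgeB ℓ (toℕ u) (toℕ v) ≡ true
    edge-intro {u} {v} u≢v c = nand-intro (isEq-≢ (u≢v ∘ Fin.toℕ-injective)) (cases c)
      where
      cases : p v ≡ u ⊎ p u ≡ v → (if isEq (par (toℕ v) (ℓ (toℕ v))) (toℕ u) then true else
                                   isEq (par (toℕ u) (ℓ (toℕ u))) (toℕ v)) ≡ true
      cases (inj₁ refl) = or-introˡ (isEq-intro (par-p v))
      cases (inj₂ refl) = or-introʳ {isEq (par (toℕ v) (ℓ (toℕ v))) (toℕ u)} (isEq-intro (par-p u))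

    open Rooted W (λ u v → edgeB ℓ (toℕ u) (toℕ v)) p h r k edge-elim edge-intro r∈W p-r p-W
      (λ {v} e → p-≡ (par-out (toℕ v) (ℓ (toℕ v)) e)) (λ {v} e → proj₂ (place v e)) public

    isHopSteiner : IsHopSteinerTree X r k S
    isHopSteiner = record
      { terminals = λ {v} v∈X → inW (unary-elim (feas .unaries (all-∋ v)) (∈⇒lookup v∈X))
      ; hops      = hop-bound
      }

    cost-S : cost d S ℚ.≤ ∑ (priceOf ℓ)
    cost-S = ℚ.≤-trans (cost-≤ p S (λ s → proj₂ (edge-elim (T⇒≡ s))))
      (ℚ.≤-reflexive (∑-cong λ v → trans (sym (D-d v (p v)))
        (trans (cong (dist (toℕ v)) (sym (par-p v))) (sym (price-≡ (toℕ v) (ℓ (toℕ v)))))))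

  -- From trees to labellings

  module FromTree (S : Subtree n) (steiner : IsHopSteinerTree X r k S) where

    E : Graph n
    E = edges S

    level : ℕ → Fin n → Bool
    level zero    v = isEq (toℕ v) (toℕ r)
    level (suc j) v = if level j v then true else anyF (λ u → level j u ∧ adj E u v)

    level-r : ∀ j → level j r ≡ true
    level-r zero    = isEq-intro {toℕ r} refl
    level-r (suc j) = or-introˡ (level-r j)

    level-mono : ∀ {i j v} → i ℕ.≤ j → level i v ≡ true → level j v ≡ true
    level-mono {v = v} le e = go (ℕ.≤⇒≤′ le)
      where
      go : ∀ {j} → _ ℕ.≤′ j → level j v ≡ true
      go ℕ.≤′-refl       = e
      go (ℕ.≤′-step le′) = or-introˡ (go le′)

    level-walk : ∀ {u v} (w : Walk E u v) i → level i u ≡ true → level (#edges E w ℕ.+ i) v ≡ true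
    level-walk ε i e = e
    level-walk {u} {v} (_◅_ {j = x} s w) i e =
      subst (λ j → level j v ≡ true) (ℕ.+-suc (#edges E w) i)
        (level-walk w (suc i) (or-introʳ {level i x} (anyF-intro u (T⇒≡ (T-∧-intro (≡⇒T e) s)))))

    in-tree : ∀ {v} → v Subset.∈ vertices S → level k v ≡ true
    in-tree v∈ with toPath (IsTree.connected (isTree S) (IsHopSteinerTree.terminals steiner r∈X) v∈)
    ... | w , pw = level-mono (subst (ℕ._≤ k) (sym (ℕ.+-identityʳ _)) (IsHopSteinerTree.hops steiner v∈ w pw))
                     (level-walk w 0 (level-r 0))

    near : ∀ j v → ∃ (Nearest (level j) (d v))
    near j v = nearest (level j) (d v) (level-r j)

    closest : ℕ → Fin n → Fin n
    closest j v = proj₁ (near j v)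

    closest-level : ∀ j v → level j (closest j v) ≡ true
    closest-level j v = proj₁ (proj₂ (near j v))

    closest-≤ : ∀ j v {y} → level j y ≡ true → d v (closest j v) ℚ.≤ d v y
    closest-≤ j v e = proj₁ (proj₂ (proj₂ (near j v)) _ e)

    closest-index : ∀ j v {y} → level j y ≡ true → d v y ℚ.≤ d v (closest j v) → toℕ (closest j v) ℕ.≤ toℕ y
    closest-index j v e = proj₂ (proj₂ (proj₂ (near j v)) _ e)

    closest-0 : ∀ v → closest 0 v ≡ r
    closest-0 v = Fin.toℕ-injective (isEq-true (closest-level 0 v))

    closest-self : ∀ j {v} → level j v ≡ true → closest j v ≡ v
    closest-self j {v} e = sym (d-≤0 (ℚ.≤-trans (closest-≤ j v e) (ℚ.≤-reflexive (d-refl v))))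

    -- Passing through u on the way from v to its nearest point leads to the
    -- nearest point of u, thanks to the common tie-breaking.
    closest-via : ∀ j v u → d v u ℚ.+ d u (closest j v) ℚ.≤ d v (closest j v) → closest j v ≡ closest j u
    closest-via j v u le = Fin.toℕ-injective (ℕ.≤-antisym
      (closest-index j v (closest-level j u) (ℚ.≤-trans (triangle v u (closest j u))
         (ℚ.≤-trans (ℚ.+-monoʳ-≤ (d v u) (closest-≤ j u (closest-level j v))) le)))
      (closest-index j u (closest-level j v) (+-cancelˡ-≤ (d v u)
         (ℚ.≤-trans le (ℚ.≤-trans (closest-≤ j v (closest-level j u)) (triangle v u (closest j u)))))))

    row : ℕ → Fin n → Row
    row zero    v = toℕ r ∷ []
    row (suc j) v = toℕ (closest (suc j) v) ∷ row j v

    row-isRow : ∀ j v → IsRow r j (row j v)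
    row-isRow zero    v = root
    row-isRow (suc j) v = above (closest (suc j) v) (row-isRow j v)

    row-entry : ∀ m i → i ℕ.< suc m → ∃[ j ] (∀ v → at 0 (row m v) i ≡ toℕ (closest j v))
    row-entry zero    zero    lt       = 0 , λ v → trans at-zero (cong toℕ (sym (closest-0 v)))
    row-entry zero    (suc i) (s≤s ())
    row-entry (suc m) zero    lt       = suc m , λ v → at-zero
    row-entry (suc m) (suc i) (s≤s lt) = let j , f = row-entry m i lt in j , λ v → trans (at-suc i) (f v)

    row-first : ∀ j v → firstOr (toℕ v) (row j v) ≡ toℕ (closest j v)
    row-first zero    v = cong toℕ (sym (closest-0 v))
    row-first (suc j) v = refl

    row-in : ∀ j {v} → level j v ≡ true → isIn (toℕ v) (row j v) ≡ true
    row-in zero {v} e = subst (λ x → isIn (toℕ v) (x ∷ []) ≡ true) (isEq-true e) isIn-here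
    row-in (suc j) {v} e =
      subst (λ x → isIn (toℕ v) (toℕ x ∷ row j v) ≡ true) (sym (closest-self (suc j) e)) isIn-here

    row-out : ∀ j {v} → level j v ≡ false → isIn (toℕ v) (row j v) ≡ false
    row-out zero    {v} e = isIn-none (λ eq → isEq-false e (sym eq)) isIn-[]
    row-out (suc j) {v} e = isIn-none
      (λ eq → true≢false (subst (λ x → level (suc j) x ≡ true) (Fin.toℕ-injective eq) (closest-level (suc j) v)) e)
      (row-out j (¬true λ e′ → true≢false (or-introˡ e′) e))

    Link : Fin n → Fin n → Set
    Link v u = u ≡ v ⊎ Adj E v u × ∃[ i ] (level i u ≡ true × level i v ≡ false)

    link : ∀ j v → ∃[ u ] (dist (toℕ v) (par (toℕ v) (row j v)) ℚ.≤ d v u × Link v u)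
    link-absent : ∀ j v → isIn (toℕ v) (row j v) ≡ false → ∃[ u ] (dist (toℕ v) (par (toℕ v) (row j v)) ℚ.≤ d v u × Link v u)
    link-absent j v e = v , ℚ.≤-reflexive (trans (cong (dist (toℕ v)) (par-out (toℕ v) (row j v) e)) (D-d v v)) , inj₁ refl
    link zero v with v Fin.≟ r
    ... | yes refl = v , ℚ.≤-reflexive (trans (cong (dist (toℕ v)) (par-here (toℕ v) [] isIn-[])) (D-d v v)) , inj₁ refl
    ... | no v≢r = link-absent 0 v (row-out 0 (isEq-≢ (v≢r ∘ Fin.toℕ-injective)))
    link (suc j) v with bool? (level j v)
    ... | inj₁ e = let u , le , l = link j v in
      u , subst (λ x → dist (toℕ v) x ℚ.≤ d v u) (sym (par-tail (toℕ v) (row j v) (row-in j e))) le , l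
    ... | inj₂ e with bool? (level (suc j) v)
    ... | inj₂ e′ = link-absent (suc j) v (row-out (suc j) e′)
    ... | inj₁ e′ with or-elim {level j v} e′
    ... | inj₁ e″ = ⊥-elim (true≢false e″ e)
    ... | inj₂ a with anyF-elim a
    ... | u , b = u , ℚ.≤-trans (ℚ.≤-reflexive eq) (closest-≤ j v lu) ,
                  inj₂ (step-sym {G = E} (T-∧ʳ {level j u} (≡⇒T b)) , j , lu , e)
      where
      lu : level j u ≡ true
      lu = T⇒≡ (T-∧ˡ (≡⇒T b))
      eq : dist (toℕ v) (par (toℕ v) (row (suc j) v)) ≡ d v (closest j v)
      eq = trans (cong (dist (toℕ v)) (trans (cong (λ x → par (toℕ v) (toℕ x ∷ row j v)) (closest-self (suc j) e′))
             (trans (par-here (toℕ v) (row j v) (row-out j e)) (row-first j v)))) (D-d v (closest j v))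

    ℓ : ℕ → Row
    ℓ = at df (tabulate (row k))

    ℓ-row : ∀ v → ℓ (toℕ v) ≡ row k v
    ℓ-row v = at-tabulate (row k) v

    ℓ-isRow : ∀ v → IsRow r k (ℓ (toℕ v))
    ℓ-isRow v = subst (IsRow r k) (sym (ℓ-row v)) (row-isRow k v)

    feasible : Feasible everything [] ℓ
    feasible .extends {u} e = ⊥-elim (find-[] e)
      where
      opaque
        unfolding find
        find-[] : ∀ {v l} → find [] v ≡ just l → ⊥
        find-[] ()
    feasible .unaries {v} _ = unary-intro λ x →
      subst (λ l → isIn (toℕ v) l ≡ true) (sym (ℓ-row v))
        (row-in k (in-tree (IsHopSteinerTree.terminals steiner (lookup⇒∈ x))))
    feasible .edges {v} {u} _ a rewrite ℓ-row v | ℓ-row u = agree-intro each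
      where
      each : ∀ i → i ℕ.< suc k → at 0 (row k v) i ≡ at 0 (row k u) i ⊎
             between (toℕ v) (toℕ u) (at 0 (row k v) i) ≡ false × between (toℕ u) (toℕ v) (at 0 (row k u) i) ≡ false
      each i lt with row-entry k i lt
      ... | j , f rewrite f v | f u with closest j v Fin.≟ closest j u
      ... | yes eq = inj₁ (cong toℕ eq)
      ... | no ne = inj₂ (apart v u ne , apart u v (ne ∘ sym))
        where
        apart : ∀ v u → closest j v ≢ closest j u → between (toℕ v) (toℕ u) (toℕ (closest j v)) ≡ false
        apart v u ne = trans (between-≤ v u (closest j v)) (¬true λ e → ne (closest-via j v u (≤ᵇ-true e)))

    cost-ℓ : ∑ (priceOf ℓ) ℚ.≤ cost d S
    cost-ℓ = ℚ.≤-trans (∑-mono λ v → ℚ.≤-trans (ℚ.≤-reflexive (trans (price-≡ (toℕ v) (ℓ (toℕ v)))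
                          (cong (λ l → dist (toℕ v) (par (toℕ v) l)) (ℓ-row v)))) (proj₁ (proj₂ (link k v))))
                       (cost-≥ π S tree-edge)
      where
      π : Fin n → Fin n
      π v = proj₁ (link k v)
      lower : ∀ {v u} → u ≢ v → Link v u → Adj E v u × ∃[ i ] (level i u ≡ true × level i v ≡ false)
      lower ne (inj₁ eq) = ⊥-elim (ne eq)
      lower ne (inj₂ l)  = l
      tree-edge : ∀ {u v} → u ≢ v → π u ≡ v → Adj E u v × π v ≢ u
      tree-edge {u} {v} u≢v refl with lower (u≢v ∘ sym) (proj₂ (proj₂ (link k u)))
      ... | a , i , iu , iv = a , λ eq → clash (lower (u≢v ∘ trans (sym eq)) (proj₂ (proj₂ (link k v)))) eq
        where
        clash : Adj E v (π v) × ∃[ j ] (level j (π v) ≡ true × level j v ≡ false) → π v ≡ u → ⊥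
        clash (_ , j , jv , jv′) eq with ℕ.≤-total i j
        ... | inj₁ le = true≢false (level-mono le iu) jv′
        ... | inj₂ ge = true≢false (level-mono ge (subst (λ x → level j x ≡ true) eq jv)) iv

metric : ∀ {n} {d : Fin n → Fin n → ℚ} → IsMetric _≡_ d → Metric d
metric m = record
  { d-refl   = λ v → IsMetric.≈⇒0 m refl
  ; d-zero   = IsMetric.0⇒≈ m
  ; d-sym    = IsMetric.sym m
  ; d-pos    = λ u v → IsMetric.nonNegative m
  ; triangle = IsMetric.triangle m
  }

-- Shortest paths

minM-cases : ∀ a b {q} → minM a b ≡ just q → a ≡ just q ⊎ b ≡ just q
minM-cases nothing  b        e = inj₂ e
minM-cases (just p) nothing  e = inj₁ e
minM-cases (just p) (just q) e with p ≤ᵇ q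
... | true  = inj₁ e
... | false = inj₂ e

minM-≤ˡ : ∀ {p} b → ∃[ q ] (minM (just p) b ≡ just q × q ℚ.≤ p)
minM-≤ˡ {p} nothing  = p , refl , ℚ.≤-refl
minM-≤ˡ {p} (just q) with bool? (p ≤ᵇ q)
... | inj₁ e = p , if-true e , ℚ.≤-refl
... | inj₂ e = q , if-false e , ℚ.<⇒≤ (≤ᵇ-false e)

minM-≤ʳ : ∀ a {p} → ∃[ q ] (minM a (just p) ≡ just q × q ℚ.≤ p)
minM-≤ʳ nothing  {p} = p , refl , ℚ.≤-refl
minM-≤ʳ (just q) {p} with bool? (q ≤ᵇ p)
... | inj₁ e = q , if-true e , ≤ᵇ-true e
... | inj₂ e = p , if-false e , ℚ.≤-refl

minimum : (ℕ → Maybe ℚ) → List ℕ → Maybe ℚ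
minimum f = foldr (λ w acc → minM (f w) acc) nothing

minimum-∈ : ∀ f xs {q} → minimum f xs ≡ just q → ∃[ w ] (w ∈ˡ xs × f w ≡ just q)
minimum-∈ f (x ∷ xs) e with minM-cases (f x) (minimum f xs) e
... | inj₁ p = x , here refl , p
... | inj₂ p = let w , w∈ , e′ = minimum-∈ f xs p in w , there w∈ , e′

minimum-≤ : ∀ f xs {w p} → w ∈ˡ xs → f w ≡ just p → ∃[ q ] (minimum f xs ≡ just q × q ℚ.≤ p)
minimum-≤ f (x ∷ xs) (here refl) e with minM-≤ˡ (minimum f xs)
... | q , eq , le = q , trans (cong (λ a → minM a (minimum f xs)) e) eq , le
minimum-≤ f (x ∷ xs) (there w∈) e with minimum-≤ f xs w∈ e
... | q , eq , le with minM-≤ʳ (f x) {q}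
... | q′ , eq′ , le′ = q′ , trans (cong (minM (f x)) eq) eq′ , ℚ.≤-trans le′ le

module _ {n} (d : Fin n → Fin n → ℚ) (m : Metric d) where

  open Metric m

  length-single : ∀ (G : WeightedGraph n) {u v} (s : Adj (graph G) u v) →
                  length (graph G) (weight G) (s ◅ ε) ≡ weight G u v
  length-single G s = ℚ.+-identityʳ _

  adj≢ : ∀ (G : Graph n) {u v} → Adj G u v → u ≢ v
  adj≢ G {u} s refl = true≢false (T⇒≡ s) (adj-irrefl G u)

  edge-≥ : ∀ (G : WeightedGraph n) → Induces G d → ∀ {u v} → Adj (graph G) u v → d u v ℚ.≤ weight G u v
  edge-≥ G ind s = ℚ.≤-trans (Induces.shortest ind (s ◅ ε) ((adj≢ (graph G) s ∷ []) ∷ ([] ∷ [])))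
                     (ℚ.≤-reflexive (length-single G s))

  module Distances (G : WeightedGraph n) (ind : Induces G d) (W : List (List (Maybe ℚ)))
                   (W-G : ∀ u v → entry nothing W (toℕ u) (toℕ v) ≡
                                  (if adj (graph G) u v then just (weight G u v) else nothing)) where

    hop′ : ℕ → ℕ → Maybe ℚ
    hop′ = hop (V n) W

    hop-self : ∀ (u : Fin n) → hop′ (toℕ u) (toℕ u) ≡ just 0ℚ
    hop-self u = if-true (isEq-intro {toℕ u} refl)

    hop-edge : ∀ {u v} → Adj (graph G) u v → hop′ (toℕ u) (toℕ v) ≡ just (weight G u v)
    hop-edge {u} {v} s = trans (if-false (isEq-≢ (adj≢ (graph G) s ∘ Fin.toℕ-injective)))
      (trans (W-G u v) (if-true (T⇒≡ s)))

    hop-≥ : ∀ u v {q} → hop′ (toℕ u) (toℕ v) ≡ just q → d u v ℚ.≤ q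
    hop-≥ u v e with u Fin.≟ v
    ... | yes refl with trans (sym (hop-self u)) e
    ... | refl = ℚ.≤-reflexive (d-refl u)
    hop-≥ u v e | no u≢v with trans (sym (W-G u v)) (trans (sym (if-false (isEq-≢ (u≢v ∘ Fin.toℕ-injective)))) e)
    ... | e′ with adj (graph G) u v in a
    hop-≥ u v e | no u≢v | refl | true = edge-≥ G ind (≡⇒T a)
    hop-≥ u v e | no u≢v | ()   | false

    after : List ℕ → List (List (Maybe ℚ))
    after = foldr (λ _ S → relax (V n) W S) (mat (V n) hop′)

    through : List (List (Maybe ℚ)) → ℕ → ℕ → ℕ → Maybe ℚ
    through S u v w = addM (hop′ u w) (entry nothing S w v)

    entry-relax : ∀ S u v → entry nothing (relax (V n) W S) (toℕ u) (toℕ v) ≡ minimum (through S (toℕ u) (toℕ v)) (V n)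
    entry-relax S u v = entry-V (λ u v → minimum (through S u v) (V n)) u v

    addM-elim : ∀ {a b q} → addM a b ≡ just q → ∃[ x ] ∃[ y ] (a ≡ just x × b ≡ just y × q ≡ x ℚ.+ y)
    addM-elim {just x} {just y} refl = x , y , refl , refl , refl

    after-≥ : ∀ xs u v {q} → entry nothing (after xs) (toℕ u) (toℕ v) ≡ just q → d u v ℚ.≤ q
    after-≥ [] u v e = hop-≥ u v (trans (sym (entry-V hop′ u v)) e)
    after-≥ (x ∷ xs) u v e
      with minimum-∈ (through (after xs) (toℕ u) (toℕ v)) (V n) (trans (sym (entry-relax (after xs) u v)) e)
    ... | w , w∈ , f with V-∈ w∈
    ... | w′ , refl with addM-elim {hop′ (toℕ u) (toℕ w′)} f
    ... | a , b , ea , eb , refl = ℚ.≤-trans (triangle u w′ v) (ℚ.+-mono-≤ (hop-≥ u w′ ea) (after-≥ xs w′ v eb))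

    after-≤ : ∀ xs {u v} (p : Walk (graph G) u v) → #edges (graph G) p ℕ.≤ List.length xs →
              ∃[ q ] (entry nothing (after xs) (toℕ u) (toℕ v) ≡ just q × q ℚ.≤ length (graph G) (weight G) p)
    after-≤ [] {u} ε _ = 0ℚ , trans (entry-V hop′ u u) (hop-self u) , ℚ.≤-refl
    after-≤ (x ∷ xs) {u} ε _ with after-≤ xs {u} ε z≤n
    ... | q , e , le with minimum-≤ (through (after xs) (toℕ u) (toℕ u)) (V n) (∈-V u) (cong₂ addM (hop-self u) e)
    ... | q′ , e′ , le′ = q′ , trans (entry-relax (after xs) u u) e′ ,
      ℚ.≤-trans le′ (ℚ.≤-trans (ℚ.≤-reflexive (ℚ.+-identityˡ q)) le)
    after-≤ (x ∷ xs) {u} {v} (_◅_ {j = w} s p) (s≤s l) with after-≤ xs p l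
    ... | q , e , le with minimum-≤ (through (after xs) (toℕ u) (toℕ v)) (V n) (∈-V w) (cong₂ addM (hop-edge s) e)
    ... | q′ , e′ , le′ = q′ , trans (entry-relax (after xs) u v) e′ ,
      ℚ.≤-trans le′ (ℚ.+-monoʳ-≤ (weight G u w) le)

    after-mat : ∀ xs → ∃[ f ] after xs ≡ mat (V n) f
    after-mat []       = hop′ , refl
    after-mat (x ∷ xs) = _ , refl

    map-mat : ∀ {A B : Set} (g : A → B) (f : ℕ → ℕ → A) → map (map g) (mat (V n) f) ≡ mat (V n) (λ u v → g (f u v))
    map-mat g f = trans (sym (map-∘ (V n))) (map-V-cong {n = n} λ u → sym (map-∘ (V n)))

    distances-correct : ∀ u v → entry 0ℚ (distances (V n) W) (toℕ u) (toℕ v) ≡ d u v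
    distances-correct u v with after-mat (V n) | Induces.attained ind u v
    ... | f , eq | p , pp , len with after-≤ (V n) p
        (subst (#edges (graph G) p ℕ.≤_) (sym (length-tabulate {n = n} toℕ)) (ℕ.<⇒≤ (path-short p pp)))
    ... | q , e , le = trans (cong (λ S → entry 0ℚ (map (map (caseM 0ℚ id)) S) (toℕ u) (toℕ v)) eq)
      (trans (cong (λ S → entry 0ℚ S (toℕ u) (toℕ v)) (map-mat (caseM 0ℚ id) f))
      (trans (entry-V (λ u v → caseM 0ℚ id (f u v)) u v)
      (trans (cong (caseM 0ℚ id) (trans (sym (entry-V f u v)) (trans (cong (λ S → entry nothing S (toℕ u) (toℕ v)) (sym eq)) e)))
             (ℚ.≤-antisym (ℚ.≤-trans le (ℚ.≤-reflexive len)) (after-≥ (V n) u v e)))))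

  direct-edge : ∀ (H : WeightedGraph n) → Induces H d → ∀ {u v} → u ≢ v →
                (∀ w → w ≢ u → w ≢ v → d u v ℚ.< d u w ℚ.+ d w v) → Adj (graph H) u v
  direct-edge H ind {u} {v} u≢v far with Induces.attained ind u v
  ... | ε , _ , _ = ⊥-elim (u≢v refl)
  ... | s ◅ ε , _ , _ = s
  ... | _◅_ {j = w} s p@(_ ◅ q) , (a ∷ (b ∷ pq)) , len =
    ⊥-elim (ℚ.<-irrefl refl (ℚ.<-≤-trans (far w (λ eq → All.lookup a (here refl) (sym eq))
        (λ { refl → All.lookup b (last-∈ q) refl }))
      (ℚ.≤-trans (ℚ.+-mono-≤ (edge-≥ H ind s) (Induces.shortest ind p (b ∷ pq))) (ℚ.≤-reflexive len))))
    where
    last-∈ : ∀ {x y} (q : Walk (graph H) x y) → y ∈ˡ walkVertices (graph H) q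
    last-∈ ε       = here refl
    last-∈ (s ◅ q) = there (last-∈ q)

-- The search

bags : ∀ {A : Set} → List A → ℕ → List (List A)
bags xs zero    = [] ∷ []
bags xs (suc i) = extend xs (bags xs i)

bags-sound : ∀ {A : Set} {xs : List A} i {τ} → τ ∈ˡ bags xs i → List.length τ ≡ i × All (_∈ˡ xs) τ
bags-sound zero    (here refl) = refl , []
bags-sound {xs = xs} (suc i) τ∈ with ∈-extend {r = zero {0}} (bags xs i) τ∈
... | t , x , t∈ , x∈ , refl with bags-sound i t∈
... | len , ok = cong suc len , x∈ ∷ ok

bags-complete : ∀ {A : Set} {xs : List A} {i τ} → List.length τ ≡ i → All (_∈ˡ xs) τ → τ ∈ˡ bags xs i
bags-complete {τ = []}    refl []        = here refl
bags-complete {τ = x ∷ τ} refl (x∈ ∷ ok) = extend-∈ {r = zero {0}} (bags-complete refl ok) x∈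

∈-pairs : ∀ {vs rows v l} → (v , l) ∈ˡ allPairs vs rows → v ∈ˡ vs × l ∈ˡ rows
∈-pairs {vs} {rows} p∈ with ∈-flatten (map (λ v → map (λ l → v , l) rows) vs) p∈
... | zs , zs∈ , p∈′ with ∈-map⁻ (λ v → map (λ l → v , l) rows) zs∈
... | v , v∈ , refl with ∈-map⁻ (λ l → v , l) p∈′
... | l , l∈ , refl = v∈ , l∈

pairs-∈ : ∀ {vs rows v l} → v ∈ˡ vs → l ∈ˡ rows → (v , l) ∈ˡ allPairs vs rows
pairs-∈ {rows = rows} {v} v∈ l∈ = flatten-∈ (∈-map⁺ (λ v → map (λ l → v , l) rows) v∈) (∈-map⁺ (λ l → v , l) l∈)

module Search {n} (d : Fin n → Fin n → ℚ) (m : Metric d) (D : List (List ℚ))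
              (D-d : ∀ u v → entry 0ℚ D (toℕ u) (toℕ v) ≡ d u v)
              (X : Subset n) (Xs : List Bool) (X-Xs : ∀ v → at false Xs (toℕ v) ≡ lookup X v)
              (r : Fin n) (r∈X : r Subset.∈ X) (k : ℕ) (1≤k : 1 ℕ.≤ k)
              (H : WeightedGraph n) (ind : Induces H d) {ω : ℕ} (td : TreeDecomposition (graph H) ω) where

  open Metric m

  rows : List Row
  rows = allRows (V n) (toℕ r) k

  star : ℕ → ℕ → Row
  star zero    v = toℕ r ∷ []
  star (suc j) v = v ∷ star j v

  star-isRow : ∀ j (v : Fin n) → IsRow r j (star j (toℕ v))
  star-isRow zero    v = root
  star-isRow (suc j) v = above v (star-isRow j v)

  df : Row
  df = firstOr [] rows

  df∈rows : df ∈ˡ rows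
  df∈rows = go rows (allRows-complete (star-isRow k r))
    where
    go : ∀ {l} (xs : List Row) → l ∈ˡ xs → firstOr [] xs ∈ˡ xs
    go (x ∷ xs) _ = here refl

  df-isRow : IsRow r k df
  df-isRow = allRows-sound k df∈rows

  open Encoding d m D D-d X Xs X-Xs r r∈X k df public
  open Existence Xs D A (V (suc k)) df M (λ _ _ → refl) using (trivially; everything-decomposable; everything-∋)

  M⊆H : ∀ {u v} → Adj M u v → Adj (graph H) u v
  M⊆H s with direct-elim (T⇒≡ s)
  ... | u≢v , far = direct-edge d m H ind u≢v far

  pairs : List (ℕ × Row)
  pairs = allPairs (V n) rows

  U : ℕ → List Part
  U = bags pairs

  U-sound : ∀ s {τ} → τ ∈ˡ U s → List.length τ ≡ s × All (λ p → proj₁ p ∈ˡ V n × IsRow r k (proj₂ p)) τ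
  U-sound s τ∈ with bags-sound s τ∈
  ... | len , ok = len , All.map (λ p∈ → let a , b = ∈-pairs p∈ in a , allRows-sound k b) ok

  U-complete : ∀ s {τ} → List.length τ ≡ s → All (λ p → proj₁ p ∈ˡ V n × IsRow r k (proj₂ p)) τ → τ ∈ˡ U s
  U-complete s len ok = bags-complete len (All.map (λ (a , b) → pairs-∈ a (allRows-complete b)) ok)

  module R s = Rounds (IsRow r k) df-isRow s (U s) (U-sound s) (U-complete s)

  star-feasible : Feasible everything [] (star k)
  star-feasible .extends {u} e = ⊥-elim (find-[] e)
    where
    opaque
      unfolding find
      find-[] : ∀ {v l} → find [] v ≡ just l → ⊥
      find-[] ()
  star-feasible .unaries {v} _ = unary-intro λ _ → head-in k 1≤k
    where
    head-in : ∀ j → 1 ℕ.≤ j → isIn (toℕ v) (star j (toℕ v)) ≡ true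
    head-in (suc j) _ = isIn-here
  star-feasible .edges {v} {u} _ s = agree-intro (positions k)
    where
    v≢u : v ≢ u
    v≢u = adj≢ d m M s
    apart : ∀ {x y} → x ≢ y → between (toℕ x) (toℕ y) (toℕ x) ≡ false
    apart {x} {y} x≢y = trans (between-≤ x y x) (¬true λ e → x≢y (d-≤0 (ℚ.≤-trans
      (ℚ.≤-trans (ℚ.≤-reflexive (sym (ℚ.+-identityʳ _))) (ℚ.+-monoʳ-≤ (d x y) (d-pos y x)))
      (ℚ.≤-trans (≤ᵇ-true e) (ℚ.≤-reflexive (d-refl x))))))
    positions : ∀ j i → i ℕ.< suc j → at 0 (star j (toℕ v)) i ≡ at 0 (star j (toℕ u)) i ⊎
      between (toℕ v) (toℕ u) (at 0 (star j (toℕ v)) i) ≡ false × between (toℕ u) (toℕ v) (at 0 (star j (toℕ u)) i) ≡ false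
    positions zero    i lt = inj₁ refl
    positions (suc j) zero lt = inj₂ (trans (cong (between (toℕ v) (toℕ u)) at-zero) (apart v≢u)
                                     , trans (cong (between (toℕ u) (toℕ v)) at-zero) (apart (v≢u ∘ sym)))
    positions (suc j) (suc i) (s≤s lt) with positions j i lt
    ... | inj₁ p = inj₁ (trans (at-suc i) (trans p (sym (at-suc i))))
    ... | inj₂ (p , q) = inj₂ (trans (cong (between (toℕ v) (toℕ u)) (at-suc i)) p
                              , trans (cong (between (toℕ u) (toℕ v)) (at-suc i)) q)

  record Optimal (lab : Lab) : Set where
    field
      feas : Feasible everything [] (at df lab)
      isRows : All (IsRow r k) lab
      size : List.length lab ≡ n
      least : ∀ {ℓ} → Feasible everything [] ℓ → (∀ (v : Fin n) → IsRow r k (ℓ (toℕ v))) →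
              ∑ (priceOf (at df lab)) ℚ.≤ ∑ (priceOf ℓ)

  everything-∑ : ∀ ℓ → ∑ ([ mem everything ] priceOf ℓ) ≡ ∑ (priceOf ℓ)
  everything-∑ ℓ = ∑-cong λ v → if-true (everything-∋ v)

  no-find : ∀ {v} → find [] v ≡ nothing
  no-find = isJust-false (trans (isJust-find [] _) isIn-[])

  length-V : ∀ {m} → List.length (V m) ≡ m
  length-V {m} = length-tabulate {n = m} toℕ

  solve-optimal : ∀ s {lab} → solve (U s) ≡ just lab → Optimal lab
  solve-optimal s {lab} e = record
    { feas = best-feasible everything [] (R.tab s (V n)) e
    ; isRows = R.best-rows s (V n) [] e
    ; size = R.best-length s (V n) e
    ; least = λ {ℓ} fe ro → least fe ro
    }
    where
    least : ∀ {ℓ} → Feasible everything [] ℓ → (∀ (v : Fin n) → IsRow r k (ℓ (toℕ v))) →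
            ∑ (priceOf (at df lab)) ℚ.≤ ∑ (priceOf ℓ)
    least {ℓ} fe ro with R.optimal s (V n) (R.best-decomposable s (V n) e) ro (λ _ → no-find) fe
    ... | lab′ , e′ , le with trans (sym e) e′
    ... | refl = ℚ.≤-trans (ℚ.≤-reflexive (sym (everything-∑ (at df lab))))
                   (ℚ.≤-trans (ℚ.≤-reflexive (sym (total-∑ everything lab)))
                   (ℚ.≤-trans le (ℚ.≤-reflexive (everything-∑ ℓ))))

  s* : ℕ
  s* = n ℕ.⊓ suc ω

  succeeds : ∃[ lab ] solve (U s*) ≡ just lab
  succeeds with R.optimal s* (V n) {everything} {[]} {star k}
                  (subst (λ j → Decomposable s* (suc j) everything) (sym length-V) dec)
                  (star-isRow k) (λ _ → no-find) star-feasible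
    where
    dec : Decomposable s* (suc n) everything
    dec with ℕ.⊓-sel n (suc ω)
    ... | inj₁ e = subst (λ s → Decomposable s (suc n) everything) (sym e) (trivially n)
    ... | inj₂ e = subst (λ s → Decomposable s (suc n) everything) (sym e) (everything-decomposable M⊆H td r)
  ... | lab , e , _ = lab , e

  data State (i : ℕ) : List Part × Maybe Lab → Set where
    found     : ∀ {j lab} → j ℕ.≤ s* → Optimal lab → State i (U j , just lab)
    searching : i ℕ.< s* → State i (U i , nothing)

  search-start : State 0 ([] ∷ [] , nothing)
  search-start = searching (ℕ.⊓-glb (ℕ.≤-trans (s≤s z≤n) (Fin.toℕ<n r)) (s≤s z≤n))

  search-step : ∀ {i acc} → State i acc → State (suc i) (searchStep pairs acc)
  search-step (found le opt) = found le opt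
  search-step {i} (searching lt) with solve (U (suc i)) in e
  ... | just lab = found lt (solve-optimal (suc i) e)
  ... | nothing with ℕ.m≤n⇒m<n∨m≡n lt
  ... | inj₁ lt′ = searching lt′
  ... | inj₂ eq with trans (sym e) (trans (cong (λ s → solve (U s)) eq) (proj₂ succeeds))
  ... | ()

  search-states : ∀ (xs : List ℕ) → State (List.length xs) (foldr (λ _ acc → searchStep pairs acc) ([] ∷ [] , nothing) xs)
  search-states []       = search-start
  search-states (x ∷ xs) = search-step (search-states xs)

  conclude : ∀ {i acc} → State i acc → s* ℕ.≤ i → ∃[ lab ] (proj₂ acc ≡ just lab × Optimal lab)
  conclude (found _ opt)  _  = _ , refl , opt
  conclude (searching lt) le = ⊥-elim (ℕ.<-irrefl refl (ℕ.<-≤-trans lt le))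

  search-result : ∃[ lab ] (proj₂ (search pairs) ≡ just lab × Optimal lab)
  search-result = conclude {acc = search pairs} (search-states (V n)) (ℕ.≤-trans (ℕ.m⊓n≤m n (suc ω)) (ℕ.≤-reflexive (sym (length-V {n}))))

  solution-tree : ∃[ S ] (IsMinimumHopSteinerTree d X r k S ×
                    solutionVal S ≡ enc solᵗ (output (caseM [] id (proj₂ (search pairs)))))
  solution-tree with search-result
  ... | lab , e , opt = T.S , record
      { isHopSteinerTree = T.isHopSteiner
      ; minimum = λ S′ st → let module F = FromTree S′ st in
          ℚ.≤-trans T.cost-S (ℚ.≤-trans (Optimal.least opt F.feasible F.ℓ-isRow) F.cost-ℓ)
      }
    , trans (cong₂ pair vertices-enc (cong listVal edges-enc)) (cong (λ m → enc solᵗ (output (caseM [] id m))) (sym e))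
    where
    module T = ToTree (at df lab) (λ v → at-All df-isRow (Optimal.isRows opt) (toℕ v)) (Optimal.feas opt)
    toList-tab : ∀ {A : Set} {m} (f : Fin m → A) → Vec.toList (Vec.tabulate f) ≡ tabulate f
    toList-tab {m = zero}  f = refl
    toList-tab {m = suc m} f = cong (f zero ∷_) (toList-tab (f ∘ suc))
    vertices-enc : subsetVal (Vec.tabulate T.W) ≡ listVal (map boolVal (map (λ v → isIn v (at df lab v)) (V n)))
    vertices-enc = cong (listVal ∘ map boolVal)
      (trans (toList-tab T.W) (sym (map-tabulate toℕ (λ v → isIn v (at df lab v)))))
    edges-enc : tabulate (λ u → listVal (tabulate λ v → boolVal (adj (edges T.S) u v))) ≡
                map (λ l → listVal (map boolVal l)) (mat (V n) (edgeB (at df lab)))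
    edges-enc = sym (trans (sym (map-∘ (V n))) (trans (map-tabulate toℕ _) (tab λ u →
      cong listVal (trans (sym (map-∘ (V n))) (map-tabulate toℕ (λ v → boolVal (edgeB (at df lab) (toℕ u) v)))))))
      where
      tab : ∀ {A : Set} {m} {f g : Fin m → A} → (∀ v → f v ≡ g v) → tabulate f ≡ tabulate g
      tab {m = zero}  p = refl
      tab {m = suc m} p = cong₂ _∷_ (p zero) (tab (p ∘ suc))

  opaque
    unfolding general

    -- The program takes the positions from the length of the default row.
    general-value : general (V n) D Xs rows ≡ output (caseM [] id (proj₂ (search pairs)))
    general-value = cong (λ ps → Solver.output (V n) Xs D A ps df (caseM [] id (proj₂ (Solver.search (V n) Xs D A ps df pairs))))
      (trans (iota-V df) (cong V (row-length df-isRow)))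

length-extend : ∀ {A : Set} (xs : List A) ts → List.length (extend xs ts) ≡ List.length ts * List.length xs
length-extend xs ts = trans (length-flatten (map (λ t → map (λ x → x ∷ t) xs) ts) each)
                            (cong (_* List.length xs) (length-map _ ts))
  where
  each : ∀ {zs} → zs ∈ˡ map (λ t → map (λ x → x ∷ t) xs) ts → List.length zs ≡ List.length xs
  each zs∈ with ∈-map⁻ (λ t → map (λ x → x ∷ t) xs) zs∈
  ... | t , _ , refl = length-map _ xs

length-bags : ∀ {A : Set} (xs : List A) i → List.length (bags xs i) ≡ List.length xs ^ i
length-bags xs zero    = refl
length-bags xs (suc i) = trans (length-extend xs (bags xs i))
  (trans (cong (_* List.length xs) (length-bags xs i)) (ℕ.*-comm (List.length xs ^ i) _))

length-allRows : ∀ n r k → List.length (allRows (V n) r k) ≡ n ^ k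
length-allRows n r zero    = refl
length-allRows n r (suc k) = trans (length-extend (V n) (allRows (V n) r k))
  (trans (cong₂ _*_ (length-allRows n r k) (length-tabulate {n = n} toℕ)) (ℕ.*-comm (n ^ k) n))

length-allPairs : ∀ vs rows → List.length (allPairs vs rows) ≡ List.length vs * List.length rows
length-allPairs vs rows = trans (length-flatten (map (λ v → map (λ l → v , l) rows) vs) each)
                                (cong (_* List.length rows) (length-map _ vs))
  where
  each : ∀ {zs} → zs ∈ˡ map (λ v → map (λ l → v , l) rows) vs → List.length zs ≡ List.length rows
  each zs∈ with ∈-map⁻ (λ v → map (λ l → v , l) rows) zs∈
  ... | t , _ , refl = length-map _ rows

check : ∀ {A} → Analysis A → Deg A → ℕ → Bool
check {A} r d t = Analysis.ok r ∧ leᵈ A (Analysis.deg r) d ∧ (Analysis.time r ℕ.≤ᵇ t)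

module Timing (N : ℕ) (2≤N : 2 ≤ N) where

  open Bounds N 2≤N public

  weaken : ∀ {A x c d t} t′ → T (t ℕ.≤ᵇ t′) → RunsAs {A} x c d t → RunsAs {A} x c d t′
  weaken {t = t} t′ p (runs f q) = runs f (≼-mono (ℕ.≤ᵇ⇒≤ t t′ p) q)

  within : ∀ {Γ A} (e : Exp Γ A) {ρ δ} → FitsEnv ρ δ → ∀ d t → T (check (analyse e δ) d t) → Runs e ρ d t
  within {A = A} e {δ = δ} fe d t p with T-both {Analysis.ok (analyse e δ)} p
  ... | p₁ , p′ with T-both {leᵈ A (Analysis.deg (analyse e δ)) d} p′
  ... | p₂ , p₃ with analyse-sound e fe p₁
  ... | runs f q = runs (fits-le A _ d p₂ f) (≼-mono (ℕ.≤ᵇ⇒≤ _ t p₃) q)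

  -- A `let` and an argument of a call cost the same number of steps.
  bind : ∀ {A B x y c c′ d d′ t t′} → RunsAs {A} x c d t → RunsAs {B} y c′ d′ t′ →
         RunsAs {B} y (suc (1 + c + c′)) d′ (suc (suc t ⊞ t′))
  bind (runs _ q) (runs f q′) = runs f (≼-suc (≼-plus (≼-suc q) q′))

  V-fits : ∀ m {a} → m ≼ a → Fits (listᵗ natᵗ) (V m) (a , a)
  V-fits m p = ≼-trans (ℕ.≤-reflexive (length-tabulate {n = m} toℕ)) p
             , All.tabulate λ x∈ → let v , e = V-∈ x∈ in
                 ≼-trans (ℕ.≤-trans (ℕ.≤-reflexive e) (ℕ.<⇒≤ (Fin.toℕ<n v))) p

  iota-fits : ∀ {A : Set} (xs : List A) {a} → List.length xs ≼ a → Fits (listᵗ natᵗ) (iota xs) (a , a)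
  iota-fits xs p = subst (λ l → Fits (listᵗ natᵗ) l _) (sym (iota-V xs)) (V-fits _ p)

  iota-runs : ∀ {Γ A} (e : Exp Γ (listᵗ A)) {ρ δ d t} → FitsEnv ρ δ → Runs e ρ (1 , d) t →
              Runs (iotaᵉ e) ρ (1 , 1) (suc (suc t ⊞ 19))
  iota-runs {A = A} e {ρ} {δ} {d} fe re =
    runs-fold {e = e} {nilᵉ} {body} {ρ} {j = 0} {13} (λ ys acc → acc ≡ iota ys) refl
      (λ {_} {ys} x∈ lt eq → cong (λ acc → 0 ∷ map suc acc) eq
                  , quick (weaken 13 tt (analyse-sound body
                      (subst (λ l → Fits (listᵗ natᵗ) l (1 , 1)) (sym eq)
                             (iota-fits ys (≼-trans (ℕ.<⇒≤ lt) (proj₁ (fits re))))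
                       ∷ All.lookup (proj₂ (fits re)) x∈ ∷ fe) tt)))
      (λ eq → iota-fits (eval e ρ) (proj₁ (fits re)))
      re ≼-1
    where
    body : Exp (vsᵗ ∷ A ∷ _) vsᵗ
    body = consᵉ zeroᵉ (mapᵉ x0 (sucᵉ x0))

  flatten-runs : ∀ {Γ A} (e : Exp Γ (listᵗ (listᵗ A))) {ρ a b d t d′} → Runs e ρ (a , b , d) t →
                 Fits (listᵗ A) (eval (flattenᵉ e) ρ) d′ →
                 Runs (flattenᵉ e) ρ d′ (suc (suc t ⊞ (suc a + (4 + (8 + b)))))
  flatten-runs {A = A} e {ρ} {b = b} re fin =
    runs-fold {e = e} {nilᵉ} {foldᵉ x1 x0 (consᵉ x1 x0)} {ρ} {j = 0} {8 + b} (λ _ _ → ⊤) tt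
      (λ {x} {_} {acc} x∈ _ _ → tt , ≼-suc (≼-suc (≼-suc (copy x acc (proj₁ (All.lookup (proj₂ (fits re)) x∈))))))
      (λ _ → fin) re ≼-1
    where
    copy : ∀ (x : List ⟦ A ⟧) (acc : List ⟦ A ⟧) → List.length x ≼ b →
           foldSteps (λ y ys → y ∷ ys) acc 1 (λ _ _ → 3) x ≼ 5 + b
    copy x acc p = ≼-mono (ℕ.≤-reflexive (ℕ.+-comm (suc b) 4))
      (≼-trans (proj₂ (foldSteps-≤ {K = 3} (λ _ _ → ⊤) tt x (λ _ _ _ → tt , ℕ.≤-refl) (s≤s z≤n)))
               (≼-times (≼-suc p) (≼-const 4 (ℕ.m≤m+n 11 5))))

  extend-runs : ∀ {A xs ts a b c dA d′} → Fits (listᵗ A) xs (a , dA) → Fits (listᵗ (listᵗ A)) ts (b , c , dA) →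
                Fits (listᵗ (listᵗ A)) (extend xs ts) d′ →
                Runs (extendᵉ {A}) (ts ∷ xs ∷ []) d′ _
  extend-runs {A} {xs} {ts} fx ft fin = flatten-runs (mapᵉ x0 (mapᵉ x2 (consᵉ x0 x1))) {ts ∷ xs ∷ []}
    (analyse-sound (mapᵉ x0 (mapᵉ x2 (consᵉ x0 x1))) (ft ∷ fx ∷ []) tt) fin

  prob-deg : Deg probᵗ
  prob-deg = (1 , 1) , (1 , tt) , (1 , 1 , tt) , (1 , 1 , tt) , (1 , 1) , (1 , 1)

  bags-deg : Deg (listᵗ partᵗ)
  bags-deg = 4 , 1 , 1 , 1 , 1

  res-deg : Deg (resᵗ)
  res-deg = bags-deg , (1 , 1 , 1)

  module _ {pairs : ⟦ partᵗ ⟧} {P : ⟦ probᵗ ⟧} (fpairs : Fits partᵗ pairs (2 , 1 , 1 , 1)) (fP : Fits probᵗ P prob-deg) where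

    module _ (solver : Exp (listᵗ partᵗ ∷ probᵗ ∷ []) (maybeᵗ labᵗ)) where

      found-steps : ∀ {us lab} → Fits (resᵗ) (us , just lab) res-deg →
                    steps (searchStepᵉ solver) ((us , just lab) ∷ pairs ∷ P ∷ []) ≼ 250
      found-steps {us} {lab} f = quick (weaken 250 tt
        (branchʳ {B = resᵗ} {x1} {lab ∷ (us , just lab) ∷ pairs ∷ P ∷ []} {d = res-deg} {d′ = res-deg} {j = 0}
          (quick (analyse-sound (sndᵉ x0) env tt))
          (analyse-sound x1 env′ tt)))
        where
        env : FitsEnv ((us , just lab) ∷ pairs ∷ P ∷ []) (res-deg ∷ (2 , 1 , 1 , 1) ∷ prob-deg ∷ [])
        env = f ∷ fpairs ∷ fP ∷ []
        env′ : FitsEnv (lab ∷ (us , just lab) ∷ pairs ∷ P ∷ []) ((1 , 1 , 1) ∷ res-deg ∷ (2 , 1 , 1 , 1) ∷ prob-deg ∷ [])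
        env′ = proj₂ f ∷ env

      searching-steps : ∀ {us} → Fits (listᵗ partᵗ) us bags-deg → Fits (listᵗ partᵗ) (extend pairs us) bags-deg →
                        (∀ {us} → Fits (listᵗ partᵗ) us bags-deg → Runs solver (us ∷ P ∷ []) (1 , 1 , 1) 200) →
                        steps (searchStepᵉ solver) ((us , nothing) ∷ pairs ∷ P ∷ []) ≼ 250
      searching-steps {us} f next solver-runs = quick (weaken 250 tt
        (branchˡ {B = resᵗ} {letᵉ (callᵉ (x1 ▸ fstᵉ x0 ▸ ∙) extendᵉ) (pairᵉ x0 (callᵉ (x3 ▸ x0 ▸ ∙) solver))}
                 {_∷_ {x = resᵗ} (us , nothing) (pairs ∷ P ∷ [])} {d = res-deg} {d′ = res-deg} {l = 0}
          (quick (analyse-sound (sndᵉ x0) env tt))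
          (bind (bind (analyse-sound x1 env tt) (bind (analyse-sound (fstᵉ x0) env tt) (extend-runs {natᵗ ×ᵗ rowᵗ} {pairs} {us} {2} {4} {1} {1 , 1 , 1} {bags-deg} fpairs f next)))
                (runs {A = resᵗ} {extend pairs us , eval solver (extend pairs us ∷ P ∷ [])} {d = res-deg}
                  (next , fits r)
                  (≼-suc (≼-plus ≼-1 (quick (bind (analyse-sound x3 env′ tt) (bind (analyse-sound x0 env′ tt) r)))))))))
        where
        r : Runs solver (extend pairs us ∷ P ∷ []) (1 , 1 , 1) 200
        r = solver-runs next
        env : FitsEnv {resᵗ ∷ partᵗ ∷ probᵗ ∷ []} ((us , nothing) ∷ pairs ∷ P ∷ []) (res-deg ∷ (2 , 1 , 1 , 1) ∷ prob-deg ∷ [])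
        env = (f , tt) ∷ fpairs ∷ fP ∷ []
        env′ : FitsEnv {listᵗ partᵗ ∷ resᵗ ∷ partᵗ ∷ probᵗ ∷ []} (extend pairs us ∷ (us , nothing) ∷ pairs ∷ P ∷ []) (bags-deg ∷ res-deg ∷ (2 , 1 , 1 , 1) ∷ prob-deg ∷ [])
        env′ = next ∷ env

    module _ (step : Exp (resᵗ ∷ partᵗ ∷ probᵗ ∷ []) (resᵗ))
             (St : ℕ → ⟦ resᵗ ⟧ → Set) (st₀ : St 0 ([] ∷ [] , nothing))
             (st-fits : ∀ {i acc} → St i acc → Fits (resᵗ) acc res-deg)
             (st-steps : ∀ {i acc} → St i acc → steps step (acc ∷ pairs ∷ P ∷ []) ≼ 250)
             (st-next : ∀ {i acc} → St i acc → St (suc i) (eval step (acc ∷ pairs ∷ P ∷ []))) where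

      search-runs : Runs (searchᵉ step) (pairs ∷ P ∷ []) res-deg 300
      search-runs =
        weaken 300 tt (runs-fold {e = vsᵉ x1} {initial} {callᵉ (x3 ▸ x2 ▸ x0 ▸ ∙) step}
          {pairs ∷ P ∷ []} {l = 260}
          (λ ys acc → St (List.length ys) acc) st₀
          (λ {x} {ys} {acc} x∈ lt st → st-next st
            , quick (weaken 260 tt (bind (analyse-sound x3 (env x∈ st) tt) (bind (analyse-sound x2 (env x∈ st) tt)
                (bind (analyse-sound x0 (env x∈ st) tt) (runs {A = boolᵗ} {x = true} {d = tt} tt (st-steps st)))))))
          st-fits
          (analyse-sound (vsᵉ x1) env₀ tt)
          (quick (analyse-sound initial env₀ tt)))
        where
        initial : Exp (partᵗ ∷ probᵗ ∷ []) resᵗ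
        initial = pairᵉ (consᵉ nilᵉ nilᵉ) noneᵉ
        env₀ : FitsEnv (pairs ∷ P ∷ []) ((2 , 1 , 1 , 1) ∷ prob-deg ∷ [])
        env₀ = fpairs ∷ fP ∷ []
        env : ∀ {x i acc} → x ∈ˡ proj₁ P → St i acc →
              FitsEnv (acc ∷ x ∷ pairs ∷ P ∷ []) (res-deg ∷ 1 ∷ (2 , 1 , 1 , 1) ∷ prob-deg ∷ [])
        env x∈ st = st-fits st ∷ All.lookup (proj₂ (proj₁ fP)) x∈ ∷ env₀

  opaque
    unfolding solveᵉ

    solve-runs : ∀ {us P} → Fits (listᵗ partᵗ) us bags-deg → Fits probᵗ P prob-deg →
                 Runs solveᵉ (us ∷ P ∷ []) (1 , 1 , 1) 200
    solve-runs {us} {P} f fP = within solveᵉ env (1 , 1 , 1) 200 tt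
      where
      env : FitsEnv (us ∷ P ∷ []) (bags-deg ∷ prob-deg ∷ [])
      env = f ∷ fP ∷ []

  module _ {Γ : Cx} {A₁ A₂ B : Type} {a₁ : Exp Γ A₁} {a₂ : Exp Γ A₂} {b : Exp (A₂ ∷ A₁ ∷ []) B}
           {ρ : Vals Γ} {v₁ : ⟦ A₁ ⟧} {v₂ : ⟦ A₂ ⟧} where

    call₂-value : eval a₁ ρ ≡ v₁ → eval a₂ ρ ≡ v₂ → eval (callᵉ (a₁ ▸ a₂ ▸ ∙) b) ρ ≡ eval b (v₂ ∷ v₁ ∷ [])
    call₂-value refl refl = refl

    call₂-runs : ∀ {d₁ d₂ d t₁ t₂ t} → eval a₁ ρ ≡ v₁ → eval a₂ ρ ≡ v₂ → Runs a₁ ρ d₁ t₁ → Runs a₂ ρ d₂ t₂ → Runs b (v₂ ∷ v₁ ∷ []) d t →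
                 Runs (callᵉ (a₁ ▸ a₂ ▸ ∙) b) ρ d (suc (suc t₁ ⊞ suc (suc t₂ ⊞ t)))
    call₂-runs refl refl r₁ r₂ r = bind r₁ (bind r₂ r)

  module _ {Γ : Cx} {A₁ A₂ A₃ B : Type} {a₁ : Exp Γ A₁} {a₂ : Exp Γ A₂} {a₃ : Exp Γ A₃} {b : Exp (A₃ ∷ A₂ ∷ A₁ ∷ []) B}
           {ρ : Vals Γ} {v₁ : ⟦ A₁ ⟧} {v₂ : ⟦ A₂ ⟧} {v₃ : ⟦ A₃ ⟧} where

    call₃-value : eval a₁ ρ ≡ v₁ → eval a₂ ρ ≡ v₂ → eval a₃ ρ ≡ v₃ →
                  eval (callᵉ (a₁ ▸ a₂ ▸ a₃ ▸ ∙) b) ρ ≡ eval b (v₃ ∷ v₂ ∷ v₁ ∷ [])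
    call₃-value refl refl refl = refl

    call₃-runs : ∀ {d₁ d₂ d₃ d t₁ t₂ t₃ t} → eval a₁ ρ ≡ v₁ → eval a₂ ρ ≡ v₂ → eval a₃ ρ ≡ v₃ →
                 Runs a₁ ρ d₁ t₁ → Runs a₂ ρ d₂ t₂ → Runs a₃ ρ d₃ t₃ → Runs b (v₃ ∷ v₂ ∷ v₁ ∷ []) d t →
                 Runs (callᵉ (a₁ ▸ a₂ ▸ a₃ ▸ ∙) b) ρ d (suc (suc t₁ ⊞ suc (suc t₂ ⊞ suc (suc t₃ ⊞ t))))
    call₃-runs refl refl refl r₁ r₂ r₃ r = bind r₁ (bind r₂ (bind r₃ r))

  main-steps : ∀ {body w₀ w₁ ws R t} → steps body ((w₀ ∷ w₁ ∷ ws , R) ∷ []) ≼ t →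
               steps (mainᵉ body) ((w₀ ∷ w₁ ∷ ws , R) ∷ []) ≼ 8 + t
  main-steps q = ≼-suc (≼-suc (≼-suc (≼-suc (≼-suc (≼-suc (≼-suc (≼-suc q)))))))

  inst-deg : Deg instᵗ
  inst-deg = (1 , 1 , tt) , (1 , tt) , 1 , 1

  opaque
    unfolding outputᵉ

    output-runs : ∀ {res pairs P rows vs inst} → Fits resᵗ res res-deg → Fits partᵗ pairs (2 , 1 , 1 , 1) →
                  Fits probᵗ P prob-deg → Fits labᵗ rows (1 , 1 , 1) → Fits vsᵗ vs (1 , 1) → Fits instᵗ inst inst-deg →
                  Runs (callᵉ (x2 ▸ caseMᵉ (sndᵉ x0) nilᵉ x0 ▸ ∙) outputᵉ) (res ∷ pairs ∷ P ∷ rows ∷ vs ∷ inst ∷ [])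
                       ((1 , tt) , (1 , 1 , tt)) 100
    output-runs {res} {pairs} {P} {rows} {vs} {inst} f₁ f₂ f₃ f₄ f₅ f₆ =
      within (callᵉ (x2 ▸ caseMᵉ (sndᵉ x0) nilᵉ x0 ▸ ∙) outputᵉ) env ((1 , tt) , (1 , 1 , tt)) 100 tt
      where
      env : FitsEnv {resᵗ ∷ partᵗ ∷ probᵗ ∷ labᵗ ∷ vsᵗ ∷ instᵗ ∷ []} (res ∷ pairs ∷ P ∷ rows ∷ vs ∷ inst ∷ [])
                    (res-deg ∷ (2 , 1 , 1 , 1) ∷ prob-deg ∷ (1 , 1 , 1) ∷ (1 , 1) ∷ inst-deg ∷ [])
      env = f₁ ∷ f₂ ∷ f₃ ∷ f₄ ∷ f₅ ∷ f₆ ∷ []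

  general-runs : ∀ {points rows problem pairs result i v₁ v₂ v₃ v₄ v₅ d₁ d₂ d₃ d₄ d₅ d t₁ t₂ t₃ t₄ t₅ t} →
    eval points (i ∷ []) ≡ v₁ → Runs points (i ∷ []) d₁ t₁ →
    eval rows (v₁ ∷ i ∷ []) ≡ v₂ → Runs rows (v₁ ∷ i ∷ []) d₂ t₂ →
    eval problem (v₂ ∷ v₁ ∷ i ∷ []) ≡ v₃ → Runs problem (v₂ ∷ v₁ ∷ i ∷ []) d₃ t₃ →
    eval pairs (v₃ ∷ v₂ ∷ v₁ ∷ i ∷ []) ≡ v₄ → Runs pairs (v₃ ∷ v₂ ∷ v₁ ∷ i ∷ []) d₄ t₄ →
    eval result (v₄ ∷ v₃ ∷ v₂ ∷ v₁ ∷ i ∷ []) ≡ v₅ → Runs result (v₄ ∷ v₃ ∷ v₂ ∷ v₁ ∷ i ∷ []) d₅ t₅ →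
    Runs (callᵉ (x2 ▸ caseMᵉ (sndᵉ x0) nilᵉ x0 ▸ ∙) outputᵉ) (v₅ ∷ v₄ ∷ v₃ ∷ v₂ ∷ v₁ ∷ i ∷ []) d t →
    Runs (generalᵉ points rows problem pairs result) (i ∷ []) d
         (suc (suc t₁ ⊞ suc (suc t₂ ⊞ suc (suc t₃ ⊞ suc (suc t₄ ⊞ suc (suc t₅ ⊞ t))))))
  general-runs refl r₁ refl r₂ refl r₃ refl r₄ refl r₅ r₆ = bind r₁ (bind r₂ (bind r₃ (bind r₄ (bind r₅ r₆))))

at-toList : ∀ {m} (Y : Subset m) v → at false (Vec.toList Y) (toℕ v) ≡ lookup Y v
at-toList (x Vec.∷ Y) zero    = at-zero
at-toList (x Vec.∷ Y) (suc v) = trans (at-suc (toℕ v)) (at-toList Y v)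

length-toList : ∀ {m} (Y : Subset m) → List.length (Vec.toList Y) ≡ m
length-toList Vec.[]      = refl
length-toList (x Vec.∷ Y) = cong suc (length-toList Y)

step-value : ∀ {vs X D A ps df p} → p ≡ (vs , X , D , A , ps , df) → ∀ pairs acc →
             eval (searchStepᵉ solveᵉ) (acc ∷ pairs ∷ p ∷ []) ≡ Solver.searchStep vs X D A ps df pairs acc
step-value {vs} {X} {D} {A} {ps} {df} refl = eval-searchStep vs X D A ps df

-- Every size that occurs in a run is at most a fixed power of n ^ (ω * k).
module General {n} (2≤n : 2 ≤ n) (d : Fin n → Fin n → ℚ) (m : Metric d)
               (W : List (List (Maybe ℚ))) (length-W : List.length W ≡ n) (rows-W : All (λ l → List.length l ≡ n) W)
               (D-d : ∀ u v → entry 0ℚ (distances (V n) W) (toℕ u) (toℕ v) ≡ d u v)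
               (X : Subset n) (r : Fin n) (r∈X : r Subset.∈ X) (k : ℕ) (1≤k : 1 ≤ k)
               (H : WeightedGraph n) (ind : Induces H d) (ω : ℕ) (1≤ω : 1 ≤ ω)
               (td : TreeDecomposition (graph H) ω) where

  Xs : List Bool
  Xs = Vec.toList X

  open Search d m (distances (V n) W) D-d X Xs (at-toList X) r r∈X k 1≤k H ind td

  instance
    n≢0 : ℕ.NonZero n
    n≢0 = ℕ.>-nonZero (ℕ.≤-trans (s≤s z≤n) 2≤n)

  N : ℕ
  N = n ^ (ω * k)

  1≤ωk : 1 ≤ ω * k
  1≤ωk = ℕ.*-mono-≤ 1≤ω 1≤k

  k≤ωk : k ≤ ω * k
  k≤ωk = ℕ.m≤n*m k ω ⦃ ℕ.>-nonZero 1≤ω ⦄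

  ω≤ωk : ω ≤ ω * k
  ω≤ωk = ℕ.m≤m*n ω k ⦃ ℕ.>-nonZero 1≤k ⦄

  n^≤N : ∀ {i} → i ≤ ω * k → n ^ i ≤ N
  n^≤N = ℕ.^-monoʳ-≤ n

  2≤N : 2 ≤ N
  2≤N = ℕ.≤-trans 2≤n (ℕ.≤-trans (ℕ.≤-reflexive (sym (ℕ.*-identityʳ n))) (n^≤N 1≤ωk))

  open Timing N 2≤N

  ≼1 : ∀ {j} → j ≤ N → j ≼ 1
  ≼1 p = le (ℕ.≤-trans p (ℕ.≤-reflexive (sym (ℕ.*-identityʳ N))))

  n≼ : n ≼ 1
  n≼ = ≼1 (ℕ.≤-trans (ℕ.≤-reflexive (sym (ℕ.*-identityʳ n))) (n^≤N 1≤ωk))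

  exp-≤ : ∀ i → suc i ≤ 2 ^ i
  exp-≤ zero    = s≤s z≤n
  exp-≤ (suc i) = ℕ.≤-trans (ℕ.+-mono-≤ (ℕ.m^n>0 2 i) (exp-≤ i))
                            (ℕ.≤-reflexive (cong (2 ^ i +_) (sym (ℕ.+-identityʳ _))))

  suc-≼ : ∀ {i} → i ≤ ω * k → suc i ≼ 1
  suc-≼ {i} p = ≼1 (ℕ.≤-trans (exp-≤ i) (ℕ.≤-trans (ℕ.^-monoˡ-≤ i 2≤n) (n^≤N p)))

  code-≼ : ∀ {x} → x ∈ˡ V n → x ≼ 1
  code-≼ x∈ = All.lookup (proj₂ (V-fits n n≼)) x∈

  row-fits : ∀ {j l} → j ≤ k → IsRow r j l → Fits rowᵗ l (1 , 1)
  row-fits {j} {l} j≤k p = ≼-trans (ℕ.≤-reflexive (row-length p)) (suc-≼ (ℕ.≤-trans j≤k k≤ωk)) , go p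
    where
    go : ∀ {j l} → IsRow r j l → All (_≼ 1) l
    go root        = code-≼ (∈-V r) ∷ []
    go (above v p) = code-≼ (∈-V v) ∷ go p

  rows-fits : ∀ {j} → j ≤ k → Fits labᵗ (allRows (V n) (toℕ r) j) (1 , 1 , 1)
  rows-fits {j} j≤k = ≼-trans (ℕ.≤-reflexive (length-allRows n (toℕ r) j)) (≼1 (n^≤N (ℕ.≤-trans j≤k k≤ωk)))
                    , All.tabulate λ l∈ → row-fits j≤k (allRows-sound j l∈)

  pairs-fits : Fits partᵗ pairs (2 , 1 , 1 , 1)
  pairs-fits = ≼-trans (ℕ.≤-reflexive (length-allPairs (V n) rows))
                 (≼-times {a = 1} {1} (proj₁ (V-fits n n≼)) (proj₁ (rows-fits ℕ.≤-refl)))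
             , All.tabulate λ p∈ → let a , b = ∈-pairs p∈ in
                 code-≼ a , row-fits ℕ.≤-refl (allRows-sound k b)

  pairs-≤ : ∀ {s} → s ≤ suc ω → List.length pairs ^ s ≼ 4
  pairs-≤ {s} s≤ = le (ℕ.≤-trans (ℕ.≤-reflexive (trans (cong (_^ s) count) (ℕ.^-*-assoc n (suc k) s)))
    (ℕ.≤-trans (ℕ.^-monoʳ-≤ n exponent) (ℕ.≤-reflexive (sym (ℕ.^-*-assoc n (ω * k) 4)))))
    where
    count : List.length pairs ≡ n ^ suc k
    count = trans (length-allPairs (V n) rows) (cong₂ _*_ (length-V {n}) (length-allRows n (toℕ r) k))
    double : ∀ {a} → 1 ≤ a → suc a ≤ a * 2
    double {a} p = ℕ.≤-trans (ℕ.+-monoˡ-≤ a p) (ℕ.≤-reflexive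
      (trans (cong (a +_) (sym (ℕ.+-identityʳ a))) (ℕ.*-comm 2 a)))
    exponent : suc k * s ≤ ω * k * 4
    exponent = ℕ.≤-trans (ℕ.*-mono-≤ (double 1≤k) (ℕ.≤-trans s≤ (double 1≤ω)))
      (ℕ.≤-reflexive (trans (ℕ.[m*n]*[o*p]≡[m*o]*[n*p] k 2 ω 2) (cong (_* 4) (ℕ.*-comm k ω))))

  U-fits : ∀ {s} → s ≤ suc ω → Fits (listᵗ partᵗ) (U s) (4 , 1 , 1 , 1 , 1)
  U-fits {s} s≤ = ≼-trans (ℕ.≤-reflexive (length-bags pairs s)) (pairs-≤ s≤)
    , All.tabulate λ τ∈ → let len , ok = U-sound s τ∈ in
        ≼-trans (ℕ.≤-reflexive len) (≼-trans s≤ (suc-≼ ω≤ωk))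
      , All.map (λ (a , b) → code-≼ a , row-fits ℕ.≤-refl b) ok

  inst : ⟦ instᵗ ⟧
  inst = W , Xs , toℕ r , k

  fits-⊤ : ∀ {A : Set} (xs : List A) → All (λ _ → ⊤) xs
  fits-⊤ xs = All.tabulate λ _ → tt

  all-⊤ : ∀ (l : List (Maybe ℚ)) → All (λ x → Fits (maybeᵗ ratᵗ) x tt) l
  all-⊤ []            = []
  all-⊤ (nothing ∷ l) = tt ∷ all-⊤ l
  all-⊤ (just q ∷ l)  = tt ∷ all-⊤ l

  inst-fits : Fits instᵗ inst inst-deg
  inst-fits = (≼-trans (ℕ.≤-reflexive length-W) n≼
              , All.map (λ {l} e → ≼-trans (ℕ.≤-reflexive e) n≼ , all-⊤ l) rows-W)
            , (≼-trans (ℕ.≤-reflexive (length-toList X)) n≼ , fits-⊤ Xs)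
            , code-≼ (∈-V r)
            , ≼-trans (ℕ.n≤1+n k) (suc-≼ k≤ωk)

  vs-fits : Fits vsᵗ (V n) (1 , 1)
  vs-fits = V-fits n n≼

  allRows-runs : Runs allRowsᵉ (k ∷ toℕ r ∷ V n ∷ []) (1 , 1 , 1) 40
  allRows-runs = weaken 40 tt (runs-iter {e = x0} {consᵉ (consᵉ x1 nilᵉ) nilᵉ} {callᵉ (x3 ▸ x0 ▸ ∙) extendᵉ}
      {k ∷ toℕ r ∷ V n ∷ []} {l = 30}
      (λ j acc → acc ≡ allRows (V n) (toℕ r) j) refl
      (λ { {j} {acc} j<k refl → refl , quick (weaken 30 tt (bind (analyse-sound x3 (env j<k) tt) (bind (analyse-sound x0 (env j<k) tt)
            (extend-runs {natᵗ} {V n} {acc} {1} {1} {1} {1} {1 , 1 , 1} vs-fits (rows-fits (ℕ.<⇒≤ j<k)) (rows-fits j<k))))) })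
      (λ { refl → rows-fits ℕ.≤-refl })
      (analyse-sound x0 env₀ tt)
      (quick (analyse-sound (consᵉ (consᵉ x1 nilᵉ) nilᵉ) env₀ tt)))
    where
    env₀ : FitsEnv (k ∷ toℕ r ∷ V n ∷ []) (1 ∷ 1 ∷ (1 , 1) ∷ [])
    env₀ = ≼-trans (ℕ.n≤1+n k) (suc-≼ k≤ωk) ∷ code-≼ (∈-V r) ∷ vs-fits ∷ []
    env : ∀ {j} → j ℕ.< k → FitsEnv (allRows (V n) (toℕ r) j ∷ k ∷ toℕ r ∷ V n ∷ []) ((1 , 1 , 1) ∷ 1 ∷ 1 ∷ (1 , 1) ∷ [])
    env j<k = rows-fits (ℕ.<⇒≤ j<k) ∷ env₀

  prob : List ℕ → ⟦ probᵗ ⟧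
  prob ps = V n , Xs , distances (V n) W , A , ps , df

  opaque
    unfolding distancesᵉ

    problem-runs : Runs problemᵉ (rows ∷ V n ∷ inst ∷ []) prob-deg 150
    problem-runs = weaken 150 tt (bind r₁ (bind r₂ (bind r₃ (analyse-sound final env₃ tt))))
      where
      e₁ : Exp (labᵗ ∷ vsᵗ ∷ instᵗ ∷ []) (listᵗ (listᵗ ratᵗ))
      e₁ = callᵉ (x1 ▸ fstᵉ x2 ▸ ∙) distancesᵉ
      D₁ : List (List ℚ)
      D₁ = eval e₁ (rows ∷ V n ∷ inst ∷ [])
      env₀ : FitsEnv {labᵗ ∷ vsᵗ ∷ instᵗ ∷ []} (rows ∷ V n ∷ inst ∷ []) ((1 , 1 , 1) ∷ (1 , 1) ∷ inst-deg ∷ [])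
      env₀ = rows-fits ℕ.≤-refl ∷ vs-fits ∷ inst-fits ∷ []
      r₁ : Runs e₁ (rows ∷ V n ∷ inst ∷ []) (1 , 1 , tt) 100
      r₁ = within e₁ env₀ (1 , 1 , tt) 100 tt
      env₁ : FitsEnv {listᵗ (listᵗ ratᵗ) ∷ labᵗ ∷ vsᵗ ∷ instᵗ ∷ []} (D₁ ∷ rows ∷ V n ∷ inst ∷ [])
                     ((1 , 1 , tt) ∷ (1 , 1 , 1) ∷ (1 , 1) ∷ inst-deg ∷ [])
      env₁ = fits r₁ ∷ env₀
      e₂ : Exp (listᵗ (listᵗ ratᵗ) ∷ labᵗ ∷ vsᵗ ∷ instᵗ ∷ []) rowᵗ
      e₂ = caseLᵉ x1 nilᵉ x0
      r₂ : Runs e₂ (D₁ ∷ rows ∷ V n ∷ inst ∷ []) (1 , 1) 10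
      r₂ = within e₂ env₁ (1 , 1) 10 tt
      env₂ : FitsEnv {rowᵗ ∷ listᵗ (listᵗ ratᵗ) ∷ labᵗ ∷ vsᵗ ∷ instᵗ ∷ []} (df ∷ D₁ ∷ rows ∷ V n ∷ inst ∷ [])
                     ((1 , 1) ∷ (1 , 1 , tt) ∷ (1 , 1 , 1) ∷ (1 , 1) ∷ inst-deg ∷ [])
      env₂ = fits r₂ ∷ env₁
      r₃ : Runs (iotaᵉ x0) (df ∷ D₁ ∷ rows ∷ V n ∷ inst ∷ []) (1 , 1) 30
      r₃ = weaken 30 tt (iota-runs x0 env₂ (analyse-sound x0 env₂ tt))
      env₃ : FitsEnv {vsᵗ ∷ rowᵗ ∷ listᵗ (listᵗ ratᵗ) ∷ labᵗ ∷ vsᵗ ∷ instᵗ ∷ []} (iota df ∷ df ∷ D₁ ∷ rows ∷ V n ∷ inst ∷ [])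
                     ((1 , 1) ∷ (1 , 1) ∷ (1 , 1 , tt) ∷ (1 , 1 , 1) ∷ (1 , 1) ∷ inst-deg ∷ [])
      env₃ = fits r₃ ∷ env₂
      final : Exp (vsᵗ ∷ rowᵗ ∷ listᵗ (listᵗ ratᵗ) ∷ labᵗ ∷ vsᵗ ∷ instᵗ ∷ []) probᵗ
      final = pairᵉ x4 (pairᵉ (fstᵉ (sndᵉ x5)) (pairᵉ x2 (pairᵉ (callᵉ (x4 ▸ x2 ▸ ∙) irreducibleᵉ) (pairᵉ x0 x1))))

  problem-value : eval problemᵉ (rows ∷ V n ∷ inst ∷ []) ≡ prob (V (suc k))
  problem-value = trans (eval-problem rows (V n) W Xs (toℕ r) k)
    (cong prob (trans (iota-V df) (cong V (row-length df-isRow))))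

  prob-fits : Fits probᵗ (prob (V (suc k))) prob-deg
  prob-fits = subst (λ p → Fits probᵗ p prob-deg) problem-value (fits problem-runs)

  pairs-runs : Runs pairsᵉ (rows ∷ V n ∷ inst ∷ []) (2 , 1 , 1 , 1) 40
  pairs-runs = weaken 40 tt (flatten-runs e {rows ∷ V n ∷ inst ∷ []}
    (analyse-sound e (rows-fits ℕ.≤-refl ∷ vs-fits ∷ inst-fits ∷ []) tt) pairs-fits)
    where
    e : Exp (labᵗ ∷ vsᵗ ∷ instᵗ ∷ []) (listᵗ partᵗ)
    e = mapᵉ x1 (mapᵉ x1 (pairᵉ x1 x0))

  lab-fits : ∀ {lab} → Optimal lab → Fits labᵗ lab (1 , 1 , 1)
  lab-fits opt = ≼-trans (ℕ.≤-reflexive (Optimal.size opt)) n≼ , All.map (row-fits ℕ.≤-refl) (Optimal.isRows opt)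

  s*≤ : s* ≤ suc ω
  s*≤ = ℕ.m⊓n≤n n (suc ω)

  state-fits : ∀ {i acc} → State i acc → Fits (resᵗ) acc res-deg
  state-fits (found {j} j≤ opt) = U-fits {j} (ℕ.≤-trans j≤ s*≤) , lab-fits opt
  state-fits {i} (searching lt) = U-fits {i} (ℕ.≤-trans (ℕ.<⇒≤ lt) s*≤) , tt

  P : ⟦ probᵗ ⟧
  P = prob (V (suc k))

  states-quick : ∀ {i acc} → State i acc → steps (searchStepᵉ solveᵉ) (acc ∷ pairs ∷ P ∷ []) ≼ 250
  states-quick (found {j} {lab} j≤ opt) =
    found-steps {pairs} {P} pairs-fits prob-fits solveᵉ {U j} {lab} (U-fits {j} (ℕ.≤-trans j≤ s*≤) , lab-fits opt)
  states-quick {i} (searching lt) =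
    searching-steps {pairs} {P} pairs-fits prob-fits solveᵉ {U i} (U-fits {i} (ℕ.≤-trans (ℕ.<⇒≤ lt) s*≤)) next
      (λ {us} f → solve-runs {us} {P} f prob-fits)
    where
    next : Fits (listᵗ partᵗ) (extend pairs (U i)) bags-deg
    next = U-fits {suc i} (ℕ.≤-trans lt s*≤)

  state-next : ∀ {i acc} → State i acc → State (suc i) (eval (searchStepᵉ solveᵉ) (acc ∷ pairs ∷ P ∷ []))
  state-next {i} {acc} st = subst (State (suc i)) (sym (step-value refl pairs acc)) (search-step st)

  search-timed : Runs (searchᵉ (searchStepᵉ solveᵉ)) (pairs ∷ P ∷ []) res-deg 300
  search-timed = search-runs {pairs} {P} pairs-fits prob-fits (searchStepᵉ solveᵉ) State search-start
    (λ {i} {acc} → state-fits {i} {acc}) states-quick state-next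

  points-value : eval pointsᵉ (inst ∷ []) ≡ V n
  points-value = trans (iota-V W) (cong V length-W)

  program-runs : Runs programᵉ (inst ∷ []) ((1 , tt) , (1 , 1 , tt)) 350
  program-runs = weaken 350 tt (general-runs {points = pointsᵉ} {callRowsᵉ} {callProblemᵉ} {callPairsᵉ} {callSearchᵉ} {inst}
      {V n} {rows} {P} {pairs} {eval (searchᵉ (searchStepᵉ solveᵉ)) (pairs ∷ P ∷ [])}
      points-value (iota-runs (fstᵉ x0) env₁ (analyse-sound (fstᵉ x0) env₁ tt))
      (call₃-value {a₁ = x0} {fstᵉ (sndᵉ (sndᵉ x1))} {sndᵉ (sndᵉ (sndᵉ x1))} {allRowsᵉ} {V n ∷ inst ∷ []} refl refl refl)
      (call₃-runs {a₁ = x0} {fstᵉ (sndᵉ (sndᵉ x1))} {sndᵉ (sndᵉ (sndᵉ x1))} {allRowsᵉ} {V n ∷ inst ∷ []} refl refl refl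
         (analyse-sound x0 env₂ tt) (analyse-sound (fstᵉ (sndᵉ (sndᵉ x1))) env₂ tt)
         (analyse-sound (sndᵉ (sndᵉ (sndᵉ x1))) env₂ tt) allRows-runs)
      (trans (call₃-value {a₁ = x2} {x1} {x0} {problemᵉ} {rows ∷ V n ∷ inst ∷ []} refl refl refl) problem-value)
      (call₃-runs {a₁ = x2} {x1} {x0} {problemᵉ} {rows ∷ V n ∷ inst ∷ []} refl refl refl
         (analyse-sound x2 env₃ tt) (analyse-sound x1 env₃ tt) (analyse-sound x0 env₃ tt) problem-runs)
      (call₃-value {a₁ = x3} {x2} {x1} {pairsᵉ} {P ∷ rows ∷ V n ∷ inst ∷ []} refl refl refl)
      (call₃-runs {a₁ = x3} {x2} {x1} {pairsᵉ} {P ∷ rows ∷ V n ∷ inst ∷ []} refl refl refl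
         (analyse-sound x3 env₄ tt) (analyse-sound x2 env₄ tt) (analyse-sound x1 env₄ tt) pairs-runs)
      (call₂-value {a₁ = x1} {x0} {searchᵉ (searchStepᵉ solveᵉ)} {pairs ∷ P ∷ rows ∷ V n ∷ inst ∷ []} refl refl)
      (call₂-runs {a₁ = x1} {x0} {searchᵉ (searchStepᵉ solveᵉ)} {pairs ∷ P ∷ rows ∷ V n ∷ inst ∷ []} refl refl
         (analyse-sound x1 env₅ tt) (analyse-sound x0 env₅ tt) search-timed)
      (output-runs {eval (searchᵉ (searchStepᵉ solveᵉ)) (pairs ∷ P ∷ [])} {pairs} {P} {rows} {V n} {inst} (fits search-timed) pairs-fits prob-fits
         (rows-fits ℕ.≤-refl) vs-fits inst-fits))
    where
    env₁ : FitsEnv {instᵗ ∷ []} (inst ∷ []) (inst-deg ∷ [])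
    env₁ = inst-fits ∷ []
    env₂ : FitsEnv {vsᵗ ∷ instᵗ ∷ []} (V n ∷ inst ∷ []) ((1 , 1) ∷ inst-deg ∷ [])
    env₂ = vs-fits ∷ env₁
    env₃ : FitsEnv {labᵗ ∷ vsᵗ ∷ instᵗ ∷ []} (rows ∷ V n ∷ inst ∷ []) ((1 , 1 , 1) ∷ (1 , 1) ∷ inst-deg ∷ [])
    env₃ = rows-fits ℕ.≤-refl ∷ env₂
    env₄ : FitsEnv {probᵗ ∷ labᵗ ∷ vsᵗ ∷ instᵗ ∷ []} (P ∷ rows ∷ V n ∷ inst ∷ [])
                   (prob-deg ∷ (1 , 1 , 1) ∷ (1 , 1) ∷ inst-deg ∷ [])
    env₄ = prob-fits ∷ env₃
    env₅ : FitsEnv {partᵗ ∷ probᵗ ∷ labᵗ ∷ vsᵗ ∷ instᵗ ∷ []} (pairs ∷ P ∷ rows ∷ V n ∷ inst ∷ [])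
                   ((2 , 1 , 1 , 1) ∷ prob-deg ∷ (1 , 1 , 1) ∷ (1 , 1) ∷ inst-deg ∷ [])
    env₅ = pairs-fits ∷ env₄

  quick-run : steps programᵉ (inst ∷ []) ≤ N ^ 350
  quick-run = power {steps programᵉ (inst ∷ [])} {350} (quick program-runs)

weights : ∀ {n} → WeightedGraph n → List (List (Maybe ℚ))
weights G = tabulate λ u → tabulate λ v → if adj (graph G) u v then just (weight G u v) else nothing

weights-entry : ∀ {n} (G : WeightedGraph n) u v → entry nothing (weights G) (toℕ u) (toℕ v) ≡
                (if adj (graph G) u v then just (weight G u v) else nothing)
weights-entry G u v =
  trans (cong (λ l → at nothing l (toℕ v))
              (at-tabulate {d = []} (λ u → tabulate λ v → if adj (graph G) u v then just (weight G u v) else nothing) u))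
        (at-tabulate (λ v → if adj (graph G) u v then just (weight G u v) else nothing) v)

weights-enc : ∀ {n} (G : WeightedGraph n) → enc (listᵗ (listᵗ (maybeᵗ ratᵗ))) (weights G) ≡ weightedGraphVal G
weights-enc G = cong listVal (trans (map-tabulate _ (enc (listᵗ (maybeᵗ ratᵗ)))) (tabulate-cong λ u →
  cong listVal (trans (map-tabulate _ (enc (maybeᵗ ratᵗ))) (tabulate-cong λ v → choose (adj (graph G) u v) (weight G u v)))))
  where
  choose : ∀ b w → enc (maybeᵗ ratᵗ) (if b then just w else nothing) ≡ (if b then inr (rat w) else inl tt)
  choose true  w = refl
  choose false w = refl

input : Ren (instᵗ ∷ []) (Instance ∷ [])
input (here refl) = here refl

program : Algorithm
program = compile (mainᵉ programᵉ) input

program-runs-in : ∀ inst → (enc instᵗ inst ∷ []) ⊢ program ⇓ enc solᵗ (solution inst) ∣ steps (mainᵉ programᵉ) (inst ∷ [])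
program-runs-in inst = subst (λ s → (enc instᵗ inst ∷ []) ⊢ program ⇓ enc solᵗ s ∣ steps (mainᵉ programᵉ) (inst ∷ []))
  (eval-main inst) (compile-sound (mainᵉ programᵉ) {input} {enc instᵗ inst ∷ []} {inst ∷ []} (agrees λ { (here refl) → refl }))

single-point : ∀ {n} → n ≡ 1 → ∀ (S : Subtree n) → solutionVal S ≡ enc solᵗ (true ∷ [] , (false ∷ []) ∷ [])
single-point refl S with vertices S | IsTree.nonempty (isTree S) | adj (edges S) zero zero | adj-irrefl (edges S) zero
... | true Vec.∷ Vec.[] | _ | .false | refl = refl
... | false Vec.∷ Vec.[] | zero , () | _ | _

returns : ∀ {n G X r k} (inst : ⟦ instᵗ ⟧) → enc instᵗ inst ≡ instanceVal {n} G X r k → ∀ (S : Subtree n) →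
          solutionVal S ≡ enc solᵗ (solution inst) → ∀ {b} → steps (mainᵉ programᵉ) (inst ∷ []) ≤ b →
          program on instanceVal G X r k returns solutionVal S within b
returns inst e S q le = steps (mainᵉ programᵉ) (inst ∷ []) ,
  subst₂ (λ x y → (x ∷ []) ⊢ program ⇓ y ∣ steps (mainᵉ programᵉ) (inst ∷ [])) e (sym q) (program-runs-in inst) , le

opaque
  C : ℕ
  C = 400

  358≤C : 358 ≤ C
  358≤C = ℕ.m≤m+n 358 42

≤C* : ∀ {n} e → n ≡ 1 → ∀ {s} → s ≤ 358 → s ≤ C * n ^ e
≤C* e refl {s} p = ℕ.≤-trans (ℕ.≤-trans p 358≤C)
  (ℕ.≤-reflexive (sym (trans (cong (C *_) (ℕ.^-zeroˡ e)) (ℕ.*-identityʳ C))))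

main-quick : ∀ {n} m → 2 ≤ n → 1 ≤ m → ∀ {body i w₀ w₁ ws R} → i ≡ (w₀ ∷ w₁ ∷ ws , R) →
             steps body (i ∷ []) ≤ (n ^ m) ^ 350 → steps (mainᵉ body) (i ∷ []) ≤ C * n ^ (C * m)
main-quick {n} m 2≤n 1≤m {body} {_} {w₀} {w₁} {ws} {R} refl q = ℕ.≤-trans
  (T._≼_.power (T.main-steps {body} {w₀} {w₁} {ws} {R} {350} (T.le q)))
  (ℕ.≤-trans (ℕ.≤-reflexive (trans (ℕ.^-*-assoc n m 358) (cong (n ^_) (ℕ.*-comm m 358))))
  (ℕ.≤-trans (ℕ.^-monoʳ-≤ n (ℕ.*-monoˡ-≤ m 358≤C))
             (ℕ.m≤n*m (n ^ (C * m)) C ⦃ ℕ.>-nonZero (ℕ.≤-trans (s≤s z≤n) 358≤C) ⦄)))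
  where
  instance
    n≢0 : ℕ.NonZero n
    n≢0 = ℕ.>-nonZero (ℕ.≤-trans (s≤s z≤n) 2≤n)
  2≤N : 2 ≤ n ^ m
  2≤N = ℕ.≤-trans 2≤n (ℕ.≤-trans (ℕ.≤-reflexive (sym (ℕ.*-identityʳ n))) (ℕ.^-monoʳ-≤ n 1≤m))
  module T = Timing (n ^ m) 2≤N

encodes-≡ : ∀ {n} {P : Subtree n → Set} {x y} → ∃[ S ] (P S × solutionVal S ≡ enc solᵗ x) → x ≡ y →
            ∃[ S ] (P S × solutionVal S ≡ enc solᵗ y)
encodes-≡ p refl = p

module Instance {n} (d : Fin n → Fin n → ℚ) (isMetric : IsMetric _≡_ d)
                (G : WeightedGraph n) (induces : Induces G d)
                (H : WeightedGraph n) (induces′ : Induces H d) (ω : ℕ) (1≤ω : 1 ≤ ω) (td : TreeDecomposition (graph H) ω)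
                (X : Subset n) (r : Fin n) (r∈X : r ∈ X) (k : ℕ) (1≤k : 1 ≤ k) where

  W : List (List (Maybe ℚ))
  W = weights G

  length-W : List.length W ≡ n
  length-W = length-tabulate {n = n} _

  rows-W : All (λ l → List.length l ≡ n) W
  rows-W = All.tabulate⁺ λ u → length-tabulate {n = n} _

  D-d : ∀ u v → entry 0ℚ (distances (V n) W) (toℕ u) (toℕ v) ≡ d u v
  D-d = Distances.distances-correct d (metric isMetric) G induces W (weights-entry G)

  inst : ⟦ instᵗ ⟧
  inst = W , Vec.toList X , toℕ r , k

  inst-enc : enc instᵗ inst ≡ instanceVal G X r k
  inst-enc = cong (λ w → pair w (pair (subsetVal X) (pair (nat (toℕ r)) (nat k)))) (weights-enc G)

  general-inst : general (iota W) (distances (iota W) W) (Vec.toList X) (allRows (iota W) (toℕ r) k) ≡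
                 general (V n) (distances (V n) W) (Vec.toList X) (allRows (V n) (toℕ r) k)
  general-inst = cong (λ vs → general vs (distances vs W) (Vec.toList X) (allRows vs (toℕ r) k))
                      (trans (iota-V W) (cong V length-W))

  tree : ∃[ S ] (IsMinimumHopSteinerTree d X r k S × solutionVal S ≡
                 enc solᵗ (general (iota W) (distances (iota W) W) (Vec.toList X) (allRows (iota W) (toℕ r) k)))
  tree = encodes-≡ (Search.solution-tree d (metric isMetric) (distances (V n) W) D-d X (Vec.toList X) (at-toList X) r r∈X k 1≤k H induces′ td)
                   (sym (trans general-inst (Search.general-value d (metric isMetric) (distances (V n) W) D-d X (Vec.toList X) (at-toList X) r r∈X k 1≤k H induces′ td)))

  quick-run : (2≤n : 2 ≤ n) → steps programᵉ (inst ∷ []) ≤ (n ^ (ω * k)) ^ 350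
  quick-run 2≤n = General.quick-run 2≤n d (metric isMetric) W length-W rows-W D-d X r r∈X k 1≤k H induces′ ω 1≤ω td

  Solved : Set
  Solved = Σ[ S ∈ Subtree n ] (IsMinimumHopSteinerTree d X r k S ×
    program on instanceVal G X r k returns solutionVal S within (C * n ^ (C * (ω * k))))

  one-point : n ≡ 1 → Solved
  one-point n≡1 = proj₁ tree , proj₁ (proj₂ tree) , returns {G = G} {X} {r} {k} inst inst-enc (proj₁ tree)
    (trans (single-point n≡1 (proj₁ tree)) (cong (enc solᵗ) (sym (value {W} {Vec.toList X} {toℕ r} {k} shape))))
    (≤C* (C * (ω * k)) n≡1 (short {programᵉ} {W} {Vec.toList X , toℕ r , k} shape))
    where
    shape : ∃[ w ] W ≡ w ∷ []
    shape with W | trans length-W n≡1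
    ... | w ∷ [] | _ = w , refl
    value : ∀ {W X r k} → ∃[ w ] W ≡ w ∷ [] → solution (W , X , r , k) ≡ (true ∷ [] , (false ∷ []) ∷ [])
    value (w , refl) = refl
    short : ∀ {body W R} → ∃[ w ] W ≡ w ∷ [] → steps (mainᵉ body) ((W , R) ∷ []) ≤ 358
    short (w , refl) = ℕ.≤ᵇ⇒≤ _ 358 tt

  more-points : 2 ≤ n → Solved
  more-points 2≤n = proj₁ tree , proj₁ (proj₂ tree) , returns {G = G} {X} {r} {k} inst inst-enc (proj₁ tree)
    (trans (proj₂ (proj₂ tree)) (cong (enc solᵗ) (sym (value {W} {Vec.toList X} {toℕ r} {k} shape))))
    (main-quick (ω * k) 2≤n (ℕ.*-mono-≤ 1≤ω 1≤k) {programᵉ} {inst}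
      (cong (λ w → w , Vec.toList X , toℕ r , k) (proj₂ (proj₂ (proj₂ shape)))) (quick-run 2≤n))
    where
    shape : ∃[ w₀ ] ∃[ w₁ ] ∃[ ws ] W ≡ w₀ ∷ w₁ ∷ ws
    shape with W | subst (2 ≤_) (sym length-W) 2≤n
    ... | w₀ ∷ []      | s≤s ()
    ... | w₀ ∷ w₁ ∷ ws | _ = w₀ , w₁ , ws , refl
    value : ∀ {W X r k} → ∃[ w₀ ] ∃[ w₁ ] ∃[ ws ] W ≡ w₀ ∷ w₁ ∷ ws →
            solution (W , X , r , k) ≡ general (iota W) (distances (iota W) W) X (allRows (iota W) r k)
    value (_ , _ , _ , refl) = refl

  solved : Solved
  solved with ℕ.m≤n⇒m<n∨m≡n (ℕ.≤-trans (s≤s z≤n) (Fin.toℕ<n r))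
  ... | inj₁ 1<n = more-points 1<n
  ... | inj₂ 1≡n = one-point (sym 1≡n)

theorem5p2 : Σ[ alg ∈ Algorithm ] Σ[ C ∈ ℕ ]
    (∀ (n : ℕ) (d : Fin n → Fin n → ℚ) → IsMetric _≡_ d →
    ∀ (G : WeightedGraph n) → Induces G d →
    ∀ (ω : ℕ) → 1 ≤ ω → MetricHasTreewidth d ω →
    ∀ (X : Subset n) (r : Fin n) → r ∈ X →
    ∀ (k : ℕ) → 1 ≤ k →
    Σ[ S ∈ Subtree n ]
    (IsMinimumHopSteinerTree d X r k S ×
    alg on instanceVal G X r k returns solutionVal S within (C * n ^ (C * (ω * k)))))
theorem5p2 = program , C , λ n d isMetric G induces ω 1≤ω (H , induces′ , td) X r r∈X k 1≤k →
  Instance.solved d isMetric G induces H induces′ ω 1≤ω td X r r∈X k 1≤k
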